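{- Let $K$ be a quadratic field with embeddings into $\mathbb{R}$ and $\mathbb{Q}_2$, and let $\alpha\in K\setminus\mathbb{Q}$ have property $I$. With $a_n(\alpha)$, $p'_n$, $q'_n$ and $\tau$ as defined in the context, there exists a constant $C>0$ such that for all $n\in\mathbb{Z}_{>0}$, $$\frac{C}{|q'_n|^{2}}<\left|\alpha_\infty-\frac{p'_n}{q'_n}\right|\left|\alpha_{\langle 2\rangle}-\frac{p'_n}{q'_n}\right|_2<\frac{2}{(1+\tau(n))\,|a_{n+1}(\alpha)|_2\,|q'_n|^2}.$$
   Context: $K$ is a quadratic field with fixed field embeddings $\sigma_\infty:K\to\mathbb{R}$ and $\sigma_2:K\to\mathbb{Q}_2$. For $\alpha\in K$ write $\alpha_\infty=\sigma_\infty(\alpha)$, $\alpha_{\langle 2\rangle}=\sigma_2(\alpha)$. $v_2$ is the $2$-adic valuation and $|u|_2=2^{ -v_2(u)}$; $|\cdot|$ is the real absolute value. For $u=\sum_{n}c_n2^n\in\mathbb{Q}_2$ with digits $c_n\in\{0,1\}$ ($c_n=0$ for $n<v_2(u)$), put $\lfloor u\rfloor_2=\sum_{n\le 0}c_n2^n\in\mathbb{Z}[1/2]$. Put $\tau(n)=0$ if $n$ is even, $\tau(n)=1$ if $n$ is odd. Property $I$: $\alpha_\infty\in(-1,1]$ and $v_2(\alpha_{\langle 2\rangle})>0$. For $\alpha\in K^\times$ let $a^{(0)}(\alpha)=2m+\lfloor(1/\alpha)_{\langle 2\rangle}\rfloor_2$, where $m$ is the smallest among the integers $i$ minimizing $|(1/\alpha)_\infty-2i-\lfloor(1/\alpha)_{\langle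 2\rangle}\rfloor_2|$; let $a^{(1)}(\alpha)=m'+\lfloor(1/\alpha)_{\langle 2\rangle}\rfloor_2$, where $m'$ is the smallest among the integers $i$ minimizing $|(1/\alpha)_\infty-i-\lfloor(1/\alpha)_{\langle 2\rangle}\rfloor_2|$. Put $T_{2,\epsilon}(\alpha)=\frac1\alpha-a^{(\epsilon)}(\alpha)$ for $\epsilon\in\{0,1\}$. Algorithm: $\alpha_{(1)}=\alpha$; for $n\ge1$, $a_n(\alpha)=a^{(\tau(n))}(\alpha_{(n)})$ and $\alpha_{(n+1)}=T_{2,\tau(n)}(\alpha_{(n)})$ (for $\alpha\in K\setminus\mathbb{Q}$ the algorithm never terminates). Convergents: $p_0=0$, $q_0=1$, and for $n\ge1$ $$\begin{pmatrix} p_{n-1} & p_n \\ q_{n-1} & q_n \end{pmatrix}=\begin{pmatrix} 0 & 1 \\ 1 & a_1(\alpha) \end{pmatrix}\cdots\begin{pmatrix} 0 & 1 \\ 1 & a_n(\alpha) \end{pmatrix};$$ $p_n,q_n\in\mathbb{Z}[1/2]$ and $q_n\ne0$. For $n\ge1$ put $p'_n=2^{ -\sum_{s=1}^n v_2(a_s(\alpha))}p_n$ and $q'_n=2^{ -\sum_{s=1}^n v_2(a_s(\alpha))}q_n$; these are coprime integers with $p'_n/q'_n=p_n/q_n$. -}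

module Defs where

open import Data.Nat as ℕ using (ℕ; zero; suc; z≤n; s≤s)
import Data.Nat.Properties as ℕ
open import Data.Nat.DivMod using (_/_; _%_; m≡m%n+[m/n]*n; m/n<m)
open import Data.Nat.Divisibility using (_∣_; divides; n∣m⇒m%n≡0; m∣m*n)
open import Data.Nat.Primality using (euclidsLemma; prime[2])
open import Data.Integer as ℤ using (ℤ; +_; -[1+_])
import Data.Integer.Properties as ℤ
open import Data.Rational as ℚ using (ℚ; mkℚ; 0ℚ; 1ℚ; ½; ↥_; ↧_; ↧ₙ_)
import Data.Rational.Properties as ℚ
open import Data.Rational.Unnormalised as ℚᵘ using (mkℚᵘ)
import Data.Rational.Unnormalised.Properties as ℚᵘ
open import Data.Rational.Solver using (module +-*-Solver)
open import Data.Empty using (⊥-elim)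
open import Data.Fin using (Fin; zero; suc; toℕ)
open import Data.Product using (Σ; ∃; ∃₂; _×_; _,_; proj₁; proj₂)
open import Data.Sum using (_⊎_; inj₁; inj₂)
open import Relation.Nullary using (¬_; Dec; yes; no)
open import Relation.Binary.PropositionalEquality
open import Algebra.Bundles using (CommutativeRing; RawRing)
open import Algebra.Morphism.Structures using (IsRingHomomorphism; IsRingMonomorphism)
open import Level using (Level; _⊔_; 0ℓ) renaming (suc to lsuc)

open +-*-Solver using (solve; _:+_; _:*_; :-_; _:-_; _:=_; con)

private variable
  c ℓ : Level

fromℤ : ℤ → ℚ
fromℤ i = i ℚ./ 1

fromℕ : ℕ → ℚ
fromℕ n = fromℤ (+ n)

infixl 7 _÷_

-- Division is total, with p ÷ 0 = 0.
_÷_ : ℚ → ℚ → ℚ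
p ÷ q with q ℚ.≟ 0ℚ
... | yes _   = 0ℚ
... | no  q≢0 = p ℚ.* (ℚ.1/ q) {{ℚ.≢-nonZero q≢0}}

infixr 8 _^_

_^_ : ℚ → ℕ → ℚ
x ^ zero  = 1ℚ
x ^ suc n = x ℚ.* x ^ n

2ℚ : ℚ
2ℚ = fromℕ 2

2^_ : ℤ → ℚ
2^ (+ n)    = 2ℚ ^ n
2^ -[1+ n ] = ½ ^ suc n

v₂-bounded : (bound n : ℕ) → ℕ
v₂-bounded zero    n = 0
v₂-bounded (suc b) n with n % 2
... | zero  = suc (v₂-bounded b (n / 2))
... | suc _ = 0

-- The exponent of 2 in n for n ≠ 0 (it is less than n, so n steps suffice);
-- v₂ℕ 0 = 0 is a junk value.
v₂ℕ : ℕ → ℕ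
v₂ℕ n = v₂-bounded n n

-- For x ≠ 0; v₂ 0ℚ = 0 is a junk value.
v₂ : ℚ → ℤ
v₂ x = + v₂ℕ ℤ.∣ ↥ x ∣ ℤ.- + v₂ℕ (↧ₙ x)

∣_∣₂ : ℚ → ℚ
∣ x ∣₂ with x ℚ.≟ 0ℚ
... | yes _ = 0ℚ
... | no  _ = 2^ (ℤ.- v₂ x)

Odd : ℤ → Set
Odd a = ¬ 2 ∣ ℤ.∣ a ∣

v₂-bounded-spec : ∀ b n → n ≢ 0 → n ℕ.≤ b → ∃ λ o → ¬ 2 ∣ o × n ≡ 2 ℕ.^ v₂-bounded b n ℕ.* o
v₂-bounded-spec zero    zero    n≢0 n≤b = ⊥-elim (n≢0 refl)
v₂-bounded-spec (suc b) n       n≢0 n≤b with n % 2 in eq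
... | suc _ = n , (λ 2∣n → 0≢ (trans (sym (n∣m⇒m%n≡0 n 2 2∣n)) eq)) , sym (ℕ.*-identityˡ n)
  where
  0≢ : ∀ {k} → 0 ≡ suc k → _
  0≢ ()
... | zero  = o , odd , (begin
    n                                              ≡⟨ n≡h*2 ⟩
    h ℕ.* 2                                        ≡⟨ cong (ℕ._* 2) h≡ ⟩
    (2 ℕ.^ v₂-bounded b h ℕ.* o) ℕ.* 2             ≡⟨ ℕ.*-comm (2 ℕ.^ v₂-bounded b h ℕ.* o) 2 ⟩
    2 ℕ.* (2 ℕ.^ v₂-bounded b h ℕ.* o)             ≡⟨ ℕ.*-assoc 2 (2 ℕ.^ v₂-bounded b h) o ⟨
    2 ℕ.^ suc (v₂-bounded b h) ℕ.* o               ∎)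
  where
  open ≡-Reasoning
  h = n / 2
  n≡h*2 : n ≡ h ℕ.* 2
  n≡h*2 = trans (m≡m%n+[m/n]*n n 2) (cong (ℕ._+ h ℕ.* 2) eq)
  h≢0 : h ≢ 0
  h≢0 h≡0 = n≢0 (trans n≡h*2 (cong (ℕ._* 2) h≡0))
  h≤b : h ℕ.≤ b
  h≤b = ℕ.≤-pred (ℕ.≤-trans (m/n<m n 2 {{ℕ.≢-nonZero n≢0}} (s≤s (s≤s z≤n))) n≤b)
  ih = v₂-bounded-spec b h h≢0 h≤b
  o = proj₁ ih
  odd = proj₁ (proj₂ ih)
  h≡ = proj₂ (proj₂ ih)

v₂ℕ-spec : ∀ n → n ≢ 0 → ∃ λ o → ¬ 2 ∣ o × n ≡ 2 ℕ.^ v₂ℕ n ℕ.* o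
v₂ℕ-spec n n≢0 = v₂-bounded-spec n n n≢0 ℕ.≤-refl

odd-* : ∀ a b → Odd a → Odd b → Odd (a ℤ.* b)
odd-* a b oa ob 2∣ab with euclidsLemma ℤ.∣ a ∣ ℤ.∣ b ∣ prime[2] (subst (2 ∣_) (ℤ.abs-* a b) 2∣ab)
... | inj₁ p = oa p
... | inj₂ p = ob p

fromℤ-unnormalised : ∀ i → ℚ.toℚᵘ (fromℤ i) ℚᵘ.≃ mkℚᵘ i 0
fromℤ-unnormalised i = ℚ.toℚᵘ-fromℚᵘ (mkℚᵘ i 0)

fromℤ-injective : ∀ {i j} → fromℤ i ≡ fromℤ j → i ≡ j
fromℤ-injective {i} {j} eq with ℚᵘ.≃-trans (ℚᵘ.≃-sym (fromℤ-unnormalised i))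
  (ℚᵘ.≃-trans (ℚᵘ.≃-reflexive (cong ℚ.toℚᵘ eq)) (fromℤ-unnormalised j))
... | ℚᵘ.*≡* e = trans (sym (ℤ.*-identityʳ i)) (trans e (ℤ.*-identityʳ j))

fromℤ-* : ∀ i j → fromℤ (i ℤ.* j) ≡ fromℤ i ℚ.* fromℤ j
fromℤ-* i j = ℚ.toℚᵘ-injective (begin
  ℚ.toℚᵘ (fromℤ (i ℤ.* j))                      ≈⟨ fromℤ-unnormalised (i ℤ.* j) ⟩
  mkℚᵘ i 0 ℚᵘ.* mkℚᵘ j 0                        ≈⟨ ℚᵘ.*-cong (fromℤ-unnormalised i) (fromℤ-unnormalised j) ⟨
  ℚ.toℚᵘ (fromℤ i) ℚᵘ.* ℚ.toℚᵘ (fromℤ j)        ≈⟨ ℚ.toℚᵘ-homo-* (fromℤ i) (fromℤ j) ⟨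
  ℚ.toℚᵘ (fromℤ i ℚ.* fromℤ j)                  ∎)
  where open ℚᵘ.≃-Reasoning

fromℤ-+ : ∀ i j → fromℤ (i ℤ.+ j) ≡ fromℤ i ℚ.+ fromℤ j
fromℤ-+ i j = ℚ.toℚᵘ-injective (begin
  ℚ.toℚᵘ (fromℤ (i ℤ.+ j))                      ≈⟨ fromℤ-unnormalised (i ℤ.+ j) ⟩
  mkℚᵘ (i ℤ.+ j) 0                              ≈⟨ ℚᵘ.*≡* (cong (ℤ._* + 1) (sym (cong₂ ℤ._+_ (ℤ.*-identityʳ i) (ℤ.*-identityʳ j)))) ⟩
  mkℚᵘ i 0 ℚᵘ.+ mkℚᵘ j 0                        ≈⟨ ℚᵘ.+-cong (fromℤ-unnormalised i) (fromℤ-unnormalised j) ⟨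
  ℚ.toℚᵘ (fromℤ i) ℚᵘ.+ ℚ.toℚᵘ (fromℤ j)        ≈⟨ ℚ.toℚᵘ-homo-+ (fromℤ i) (fromℤ j) ⟨
  ℚ.toℚᵘ (fromℤ i ℚ.+ fromℤ j)                  ∎)
  where open ℚᵘ.≃-Reasoning

*-denominator : ∀ x → x ℚ.* fromℤ (↧ x) ≡ fromℤ (↥ x)
*-denominator x@(mkℚ n d-1 _) = ℚ.toℚᵘ-injective (begin
  ℚ.toℚᵘ (x ℚ.* fromℤ (↧ x))                    ≈⟨ ℚ.toℚᵘ-homo-* x (fromℤ (↧ x)) ⟩
  mkℚᵘ n d-1 ℚᵘ.* ℚ.toℚᵘ (fromℤ (↧ x))          ≈⟨ ℚᵘ.*-congˡ {mkℚᵘ n d-1} (fromℤ-unnormalised (↧ x)) ⟩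
  mkℚᵘ n d-1 ℚᵘ.* mkℚᵘ (↧ x) 0                  ≈⟨ ℚᵘ.*≡* (trans (ℤ.*-identityʳ _) (cong (n ℤ.*_) (sym (ℤ.*-identityʳ (↧ x))))) ⟩
  mkℚᵘ n 0                                      ≈⟨ fromℤ-unnormalised n ⟨
  ℚ.toℚᵘ (fromℤ (↥ x))                          ∎)
  where open ℚᵘ.≃-Reasoning

fromℤ-2^ : ∀ n → fromℤ (+ (2 ℕ.^ n)) ≡ 2^ (+ n)
fromℤ-2^ zero    = refl
fromℤ-2^ (suc n) = begin
  fromℤ (+ (2 ℕ.* 2 ℕ.^ n))           ≡⟨ cong fromℤ (ℤ.pos-* 2 (2 ℕ.^ n)) ⟩
  fromℤ (+ 2 ℤ.* + (2 ℕ.^ n))         ≡⟨ fromℤ-* (+ 2) (+ (2 ℕ.^ n)) ⟩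
  2ℚ ℚ.* fromℤ (+ (2 ℕ.^ n))          ≡⟨ cong (2ℚ ℚ.*_) (fromℤ-2^ n) ⟩
  2ℚ ℚ.* 2^ (+ n)                     ∎
  where open ≡-Reasoning

2^-suc : ∀ i → 2^ (ℤ.suc i) ≡ 2ℚ ℚ.* 2^ i
2^-suc (+ n)          = refl
2^-suc -[1+ zero ]    = refl
2^-suc -[1+ suc n ]   = begin
  ½ ^ suc n                       ≡⟨ ℚ.*-identityˡ (½ ^ suc n) ⟨
  (2ℚ ℚ.* ½) ℚ.* ½ ^ suc n        ≡⟨ ℚ.*-assoc 2ℚ ½ (½ ^ suc n) ⟩
  2ℚ ℚ.* (½ ℚ.* ½ ^ suc n)        ∎
  where open ≡-Reasoning

2^-pred : ∀ i → 2^ (ℤ.pred i) ≡ ½ ℚ.* 2^ i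
2^-pred i = begin
  2^ (ℤ.pred i)                         ≡⟨ ℚ.*-identityˡ _ ⟨
  (½ ℚ.* 2ℚ) ℚ.* 2^ (ℤ.pred i)          ≡⟨ ℚ.*-assoc ½ 2ℚ (2^ (ℤ.pred i)) ⟩
  ½ ℚ.* (2ℚ ℚ.* 2^ (ℤ.pred i))          ≡⟨ cong (½ ℚ.*_) (2^-suc (ℤ.pred i)) ⟨
  ½ ℚ.* 2^ (ℤ.suc (ℤ.pred i))           ≡⟨ cong (λ k → ½ ℚ.* 2^ k) (ℤ.suc-pred i) ⟩
  ½ ℚ.* 2^ i                            ∎
  where open ≡-Reasoning

2^-+ : ∀ i j → 2^ (i ℤ.+ j) ≡ 2^ i ℚ.* 2^ j
2^-+ (+ zero) j = trans (cong 2^_ (ℤ.+-identityˡ j)) (sym (ℚ.*-identityˡ (2^ j)))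
2^-+ (+ suc n) j = begin
  2^ (+ suc n ℤ.+ j)                    ≡⟨ cong 2^_ (ℤ.suc-+ n j) ⟩
  2^ (ℤ.suc (+ n ℤ.+ j))                ≡⟨ 2^-suc (+ n ℤ.+ j) ⟩
  2ℚ ℚ.* 2^ (+ n ℤ.+ j)                 ≡⟨ cong (2ℚ ℚ.*_) (2^-+ (+ n) j) ⟩
  2ℚ ℚ.* (2^ (+ n) ℚ.* 2^ j)            ≡⟨ ℚ.*-assoc 2ℚ (2^ (+ n)) (2^ j) ⟨
  2^ (+ suc n) ℚ.* 2^ j                 ∎
  where open ≡-Reasoning
2^-+ -[1+ zero ] j = 2^-pred j
2^-+ -[1+ suc n ] j = begin
  2^ (-[1+ suc n ] ℤ.+ j)               ≡⟨ cong 2^_ (ℤ.+-assoc ℤ.-1ℤ -[1+ n ] j) ⟩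
  2^ (ℤ.pred (-[1+ n ] ℤ.+ j))          ≡⟨ 2^-pred (-[1+ n ] ℤ.+ j) ⟩
  ½ ℚ.* 2^ (-[1+ n ] ℤ.+ j)             ≡⟨ cong (½ ℚ.*_) (2^-+ -[1+ n ] j) ⟩
  ½ ℚ.* (2^ -[1+ n ] ℚ.* 2^ j)          ≡⟨ ℚ.*-assoc ½ (2^ -[1+ n ]) (2^ j) ⟨
  2^ -[1+ suc n ] ℚ.* 2^ j              ∎
  where open ≡-Reasoning

^-positive : ∀ x → 0ℚ ℚ.< x → ∀ n → 0ℚ ℚ.< x ^ n
^-positive x 0<x zero    = ℚ.positive⁻¹ 1ℚ
^-positive x 0<x (suc n) = subst (ℚ._< x ℚ.* x ^ n) (ℚ.*-zeroʳ x)
  (ℚ.*-monoʳ-<-pos x {{ℚ.positive 0<x}} (^-positive x 0<x n))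

2^-positive : ∀ i → 0ℚ ℚ.< 2^ i
2^-positive (+ n)    = ^-positive 2ℚ (ℚ.positive⁻¹ 2ℚ) n
2^-positive -[1+ n ] = ^-positive ½ (ℚ.positive⁻¹ ½) (suc n)

1≤2^ : ∀ n → 1ℚ ℚ.≤ 2^ (+ n)
1≤2^ zero    = ℚ.≤-refl
1≤2^ (suc n) = begin
  1ℚ                    ≤⟨ 1≤2^ n ⟩
  2^ (+ n)              ≡⟨ ℚ.*-identityˡ (2^ (+ n)) ⟨
  1ℚ ℚ.* 2^ (+ n)       ≤⟨ ℚ.*-monoʳ-≤-nonNeg (2^ (+ n)) {{ℚ.nonNegative (ℚ.<⇒≤ (2^-positive (+ n)))}}
                             (ℚ.+-monoʳ-≤ 1ℚ (ℚ.nonNegative⁻¹ 1ℚ)) ⟩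
  2ℚ ℚ.* 2^ (+ n)       ∎
  where open ℚ.≤-Reasoning

2^-inverse : ∀ i → 2^ (ℤ.- i) ℚ.* 2^ i ≡ 1ℚ
2^-inverse i = trans (sym (2^-+ (ℤ.- i) i)) (cong 2^_ (ℤ.+-inverseˡ i))

odd-part : ∀ i → i ≢ + 0 → ∃ λ a → Odd a × fromℤ i ≡ 2^ (+ v₂ℕ ℤ.∣ i ∣) ℚ.* fromℤ a
odd-part i i≢0 with v₂ℕ-spec ℤ.∣ i ∣ (λ e → i≢0 (ℤ.∣i∣≡0⇒i≡0 e))
... | o , odd , eq = go i eq
  where
  k = v₂ℕ ℤ.∣ i ∣
  scaled : ∀ a → fromℤ (+ (2 ℕ.^ k) ℤ.* a) ≡ 2^ (+ k) ℚ.* fromℤ a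
  scaled a = trans (fromℤ-* (+ (2 ℕ.^ k)) a) (cong (ℚ._* fromℤ a) (fromℤ-2^ k))
  go : ∀ j → ℤ.∣ j ∣ ≡ 2 ℕ.^ k ℕ.* o → ∃ λ a → Odd a × fromℤ j ≡ 2^ (+ k) ℚ.* fromℤ a
  go (+ n) e = + o , odd ,
    trans (cong fromℤ (trans (cong +_ e) (ℤ.pos-* (2 ℕ.^ k) o))) (scaled (+ o))
  go -[1+ n ] e = ℤ.- + o , subst (λ m → ¬ 2 ∣ m) (sym (ℤ.∣-i∣≡∣i∣ (+ o))) odd ,
    trans (cong fromℤ (trans (cong (λ m → ℤ.- + m) e)
      (trans (cong ℤ.-_ (ℤ.pos-* (2 ℕ.^ k) o)) (ℤ.neg-distribʳ-* (+ (2 ℕ.^ k)) (+ o)))))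
      (scaled (ℤ.- + o))

-- x = 2ᵏ · a / b with a and b odd
record HasOrder (x : ℚ) (k : ℤ) : Set where
  constructor hasOrder
  field
    a b   : ℤ
    odd-a : Odd a
    odd-b : Odd b
    eq    : x ℚ.* fromℤ b ≡ 2^ k ℚ.* fromℤ a

hasOrder-v₂ : ∀ x → x ≢ 0ℚ → HasOrder x (v₂ x)
hasOrder-v₂ x x≢0 with odd-part (↥ x) (λ e → x≢0 (ℚ.↥p≡0⇒p≡0 x e)) | odd-part (↧ x) (λ ())
... | a , oa , ea | b , ob , eb = hasOrder a b oa ob (begin
  x ℚ.* fromℤ b                                     ≡⟨ ℚ.*-identityˡ _ ⟨
  1ℚ ℚ.* (x ℚ.* fromℤ b)                            ≡⟨ cong (ℚ._* (x ℚ.* fromℤ b)) (2^-inverse m) ⟨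
  (2^ (ℤ.- m) ℚ.* 2^ m) ℚ.* (x ℚ.* fromℤ b)         ≡⟨ solve 4 (λ s t u v → (s :* t) :* (u :* v) := (u :* (t :* v)) :* s) refl
                                                         (2^ (ℤ.- m)) (2^ m) x (fromℤ b) ⟩
  (x ℚ.* (2^ m ℚ.* fromℤ b)) ℚ.* 2^ (ℤ.- m)         ≡⟨ cong (λ z → (x ℚ.* z) ℚ.* 2^ (ℤ.- m)) eb ⟨
  (x ℚ.* fromℤ (↧ x)) ℚ.* 2^ (ℤ.- m)                ≡⟨ cong (ℚ._* 2^ (ℤ.- m)) (trans (*-denominator x) ea) ⟩
  (2^ n ℚ.* fromℤ a) ℚ.* 2^ (ℤ.- m)                 ≡⟨ solve 3 (λ s t u → (s :* t) :* u := (s :* u) :* t) refl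
                                                         (2^ n) (fromℤ a) (2^ (ℤ.- m)) ⟩
  (2^ n ℚ.* 2^ (ℤ.- m)) ℚ.* fromℤ a                 ≡⟨ cong (ℚ._* fromℤ a) (2^-+ n (ℤ.- m)) ⟨
  2^ (v₂ x) ℚ.* fromℤ a                             ∎)
  where
  open ≡-Reasoning
  m = + v₂ℕ (↧ₙ x)
  n = + v₂ℕ ℤ.∣ ↥ x ∣

2^-cancel : ∀ k x y → 2^ k ℚ.* x ≡ 2^ k ℚ.* y → x ≡ y
2^-cancel k x y e = trans (sym (undo x)) (trans (cong (2^ (ℤ.- k) ℚ.*_) e) (undo y))
  where
  undo : ∀ z → 2^ (ℤ.- k) ℚ.* (2^ k ℚ.* z) ≡ z
  undo z = trans (sym (ℚ.*-assoc (2^ (ℤ.- k)) (2^ k) z)) (trans (cong (ℚ._* z) (2^-inverse k)) (ℚ.*-identityˡ z))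

≤⇒+ : ∀ {i j} → i ℤ.≤ j → ∃ λ n → j ≡ i ℤ.+ + n
≤⇒+ {i} {j} i≤j = ℤ.∣ j ℤ.- i ∣ , (begin
  j                               ≡⟨ ℤ.+-identityˡ j ⟨
  + 0 ℤ.+ j                       ≡⟨ cong (ℤ._+ j) (ℤ.+-inverseʳ i) ⟨
  (i ℤ.- i) ℤ.+ j                 ≡⟨ ℤ.+-assoc i (ℤ.- i) j ⟩
  i ℤ.+ (ℤ.- i ℤ.+ j)             ≡⟨ cong (λ z → i ℤ.+ z) (ℤ.+-comm (ℤ.- i) j) ⟩
  i ℤ.+ (j ℤ.- i)                 ≡⟨ cong (λ z → i ℤ.+ z) (ℤ.0≤i⇒+∣i∣≡i (ℤ.i≤j⇒0≤j-i i≤j)) ⟨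
  i ℤ.+ + ℤ.∣ j ℤ.- i ∣           ∎)
  where open ≡-Reasoning

hasOrder-unique-≤ : ∀ x {k l} → k ℤ.≤ l → HasOrder x k → HasOrder x l → k ≡ l
hasOrder-unique-≤ x {k} {l} k≤l (hasOrder a b oa ob e) (hasOrder a′ b′ oa′ ob′ e′) with ≤⇒+ k≤l
... | zero , l≡ = sym (trans l≡ (ℤ.+-identityʳ k))
... | suc n , l≡ = ⊥-elim (odd-* a b′ oa ob′ even)
  where
  open ≡-Reasoning
  cross : fromℤ (a ℤ.* b′) ≡ fromℤ (+ (2 ℕ.^ suc n) ℤ.* (a′ ℤ.* b))
  cross = 2^-cancel k _ _ (begin
    2^ k ℚ.* fromℤ (a ℤ.* b′)                                     ≡⟨ cong (2^ k ℚ.*_) (fromℤ-* a b′) ⟩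
    2^ k ℚ.* (fromℤ a ℚ.* fromℤ b′)                               ≡⟨ ℚ.*-assoc (2^ k) (fromℤ a) (fromℤ b′) ⟨
    (2^ k ℚ.* fromℤ a) ℚ.* fromℤ b′                               ≡⟨ cong (ℚ._* fromℤ b′) e ⟨
    (x ℚ.* fromℤ b) ℚ.* fromℤ b′                                  ≡⟨ solve 3 (λ s t u → (s :* t) :* u := (s :* u) :* t) refl
                                                                       x (fromℤ b) (fromℤ b′) ⟩
    (x ℚ.* fromℤ b′) ℚ.* fromℤ b                                  ≡⟨ cong (ℚ._* fromℤ b) e′ ⟩
    (2^ l ℚ.* fromℤ a′) ℚ.* fromℤ b                               ≡⟨ cong (λ z → (2^ z ℚ.* fromℤ a′) ℚ.* fromℤ b) l≡ ⟩
    (2^ (k ℤ.+ + suc n) ℚ.* fromℤ a′) ℚ.* fromℤ b                 ≡⟨ cong (λ z → (z ℚ.* fromℤ a′) ℚ.* fromℤ b) (2^-+ k (+ suc n)) ⟩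
    ((2^ k ℚ.* 2^ (+ suc n)) ℚ.* fromℤ a′) ℚ.* fromℤ b            ≡⟨ solve 4 (λ s t u v → ((s :* t) :* u) :* v := s :* (t :* (u :* v))) refl
                                                                       (2^ k) (2^ (+ suc n)) (fromℤ a′) (fromℤ b) ⟩
    2^ k ℚ.* (2^ (+ suc n) ℚ.* (fromℤ a′ ℚ.* fromℤ b))            ≡⟨ cong (2^ k ℚ.*_) (cong₂ ℚ._*_ (fromℤ-2^ (suc n)) (fromℤ-* a′ b)) ⟨
    2^ k ℚ.* (fromℤ (+ (2 ℕ.^ suc n)) ℚ.* fromℤ (a′ ℤ.* b))       ≡⟨ cong (2^ k ℚ.*_) (fromℤ-* (+ (2 ℕ.^ suc n)) (a′ ℤ.* b)) ⟨
    2^ k ℚ.* fromℤ (+ (2 ℕ.^ suc n) ℤ.* (a′ ℤ.* b))               ∎)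
  even : 2 ∣ ℤ.∣ a ℤ.* b′ ∣
  even = subst (2 ∣_) (sym (trans (cong ℤ.∣_∣ (fromℤ-injective {a ℤ.* b′} {+ (2 ℕ.^ suc n) ℤ.* (a′ ℤ.* b)} cross)) (ℤ.abs-* (+ (2 ℕ.^ suc n)) (a′ ℤ.* b))))
    (subst (2 ∣_) (sym (ℕ.*-assoc 2 (2 ℕ.^ n) ℤ.∣ a′ ℤ.* b ∣)) (m∣m*n (2 ℕ.^ n ℕ.* ℤ.∣ a′ ℤ.* b ∣)))

hasOrder-unique : ∀ x {k l} → HasOrder x k → HasOrder x l → k ≡ l
hasOrder-unique x {k} {l} p q with ℤ.≤-total k l
... | inj₁ k≤l = hasOrder-unique-≤ x k≤l p q
... | inj₂ l≤k = sym (hasOrder-unique-≤ x l≤k q p)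

hasOrder-* : ∀ x y {k l} → HasOrder x k → HasOrder y l → HasOrder (x ℚ.* y) (k ℤ.+ l)
hasOrder-* x y {k} {l} (hasOrder a b oa ob e) (hasOrder a′ b′ oa′ ob′ e′) =
  hasOrder (a ℤ.* a′) (b ℤ.* b′) (odd-* a a′ oa oa′) (odd-* b b′ ob ob′) (begin
  (x ℚ.* y) ℚ.* fromℤ (b ℤ.* b′)                      ≡⟨ cong ((x ℚ.* y) ℚ.*_) (fromℤ-* b b′) ⟩
  (x ℚ.* y) ℚ.* (fromℤ b ℚ.* fromℤ b′)                ≡⟨ interchange x y (fromℤ b) (fromℤ b′) ⟩
  (x ℚ.* fromℤ b) ℚ.* (y ℚ.* fromℤ b′)                ≡⟨ cong₂ ℚ._*_ e e′ ⟩
  (2^ k ℚ.* fromℤ a) ℚ.* (2^ l ℚ.* fromℤ a′)          ≡⟨ interchange (2^ k) (fromℤ a) (2^ l) (fromℤ a′) ⟩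
  (2^ k ℚ.* 2^ l) ℚ.* (fromℤ a ℚ.* fromℤ a′)          ≡⟨ cong₂ ℚ._*_ (2^-+ k l) (fromℤ-* a a′) ⟨
  2^ (k ℤ.+ l) ℚ.* fromℤ (a ℤ.* a′)                   ∎)
  where
  open ≡-Reasoning
  interchange : ∀ s t u v → (s ℚ.* t) ℚ.* (u ℚ.* v) ≡ (s ℚ.* u) ℚ.* (t ℚ.* v)
  interchange = solve 4 (λ s t u v → (s :* t) :* (u :* v) := (s :* u) :* (t :* v)) refl

hasOrder-+ : ∀ x y {k l} → k ℤ.≤ l → x ℚ.+ y ≢ 0ℚ → HasOrder x k → HasOrder y l →
             ∃ λ m → k ℤ.≤ m × HasOrder (x ℚ.+ y) m
hasOrder-+ x y {k} {l} k≤l x+y≢0 (hasOrder a b oa ob e) (hasOrder a′ b′ oa′ ob′ e′) with ≤⇒+ k≤l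
... | n , l≡ = k ℤ.+ + j , ℤ.i≤i+j k (+ j) , hasOrder o (b ℤ.* b′) oo (odd-* b b′ ob ob′) (begin
  (x ℚ.+ y) ℚ.* fromℤ (b ℤ.* b′)              ≡⟨ sum ⟩
  2^ k ℚ.* fromℤ s                            ≡⟨ cong (2^ k ℚ.*_) eo ⟩
  2^ k ℚ.* (2^ (+ j) ℚ.* fromℤ o)             ≡⟨ ℚ.*-assoc (2^ k) (2^ (+ j)) (fromℤ o) ⟨
  (2^ k ℚ.* 2^ (+ j)) ℚ.* fromℤ o             ≡⟨ cong (ℚ._* fromℤ o) (2^-+ k (+ j)) ⟨
  2^ (k ℤ.+ + j) ℚ.* fromℤ o                  ∎)
  where
  open ≡-Reasoning
  s = a ℤ.* b′ ℤ.+ + (2 ℕ.^ n) ℤ.* (a′ ℤ.* b)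
  fromℤ-s : fromℤ s ≡ fromℤ a ℚ.* fromℤ b′ ℚ.+ 2^ (+ n) ℚ.* (fromℤ a′ ℚ.* fromℤ b)
  fromℤ-s = trans (fromℤ-+ (a ℤ.* b′) (+ (2 ℕ.^ n) ℤ.* (a′ ℤ.* b))) (cong₂ ℚ._+_ (fromℤ-* a b′)
    (trans (fromℤ-* (+ (2 ℕ.^ n)) (a′ ℤ.* b)) (cong₂ ℚ._*_ (fromℤ-2^ n) (fromℤ-* a′ b))))
  sum : (x ℚ.+ y) ℚ.* fromℤ (b ℤ.* b′) ≡ 2^ k ℚ.* fromℤ s
  sum = begin
    (x ℚ.+ y) ℚ.* fromℤ (b ℤ.* b′)
      ≡⟨ cong ((x ℚ.+ y) ℚ.*_) (fromℤ-* b b′) ⟩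
    (x ℚ.+ y) ℚ.* (fromℤ b ℚ.* fromℤ b′)
      ≡⟨ solve 4 (λ x y b b′ → (x :+ y) :* (b :* b′) := (x :* b) :* b′ :+ (y :* b′) :* b) refl x y (fromℤ b) (fromℤ b′) ⟩
    (x ℚ.* fromℤ b) ℚ.* fromℤ b′ ℚ.+ (y ℚ.* fromℤ b′) ℚ.* fromℤ b
      ≡⟨ cong₂ (λ z w → z ℚ.* fromℤ b′ ℚ.+ w ℚ.* fromℤ b) e
           (trans e′ (cong (ℚ._* fromℤ a′) (trans (cong 2^_ l≡) (2^-+ k (+ n))))) ⟩
    (2^ k ℚ.* fromℤ a) ℚ.* fromℤ b′ ℚ.+ ((2^ k ℚ.* 2^ (+ n)) ℚ.* fromℤ a′) ℚ.* fromℤ b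
      ≡⟨ solve 6 (λ t u a b a′ b′ → (t :* a) :* b′ :+ ((t :* u) :* a′) :* b := t :* (a :* b′ :+ u :* (a′ :* b))) refl
           (2^ k) (2^ (+ n)) (fromℤ a) (fromℤ b) (fromℤ a′) (fromℤ b′) ⟩
    2^ k ℚ.* (fromℤ a ℚ.* fromℤ b′ ℚ.+ 2^ (+ n) ℚ.* (fromℤ a′ ℚ.* fromℤ b))
      ≡⟨ cong (2^ k ℚ.*_) fromℤ-s ⟨
    2^ k ℚ.* fromℤ s
      ∎
  s≢0 : s ≢ + 0
  s≢0 s≡0 = x+y≢0 (cancel bb′≢0 (trans sum (trans (cong (λ z → 2^ k ℚ.* fromℤ z) s≡0) (ℚ.*-zeroʳ (2^ k)))))
    where
    bb′≢0 : fromℤ (b ℤ.* b′) ≢ 0ℚ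
    bb′≢0 z = odd-* b b′ ob ob′ (subst (λ w → 2 ∣ ℤ.∣ w ∣) (sym (fromℤ-injective {b ℤ.* b′} {+ 0} z)) (divides 0 refl))
    cancel : ∀ {u v} → v ≢ 0ℚ → u ℚ.* v ≡ 0ℚ → u ≡ 0ℚ
    cancel {u} {v} v≢0 uv≡0 = trans (sym (ℚ.*-identityʳ u)) (trans (cong (u ℚ.*_) (sym (ℚ.*-inverseʳ v)))
      (trans (sym (ℚ.*-assoc u v _)) (trans (cong (ℚ._* (ℚ.1/ v)) uv≡0) (ℚ.*-zeroˡ (ℚ.1/ v)))))
      where instance _ = ℚ.≢-nonZero v≢0
  part = odd-part s s≢0
  j = v₂ℕ ℤ.∣ s ∣
  o = proj₁ part
  oo = proj₁ (proj₂ part)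
  eo = proj₂ (proj₂ part)

∣∣₂-hasOrder : ∀ x {k} → x ≢ 0ℚ → HasOrder x k → ∣ x ∣₂ ≡ 2^ (ℤ.- k)
∣∣₂-hasOrder x x≢0 h with x ℚ.≟ 0ℚ
... | yes x≡0 = ⊥-elim (x≢0 x≡0)
... | no  _   = cong (λ k → 2^ (ℤ.- k)) (hasOrder-unique x (hasOrder-v₂ x x≢0) h)

∣∣₂-nonNeg : ∀ x → 0ℚ ℚ.≤ ∣ x ∣₂
∣∣₂-nonNeg x with x ℚ.≟ 0ℚ
... | yes _ = ℚ.≤-refl
... | no  _ = ℚ.<⇒≤ (2^-positive (ℤ.- v₂ x))

∣∣₂-definite : ∀ x → ∣ x ∣₂ ≡ 0ℚ → x ≡ 0ℚ
∣∣₂-definite x e with x ℚ.≟ 0ℚ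
... | yes x≡0 = x≡0
... | no  _   = ⊥-elim (ℚ.<⇒≢ (2^-positive (ℤ.- v₂ x)) (sym e))

*-nonzero : ∀ {x y} → x ≢ 0ℚ → y ≢ 0ℚ → x ℚ.* y ≢ 0ℚ
*-nonzero {x} {y} x≢0 y≢0 xy≡0 = x≢0 (begin
  x                         ≡⟨ ℚ.*-identityʳ x ⟨
  x ℚ.* 1ℚ                  ≡⟨ cong (x ℚ.*_) (ℚ.*-inverseʳ y) ⟨
  x ℚ.* (y ℚ.* ℚ.1/ y)      ≡⟨ ℚ.*-assoc x y (ℚ.1/ y) ⟨
  (x ℚ.* y) ℚ.* ℚ.1/ y      ≡⟨ cong (ℚ._* ℚ.1/ y) xy≡0 ⟩
  0ℚ ℚ.* ℚ.1/ y             ≡⟨ ℚ.*-zeroˡ (ℚ.1/ y) ⟩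
  0ℚ                        ∎)
  where
  open ≡-Reasoning
  instance _ = ℚ.≢-nonZero y≢0

∣∣₂-* : ∀ x y → ∣ x ℚ.* y ∣₂ ≡ ∣ x ∣₂ ℚ.* ∣ y ∣₂
∣∣₂-* x y = by-cases (x ℚ.≟ 0ℚ) (y ℚ.≟ 0ℚ)
  where
  open ≡-Reasoning
  by-cases : Dec (x ≡ 0ℚ) → Dec (y ≡ 0ℚ) → ∣ x ℚ.* y ∣₂ ≡ ∣ x ∣₂ ℚ.* ∣ y ∣₂
  by-cases (yes refl) _ = trans (cong ∣_∣₂ (ℚ.*-zeroˡ y)) (sym (ℚ.*-zeroˡ ∣ y ∣₂))
  by-cases (no _) (yes refl) = trans (cong ∣_∣₂ (ℚ.*-zeroʳ x)) (sym (ℚ.*-zeroʳ ∣ x ∣₂))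
  by-cases (no x≢0) (no y≢0) = begin
    ∣ x ℚ.* y ∣₂                              ≡⟨ ∣∣₂-hasOrder (x ℚ.* y) (*-nonzero x≢0 y≢0) (hasOrder-* x y hx hy) ⟩
    2^ (ℤ.- (v₂ x ℤ.+ v₂ y))                  ≡⟨ cong 2^_ (ℤ.neg-distrib-+ (v₂ x) (v₂ y)) ⟩
    2^ (ℤ.- v₂ x ℤ.+ ℤ.- v₂ y)                ≡⟨ 2^-+ (ℤ.- v₂ x) (ℤ.- v₂ y) ⟩
    2^ (ℤ.- v₂ x) ℚ.* 2^ (ℤ.- v₂ y)           ≡⟨ cong₂ ℚ._*_ (∣∣₂-hasOrder x x≢0 hx) (∣∣₂-hasOrder y y≢0 hy) ⟨
    ∣ x ∣₂ ℚ.* ∣ y ∣₂                         ∎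
    where
    hx = hasOrder-v₂ x x≢0
    hy = hasOrder-v₂ y y≢0

∣∣₂-neg : ∀ x → ∣ ℚ.- x ∣₂ ≡ ∣ x ∣₂
∣∣₂-neg x = begin
  ∣ ℚ.- x ∣₂                        ≡⟨ cong ∣_∣₂ (solve 1 (λ x → :- x := (:- con 1ℚ) :* x) refl x) ⟩
  ∣ ℚ.- 1ℚ ℚ.* x ∣₂                 ≡⟨ ∣∣₂-* (ℚ.- 1ℚ) x ⟩
  1ℚ ℚ.* ∣ x ∣₂                     ≡⟨ ℚ.*-identityˡ ∣ x ∣₂ ⟩
  ∣ x ∣₂                            ∎
  where open ≡-Reasoning

2^-antitone : ∀ {i j} → i ℤ.≤ j → 2^ (ℤ.- j) ℚ.≤ 2^ (ℤ.- i)
2^-antitone {i} {j} i≤j with ≤⇒+ (ℤ.neg-mono-≤ i≤j)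
... | n , e = begin
  2^ (ℤ.- j)                        ≡⟨ ℚ.*-identityʳ _ ⟨
  2^ (ℤ.- j) ℚ.* 1ℚ                 ≤⟨ ℚ.*-monoˡ-≤-nonNeg (2^ (ℤ.- j)) {{ℚ.nonNegative (ℚ.<⇒≤ (2^-positive (ℤ.- j)))}} (1≤2^ n) ⟩
  2^ (ℤ.- j) ℚ.* 2^ (+ n)           ≡⟨ 2^-+ (ℤ.- j) (+ n) ⟨
  2^ (ℤ.- j ℤ.+ + n)                ≡⟨ cong 2^_ e ⟨
  2^ (ℤ.- i)                        ∎
  where open ℚ.≤-Reasoning

∣∣₂-triangle : ∀ x y → ∣ x ℚ.+ y ∣₂ ℚ.≤ ∣ x ∣₂ ℚ.+ ∣ y ∣₂
∣∣₂-triangle x y = by-cases (x ℚ.≟ 0ℚ) (y ℚ.≟ 0ℚ) ((x ℚ.+ y) ℚ.≟ 0ℚ)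
  where
  open ℚ.≤-Reasoning
  bound : ∀ x y → x ≢ 0ℚ → y ≢ 0ℚ → x ℚ.+ y ≢ 0ℚ → v₂ x ℤ.≤ v₂ y → ∣ x ℚ.+ y ∣₂ ℚ.≤ ∣ x ∣₂ ℚ.+ ∣ y ∣₂
  bound x y x≢0 y≢0 s≢0 v≤v = begin
    ∣ x ℚ.+ y ∣₂              ≡⟨ ∣∣₂-hasOrder (x ℚ.+ y) s≢0 (proj₂ (proj₂ sum)) ⟩
    2^ (ℤ.- proj₁ sum)        ≤⟨ 2^-antitone (proj₁ (proj₂ sum)) ⟩
    2^ (ℤ.- v₂ x)             ≡⟨ ∣∣₂-hasOrder x x≢0 (hasOrder-v₂ x x≢0) ⟨
    ∣ x ∣₂                    ≡⟨ ℚ.+-identityʳ ∣ x ∣₂ ⟨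
    ∣ x ∣₂ ℚ.+ 0ℚ             ≤⟨ ℚ.+-monoʳ-≤ ∣ x ∣₂ (∣∣₂-nonNeg y) ⟩
    ∣ x ∣₂ ℚ.+ ∣ y ∣₂         ∎
    where
    sum = hasOrder-+ x y v≤v s≢0 (hasOrder-v₂ x x≢0) (hasOrder-v₂ y y≢0)
  either : x ≢ 0ℚ → y ≢ 0ℚ → x ℚ.+ y ≢ 0ℚ → v₂ x ℤ.≤ v₂ y ⊎ v₂ y ℤ.≤ v₂ x → ∣ x ℚ.+ y ∣₂ ℚ.≤ ∣ x ∣₂ ℚ.+ ∣ y ∣₂
  either x≢0 y≢0 s≢0 (inj₁ v≤v) = bound x y x≢0 y≢0 s≢0 v≤v
  either x≢0 y≢0 s≢0 (inj₂ v≤v) = begin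
    ∣ x ℚ.+ y ∣₂              ≡⟨ cong ∣_∣₂ (ℚ.+-comm x y) ⟩
    ∣ y ℚ.+ x ∣₂              ≤⟨ bound y x y≢0 x≢0 (λ e → s≢0 (trans (ℚ.+-comm x y) e)) v≤v ⟩
    ∣ y ∣₂ ℚ.+ ∣ x ∣₂         ≡⟨ ℚ.+-comm ∣ y ∣₂ ∣ x ∣₂ ⟩
    ∣ x ∣₂ ℚ.+ ∣ y ∣₂         ∎
  by-cases : Dec (x ≡ 0ℚ) → Dec (y ≡ 0ℚ) → Dec (x ℚ.+ y ≡ 0ℚ) → ∣ x ℚ.+ y ∣₂ ℚ.≤ ∣ x ∣₂ ℚ.+ ∣ y ∣₂
  by-cases (yes refl) _ _ = ℚ.≤-reflexive (trans (cong ∣_∣₂ (ℚ.+-identityˡ y)) (sym (ℚ.+-identityˡ ∣ y ∣₂)))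
  by-cases (no _) (yes refl) _ = ℚ.≤-reflexive (trans (cong ∣_∣₂ (ℚ.+-identityʳ x)) (sym (ℚ.+-identityʳ ∣ x ∣₂)))
  by-cases (no _) (no _) (yes s≡0) = begin
    ∣ x ℚ.+ y ∣₂              ≡⟨ cong ∣_∣₂ s≡0 ⟩
    0ℚ ℚ.+ 0ℚ                 ≤⟨ ℚ.+-mono-≤ (∣∣₂-nonNeg x) (∣∣₂-nonNeg y) ⟩
    ∣ x ∣₂ ℚ.+ ∣ y ∣₂         ∎
  by-cases (no x≢0) (no y≢0) (no s≢0) = either x≢0 y≢0 s≢0 (ℤ.≤-total (v₂ x) (v₂ y))

record QuadraticField (c ℓ : Level) : Set (lsuc (c ⊔ ℓ)) where
  field
    commutativeRing : CommutativeRing c ℓ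
  open CommutativeRing commutativeRing public
  infix 8 _⁻¹
  field
    1≉0         : ¬ 1# ≈ 0#
    _⁻¹         : Carrier → Carrier
    ⁻¹-inverse  : ∀ x → ¬ x ≈ 0# → x * x ⁻¹ ≈ 1#
    -- K has dimension two over ℚ, with basis {1, ω}.
    ι           : ℚ → Carrier
    ι-isRingHomomorphism : IsRingHomomorphism ℚ.+-*-rawRing rawRing ι
    ω           : Carrier
    spans       : ∀ x → ∃₂ λ p q → x ≈ ι p + ι q * ω
    independent : ∀ p q → ι p + ι q * ω ≈ 0# → p ≡ 0ℚ × q ≡ 0ℚ

  Rational : Carrier → Set ℓ
  Rational x = ∃ λ r → x ≈ ι r

split-positive : ∀ {x y z} → 0ℚ ℚ.< x → 0ℚ ℚ.< y → 0ℚ ℚ.< z →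
                 ∃ λ w → 0ℚ ℚ.< w × x ℚ.* w ℚ.+ y ℚ.* w ≡ z
split-positive {x} {y} {z} 0<x 0<y 0<z = z ℚ.* r , 0<zr , (begin
  x ℚ.* (z ℚ.* r) ℚ.+ y ℚ.* (z ℚ.* r)     ≡⟨ solve 4 (λ x y z r → x :* (z :* r) :+ y :* (z :* r) := z :* ((x :+ y) :* r)) refl x y z r ⟩
  z ℚ.* ((x ℚ.+ y) ℚ.* r)                 ≡⟨ cong (z ℚ.*_) (ℚ.*-inverseʳ (x ℚ.+ y)) ⟩
  z ℚ.* 1ℚ                                ≡⟨ ℚ.*-identityʳ z ⟩
  z                                       ∎)
  where
  open ≡-Reasoning
  instance
    x+y-positive = ℚ.positive (ℚ.+-mono-< 0<x 0<y)
    x+y-nonZero = ℚ.pos⇒nonZero (x ℚ.+ y)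
  r = ℚ.1/ (x ℚ.+ y)
  0<zr : 0ℚ ℚ.< z ℚ.* r
  0<zr = subst (ℚ._< z ℚ.* r) (ℚ.*-zeroˡ r) (ℚ.*-monoˡ-<-pos r {{ℚ.1/pos⇒pos (x ℚ.+ y)}} 0<z)

record AbsoluteValue : Set where
  field
    ∣_∣      : ℚ → ℚ
    nonNeg   : ∀ x → 0ℚ ℚ.≤ ∣ x ∣
    definite : ∀ x → ∣ x ∣ ≡ 0ℚ → x ≡ 0ℚ
    ∣0∣      : ∣ 0ℚ ∣ ≡ 0ℚ
    neg      : ∀ x → ∣ ℚ.- x ∣ ≡ ∣ x ∣
    mult     : ∀ x y → ∣ x ℚ.* y ∣ ≡ ∣ x ∣ ℚ.* ∣ y ∣
    triangle : ∀ x y → ∣ x ℚ.+ y ∣ ℚ.≤ ∣ x ∣ ℚ.+ ∣ y ∣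

  Cauchy : (ℕ → ℚ) → Set
  Cauchy s = ∀ ε → 0ℚ ℚ.< ε → ∃ λ N → ∀ m n → N ℕ.≤ m → N ℕ.≤ n → ∣ s m ℚ.- s n ∣ ℚ.< ε

  split-difference : ∀ x y → ∣ x ∣ ℚ.≤ ∣ y ∣ ℚ.+ ∣ x ℚ.- y ∣
  split-difference x y = ℚ.≤-trans
    (ℚ.≤-reflexive (cong ∣_∣ (solve 2 (λ x y → x := y :+ (x :- y)) refl x y))) (triangle y (x ℚ.- y))

  constant-cauchy : ∀ x → Cauchy (λ _ → x)
  constant-cauchy x ε 0<ε = 0 , λ _ _ _ _ → subst (ℚ._< ε) (sym (trans (cong ∣_∣ (ℚ.+-inverseʳ x)) ∣0∣)) 0<ε

  neg-cauchy : ∀ {s} → Cauchy s → Cauchy (λ n → ℚ.- s n)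
  neg-cauchy {s} cs ε 0<ε with cs ε 0<ε
  ... | N , h = N , λ m n N≤m N≤n → subst (ℚ._< ε)
    (trans (sym (neg (s m ℚ.- s n))) (cong ∣_∣ (solve 2 (λ x y → :- (x :- y) := :- x :- (:- y)) refl (s m) (s n))))
    (h m n N≤m N≤n)

  +-cauchy : ∀ {s t} → Cauchy s → Cauchy t → Cauchy (λ n → s n ℚ.+ t n)
  +-cauchy {s} {t} cs ct ε 0<ε = N , close
    where
    open ℚ.≤-Reasoning
    δ = ½ ℚ.* ε
    0<δ : 0ℚ ℚ.< δ
    0<δ = subst (ℚ._< δ) (ℚ.*-zeroʳ ½) (ℚ.*-monoʳ-<-pos ½ 0<ε)
    N₁ = proj₁ (cs δ 0<δ)
    N₂ = proj₁ (ct δ 0<δ)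
    N = N₁ ℕ.⊔ N₂
    at₁ : ∀ {k} → N ℕ.≤ k → N₁ ℕ.≤ k
    at₁ = ℕ.m⊔n≤o⇒m≤o N₁ N₂
    at₂ : ∀ {k} → N ℕ.≤ k → N₂ ℕ.≤ k
    at₂ = ℕ.m⊔n≤o⇒n≤o N₁ N₂
    close : ∀ m n → N ℕ.≤ m → N ℕ.≤ n → ∣ (s m ℚ.+ t m) ℚ.- (s n ℚ.+ t n) ∣ ℚ.< ε
    close m n N≤m N≤n = begin-strict
      ∣ (s m ℚ.+ t m) ℚ.- (s n ℚ.+ t n) ∣
        ≡⟨ cong ∣_∣ (solve 4 (λ a b c d → (a :+ b) :- (c :+ d) := (a :- c) :+ (b :- d)) refl (s m) (t m) (s n) (t n)) ⟩
      ∣ (s m ℚ.- s n) ℚ.+ (t m ℚ.- t n) ∣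
        ≤⟨ triangle (s m ℚ.- s n) (t m ℚ.- t n) ⟩
      ∣ s m ℚ.- s n ∣ ℚ.+ ∣ t m ℚ.- t n ∣
        <⟨ ℚ.+-mono-< (proj₂ (cs δ 0<δ) m n (at₁ N≤m) (at₁ N≤n)) (proj₂ (ct δ 0<δ) m n (at₂ N≤m) (at₂ N≤n)) ⟩
      δ ℚ.+ δ
        ≡⟨ solve 1 (λ e → con ½ :* e :+ con ½ :* e := e) refl ε ⟩
      ε ∎

  eventually-bounded : ∀ {s} → Cauchy s → ∃₂ λ B N → 0ℚ ℚ.< B × (∀ n → N ℕ.≤ n → ∣ s n ∣ ℚ.≤ B)
  eventually-bounded {s} cs with cs 1ℚ (ℚ.positive⁻¹ 1ℚ)
  ... | N , h = ∣ s N ∣ ℚ.+ 1ℚ , N , ℚ.+-mono-≤-< (nonNeg (s N)) (ℚ.positive⁻¹ 1ℚ) , λ n N≤n →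
    ℚ.≤-trans (split-difference (s n) (s N)) (ℚ.+-monoʳ-≤ ∣ s N ∣ (ℚ.<⇒≤ (h n N N≤n ℕ.≤-refl)))

  *-cauchy : ∀ {s t} → Cauchy s → Cauchy t → Cauchy (λ n → s n ℚ.* t n)
  *-cauchy {s} {t} cs ct ε 0<ε = N , close
    where
    open ℚ.≤-Reasoning
    s-bounded = eventually-bounded cs
    t-bounded = eventually-bounded ct
    B = proj₁ s-bounded
    D = proj₁ t-bounded
    N₁ = proj₁ (proj₂ s-bounded)
    N₂ = proj₁ (proj₂ t-bounded)
    0<B = proj₁ (proj₂ (proj₂ s-bounded))
    0<D = proj₁ (proj₂ (proj₂ t-bounded))
    bs = proj₂ (proj₂ (proj₂ s-bounded))
    bt = proj₂ (proj₂ (proj₂ t-bounded))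
    portion = split-positive 0<B 0<D 0<ε
    δ = proj₁ portion
    0<δ = proj₁ (proj₂ portion)
    N₃ = proj₁ (cs δ 0<δ)
    N₄ = proj₁ (ct δ 0<δ)
    N = (N₁ ℕ.⊔ N₂) ℕ.⊔ (N₃ ℕ.⊔ N₄)
    scale : ∀ {u v U V} → 0ℚ ℚ.≤ v → 0ℚ ℚ.< U → u ℚ.≤ U → v ℚ.< V → u ℚ.* v ℚ.< U ℚ.* V
    scale {u} {v} {U} {V} 0≤v 0<U u≤U v<V = ℚ.≤-<-trans
      (ℚ.*-monoʳ-≤-nonNeg v {{ℚ.nonNegative 0≤v}} u≤U) (ℚ.*-monoʳ-<-pos U {{ℚ.positive 0<U}} v<V)
    close : ∀ m n → N ℕ.≤ m → N ℕ.≤ n → ∣ s m ℚ.* t m ℚ.- s n ℚ.* t n ∣ ℚ.< ε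
    close m n N≤m N≤n = begin-strict
      ∣ s m ℚ.* t m ℚ.- s n ℚ.* t n ∣
        ≡⟨ cong ∣_∣ (solve 4 (λ a b c d → a :* b :- c :* d := a :* (b :- d) :+ d :* (a :- c)) refl (s m) (t m) (s n) (t n)) ⟩
      ∣ s m ℚ.* (t m ℚ.- t n) ℚ.+ t n ℚ.* (s m ℚ.- s n) ∣
        ≤⟨ triangle (s m ℚ.* (t m ℚ.- t n)) (t n ℚ.* (s m ℚ.- s n)) ⟩
      ∣ s m ℚ.* (t m ℚ.- t n) ∣ ℚ.+ ∣ t n ℚ.* (s m ℚ.- s n) ∣
        ≡⟨ cong₂ ℚ._+_ (mult (s m) (t m ℚ.- t n)) (mult (t n) (s m ℚ.- s n)) ⟩
      ∣ s m ∣ ℚ.* ∣ t m ℚ.- t n ∣ ℚ.+ ∣ t n ∣ ℚ.* ∣ s m ℚ.- s n ∣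
        <⟨ ℚ.+-mono-<
             (scale (nonNeg (t m ℚ.- t n)) 0<B (bs m (at₁ N≤m)) (proj₂ (ct δ 0<δ) m n (at₄ N≤m) (at₄ N≤n)))
             (scale (nonNeg (s m ℚ.- s n)) 0<D (bt n (at₂ N≤n)) (proj₂ (cs δ 0<δ) m n (at₃ N≤m) (at₃ N≤n))) ⟩
      B ℚ.* δ ℚ.+ D ℚ.* δ
        ≡⟨ proj₂ (proj₂ portion) ⟩
      ε ∎
      where
      left : ∀ {k} → N ℕ.≤ k → N₁ ℕ.⊔ N₂ ℕ.≤ k
      left = ℕ.m⊔n≤o⇒m≤o (N₁ ℕ.⊔ N₂) (N₃ ℕ.⊔ N₄)
      right : ∀ {k} → N ℕ.≤ k → N₃ ℕ.⊔ N₄ ℕ.≤ k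
      right = ℕ.m⊔n≤o⇒n≤o (N₁ ℕ.⊔ N₂) (N₃ ℕ.⊔ N₄)
      at₁ : ∀ {k} → N ℕ.≤ k → N₁ ℕ.≤ k
      at₁ N≤k = ℕ.m⊔n≤o⇒m≤o N₁ N₂ (left N≤k)
      at₂ : ∀ {k} → N ℕ.≤ k → N₂ ℕ.≤ k
      at₂ N≤k = ℕ.m⊔n≤o⇒n≤o N₁ N₂ (left N≤k)
      at₃ : ∀ {k} → N ℕ.≤ k → N₃ ℕ.≤ k
      at₃ N≤k = ℕ.m⊔n≤o⇒m≤o N₃ N₄ (right N≤k)
      at₄ : ∀ {k} → N ℕ.≤ k → N₄ ℕ.≤ k
      at₄ N≤k = ℕ.m⊔n≤o⇒n≤o N₃ N₄ (right N≤k)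

  ∣∣-cauchy : ∀ {s} → Cauchy s → ∀ ε → 0ℚ ℚ.< ε →
              ∃ λ N → ∀ m n → N ℕ.≤ m → N ℕ.≤ n → ℚ.∣ ∣ s m ∣ ℚ.- ∣ s n ∣ ∣ ℚ.< ε
  ∣∣-cauchy {s} cs ε 0<ε with cs ε 0<ε
  ... | N , h = N , λ m n N≤m N≤n →
    ℚ.≤-<-trans (bound (∣ s m ∣ ℚ.- ∣ s n ∣) ∣ s m ℚ.- s n ∣ (one-sided (s m) (s n))
                  (ℚ.≤-trans (ℚ.≤-reflexive (solve 2 (λ a b → :- (a :- b) := b :- a) refl ∣ s m ∣ ∣ s n ∣))
                    (ℚ.≤-trans (one-sided (s n) (s m)) (ℚ.≤-reflexive (trans (sym (neg _))
                      (cong ∣_∣ (solve 2 (λ a b → :- (a :- b) := b :- a) refl (s n) (s m))))))))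
                (h m n N≤m N≤n)
    where
    bound : ∀ p q → p ℚ.≤ q → ℚ.- p ℚ.≤ q → ℚ.∣ p ∣ ℚ.≤ q
    bound p q p≤q -p≤q with ℚ.∣p∣≡p∨∣p∣≡-p p
    ... | inj₁ e = subst (ℚ._≤ q) (sym e) p≤q
    ... | inj₂ e = subst (ℚ._≤ q) (sym e) -p≤q
    one-sided : ∀ x y → ∣ x ∣ ℚ.- ∣ y ∣ ℚ.≤ ∣ x ℚ.- y ∣
    one-sided x y = ℚ.≤-trans (ℚ.+-monoˡ-≤ (ℚ.- ∣ y ∣) (split-difference x y))
      (ℚ.≤-reflexive (solve 2 (λ a b → (a :+ b) :- a := b) refl ∣ y ∣ ∣ x ℚ.- y ∣))

archimedean : AbsoluteValue
archimedean = record
  { ∣_∣ = ℚ.∣_∣ ; nonNeg = ℚ.0≤∣p∣ ; definite = ℚ.∣p∣≡0⇒p≡0 ; ∣0∣ = refl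
  ; neg = ℚ.∣-p∣≡∣p∣ ; mult = ℚ.∣p*q∣≡∣p∣*∣q∣ ; triangle = ℚ.∣p+q∣≤∣p∣+∣q∣ }

dyadic : AbsoluteValue
dyadic = record
  { ∣_∣ = ∣_∣₂ ; nonNeg = ∣∣₂-nonNeg ; definite = ∣∣₂-definite ; ∣0∣ = refl
  ; neg = ∣∣₂-neg ; mult = ∣∣₂-* ; triangle = ∣∣₂-triangle }

-- Cauchy sequences of rationals; equality of points is _≈_ below.
record Completion (A : AbsoluteValue) : Set where
  constructor mkCompletion
  open AbsoluteValue A using (Cauchy)
  field
    seq    : ℕ → ℚ
    cauchy : Cauchy seq

open Completion public using (seq; cauchy)

ℝ : Set
ℝ = Completion archimedean

ℚ₂ : Set
ℚ₂ = Completion dyadic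

module _ {A : AbsoluteValue} where
  open AbsoluteValue A

  infix  4 _≈_
  infixl 6 _+_ _-_
  infixl 7 _*_
  infix  8 -_

  _≈_ : Completion A → Completion A → Set
  x ≈ y = ∀ ε → 0ℚ ℚ.< ε → ∃ λ N → ∀ n → N ℕ.≤ n → ∣ seq x n ℚ.- seq y n ∣ ℚ.< ε

  fromℚ : ℚ → Completion A
  fromℚ r = mkCompletion (λ _ → r) (constant-cauchy r)

  -_ : Completion A → Completion A
  - x = mkCompletion (λ n → ℚ.- seq x n) (neg-cauchy {seq x} (cauchy x))

  _+_ _*_ : Completion A → Completion A → Completion A
  x + y = mkCompletion (λ n → seq x n ℚ.+ seq y n) (+-cauchy {seq x} {seq y} (cauchy x) (cauchy y))
  x * y = mkCompletion (λ n → seq x n ℚ.* seq y n) (*-cauchy {seq x} {seq y} (cauchy x) (cauchy y))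

  _-_ : Completion A → Completion A → Completion A
  x - y = x + (- y)

  -- The continuous extension of the absolute value.
  ∥_∥ : Completion A → ℝ
  ∥ x ∥ = mkCompletion (λ n → ∣ seq x n ∣) (∣∣-cauchy {seq x} (cauchy x))

completionRing : AbsoluteValue → RawRing 0ℓ 0ℓ
completionRing A = record
  { Carrier = Completion A ; _≈_ = _≈_ ; _+_ = _+_ ; _*_ = _*_ ; -_ = -_ ; 0# = fromℚ 0ℚ ; 1# = fromℚ 1ℚ }

ℝ-ring ℚ₂-ring : RawRing 0ℓ 0ℓ
ℝ-ring  = completionRing archimedean
ℚ₂-ring = completionRing dyadic

infix 4 _<_ _≤_

_<_ _≤_ : ℝ → ℝ → Set
x < y = ∃ λ ε → 0ℚ ℚ.< ε × ∃ λ N → ∀ n → N ℕ.≤ n → seq x n ℚ.+ ε ℚ.≤ seq y n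
x ≤ y = ¬ y < x

_⟶_ : {A : AbsoluteValue} → (ℕ → Completion A) → Completion A → Set
s ⟶ x = ∀ ε → 0ℚ ℚ.< ε → ∃ λ N → ∀ n → N ℕ.≤ n → ∥ s n - x ∥ < fromℚ ε

-- v₂ is locally constant on ℚ₂ \ {0}, so v₂(u) is the eventual value of v₂
-- along any sequence of rationals representing u.
HasValuation : ℚ₂ → ℤ → Set
HasValuation u k = ∃ λ N → ∀ n → N ℕ.≤ n → seq u n ≢ 0ℚ × v₂ (seq u n) ≡ k

PositiveValuation : ℚ₂ → Set
PositiveValuation u = u ≈ fromℚ 0ℚ ⊎ ∃ λ k → HasValuation u k × + 0 ℤ.< k

-- Σ_{-N ≤ n < -N + k} cₙ 2ⁿ
digitSum : (ℤ → Fin 2) → (N k : ℕ) → ℚ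
digitSum c N zero    = 0ℚ
digitSum c N (suc k) = digitSum c N k ℚ.+ fromℕ (toℕ (c n)) ℚ.* 2^ n
  where n = ℤ.- + N ℤ.+ + k

-- u = Σₙ cₙ 2ⁿ with cₙ = 0 for n < -N.  The digits do not depend on the cut-off:
-- the first nonzero one sits at v₂(u), so -N may be any lower bound for it.
record DigitExpansion (u : ℚ₂) : Set where
  field
    digit     : ℤ → Fin 2
    N         : ℕ
    vanishes  : ∀ n → n ℤ.< ℤ.- + N → digit n ≡ zero
    converges : (λ k → fromℚ (digitSum digit N k)) ⟶ u

  -- Σ_{n ≤ 0} cₙ 2ⁿ
  floor : ℚ
  floor = digitSum digit N (suc N)

-- r = ⌊u⌋₂
IsFloor₂ : ℚ₂ → ℚ → Set
IsFloor₂ u r = Σ (DigitExpansion u) λ e → r ≡ DigitExpansion.floor e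

Minimizes : (ℤ → ℝ) → ℤ → Set
Minimizes f m = ∀ i → f m ≤ f i

IsSmallestMinimizer : (ℤ → ℝ) → ℤ → Set
IsSmallestMinimizer f m = Minimizes f m × (∀ i → Minimizes f i → m ℤ.≤ i)

τ : ℕ → Fin 2
τ zero          = zero
τ (suc zero)    = suc zero
τ (suc (suc n)) = τ n

-- a⁽⁰⁾ subtracts even integers, a⁽¹⁾ arbitrary ones.
stride : Fin 2 → ℤ
stride zero       = + 2
stride (suc zero) = + 1

module Algorithm {c ℓ} (K : QuadraticField c ℓ)
  (σ∞ : QuadraticField.Carrier K → ℝ) (σ₂ : QuadraticField.Carrier K → ℚ₂) where

  open QuadraticField K using (Carrier; _⁻¹; ι) renaming (_≈_ to _≈ᴷ_; _-_ to _-ᴷ_)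

  PropertyI : Carrier → Set
  PropertyI α = fromℚ (ℚ.- 1ℚ) < σ∞ α × σ∞ α ≤ fromℚ 1ℚ × PositiveValuation (σ₂ α)

  -- a = a⁽ᵉ⁾(α), for α ≠ 0
  IsPartialQuotient : Fin 2 → Carrier → ℚ → Set
  IsPartialQuotient e α a = ∃₂ λ r m →
    IsFloor₂ (σ₂ (α ⁻¹)) r ×
    IsSmallestMinimizer (λ i → ∥ σ∞ (α ⁻¹) - fromℚ (fromℤ (stride e ℤ.* i)) - fromℚ r ∥) m ×
    a ≡ fromℤ (stride e ℤ.* m) ℚ.+ r

  -- αs n and a n are α₍ₙ₎ and aₙ(α) for n ≥ 1; the values at 0 play no role.
  record IsExpansion (α : Carrier) (αs : ℕ → Carrier) (a : ℕ → ℚ) : Set ℓ where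
    field
      initial  : αs 1 ≈ᴷ α
      quotient : ∀ n → 1 ℕ.≤ n → IsPartialQuotient (τ n) (αs n) (a n)
      step     : ∀ n → 1 ℕ.≤ n → αs (suc n) ≈ᴷ (αs n) ⁻¹ -ᴷ ι (a n)

record Matrix₂ : Set where
  constructor matrix
  field
    m₁₁ m₁₂ m₂₁ m₂₂ : ℚ

open Matrix₂

infixl 7 _·_

_·_ : Matrix₂ → Matrix₂ → Matrix₂
matrix a b c d · matrix a′ b′ c′ d′ = matrix
  (a ℚ.* a′ ℚ.+ b ℚ.* c′) (a ℚ.* b′ ℚ.+ b ℚ.* d′)
  (c ℚ.* a′ ℚ.+ d ℚ.* c′) (c ℚ.* b′ ℚ.+ d ℚ.* d′)

module _ (a : ℕ → ℚ) where

  -- The product over s = 1, …, n.  For n = 0 the identity matrix gives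
  -- p₀ = 0 and q₀ = 1.
  convergentMatrix : ℕ → Matrix₂
  convergentMatrix zero    = matrix 1ℚ 0ℚ 0ℚ 1ℚ
  convergentMatrix (suc n) = convergentMatrix n · matrix 0ℚ 1ℚ 1ℚ (a (suc n))

  p q : ℕ → ℚ
  p n = m₁₂ (convergentMatrix n)
  q n = m₂₂ (convergentMatrix n)

  -- Σ_{s=1}^{n} v₂(aₛ)
  valuationSum : ℕ → ℤ
  valuationSum zero    = + 0
  valuationSum (suc n) = valuationSum n ℤ.+ v₂ (a (suc n))

  p′ q′ : ℕ → ℚ
  p′ n = 2^ (ℤ.- valuationSum n) ℚ.* p n
  q′ n = 2^ (ℤ.- valuationSum n) ℚ.* q n

{-# OPTIONS --safe #-}

-- Each complete quotient satisfies ∣α₍ₙ₊₁₎∣ ≤ 1/(1 + τ(n)) at the real place, and ∣α₍ₙ₊₁₎∣₂ = 1/∣aₙ₊₁∣₂ with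
-- ∣α₍ₙ₊₁₎∣₂ ≤ 1, strictly when n is even.  Put wₙ = qₙ α₍₁₎⋯α₍ₙ₎.  Then wₙ₊₁ = 1 − α₍ₙ₊₁₎α₍ₙ₊₂₎wₙ, and consecutive complete
-- quotients have real product at most 1/2, so ∣wₙ∣ ≤ 2 − 2⁻ⁿ.  Since qₙα − pₙ = ± α₍₁₎⋯α₍ₙ₊₁₎ and ∣qₙ∣₂ = ∣a₁∣₂⋯∣aₙ∣₂,
-- this is the upper bound.
-- The lower bound is a Liouville argument.  If A α² = B α + C with A, B, C ∈ ℤ[1/2], then the norm form
-- A pₙ² − B pₙqₙ − C qₙ² is a nonzero element of ℤ[1/2], so the product of its two absolute values is at least 1, while at
-- each place it is ∣qₙ∣²∣α − pₙ/qₙ∣ times a factor bounded independently of n, because ∣qₙα − pₙ∣ ≤ ∣qₙ∣ at both places.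

module Submission where

open import Defs
open import Level using (Level)
open import Data.Nat as ℕ using (ℕ; zero; suc; z≤n; s≤s)
import Data.Nat.Properties as ℕ
open import Data.Nat.Divisibility using (divides; ∣1⇒≡1)
open import Data.Fin using (Fin; zero; suc; toℕ)
open import Data.Integer as ℤ using (ℤ; +_; -[1+_])
import Data.Integer.Properties as ℤ
open import Data.Rational as ℚ using (ℚ; 0ℚ; 1ℚ; ½; ↥_; ↧_)
import Data.Rational.Properties as ℚ
open import Data.Rational.Solver using (module +-*-Solver)
open import Data.Empty using (⊥-elim)
open import Data.Maybe using (Maybe; just; nothing)
open import Data.Product using (∃; ∃₂; _×_; _,_; proj₁; proj₂)
open import Data.Sum using (_⊎_; inj₁; inj₂)
open import Relation.Nullary using (¬_; Dec; yes; no)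
open import Relation.Binary.PropositionalEquality
open import Algebra.Morphism.Structures using (IsRingHomomorphism; IsRingMonomorphism)
import Algebra.Solver.Ring
import Algebra.Solver.Ring.AlmostCommutativeRing as ACR
import Relation.Binary.Reasoning.Setoid as SetoidReasoning

open +-*-Solver using (solve; _:+_; _:*_; :-_; _:-_; _:=_; con)

-- Points of a completion are Cauchy sequences, and their sizes are handled as rational bounds on
-- limits superior, so only upper bounds are manipulated. Lower bounds are read off from identities
-- whose value is a nonzero rational: 1 = w - (w - 1) for qₙ at the real place, 1 = βa + ββ′ for
-- aₙ₊₁ at the 2-adic place, and the norm form for the approximation error. The real induction runs
-- on wₙ - 1. Its bound 1 - 2⁻ⁿ leaves a deficit 2⁻ⁿ in the bound for wₙ, which makes the last
-- inequality strict, and it also keeps wₙ at distance at least 2⁻ⁿ from 0, which is where qₙ ≠ 0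
-- comes from. At the 2-adic place the term qₙaₙ₊₁ must dominate qₙ₋₁, although for odd n only
-- ∣aₙ₊₁∣₂ ≥ 1 is known. The gain then comes from the preceding step, so growth is measured with a
-- weight that alternates with the parity of n.

private variable
  κ ℓ : Level

-- Order and division in ℚ

0<½ : 0ℚ ℚ.< ½
0<½ = ℚ.positive⁻¹ ½

0<1 : 0ℚ ℚ.< 1ℚ
0<1 = ℚ.positive⁻¹ 1ℚ

≤-from-gap : ∀ {x y} d → 0ℚ ℚ.≤ d → x ℚ.+ d ≡ y → x ℚ.≤ y
≤-from-gap {x} d 0≤d e = ℚ.≤-trans (ℚ.≤-reflexive (sym (ℚ.+-identityʳ x)))
  (ℚ.≤-trans (ℚ.+-monoʳ-≤ x 0≤d) (ℚ.≤-reflexive e))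

<-from-gap : ∀ {x y} d → 0ℚ ℚ.< d → x ℚ.+ d ≡ y → x ℚ.< y
<-from-gap {x} d 0<d e = ℚ.≤-<-trans (ℚ.≤-reflexive (sym (ℚ.+-identityʳ x)))
  (ℚ.<-≤-trans (ℚ.+-monoʳ-< x 0<d) (ℚ.≤-reflexive e))

gap-nonNeg : ∀ {x y} → x ℚ.≤ y → 0ℚ ℚ.≤ y ℚ.- x
gap-nonNeg {x} {y} x≤y = ℚ.≤-trans (ℚ.≤-reflexive (sym (ℚ.+-inverseʳ x))) (ℚ.+-monoˡ-≤ (ℚ.- x) x≤y)

gap-positive : ∀ {x y} → x ℚ.< y → 0ℚ ℚ.< y ℚ.- x
gap-positive {x} {y} x<y = ℚ.≤-<-trans (ℚ.≤-reflexive (sym (ℚ.+-inverseʳ x))) (ℚ.+-monoˡ-< (ℚ.- x) x<y)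

+-nonNeg : ∀ {x y} → 0ℚ ℚ.≤ x → 0ℚ ℚ.≤ y → 0ℚ ℚ.≤ x ℚ.+ y
+-nonNeg = ℚ.+-mono-≤

+-positive : ∀ {x y} → 0ℚ ℚ.< x → 0ℚ ℚ.< y → 0ℚ ℚ.< x ℚ.+ y
+-positive = ℚ.+-mono-<

*-mono-≤ : ∀ {x y u v} → 0ℚ ℚ.≤ x → 0ℚ ℚ.≤ v → x ℚ.≤ y → u ℚ.≤ v → x ℚ.* u ℚ.≤ y ℚ.* v
*-mono-≤ {x} {y} {u} {v} 0≤x 0≤v x≤y u≤v = ℚ.≤-trans
  (ℚ.*-monoˡ-≤-nonNeg x {{ℚ.nonNegative 0≤x}} u≤v) (ℚ.*-monoʳ-≤-nonNeg v {{ℚ.nonNegative 0≤v}} x≤y)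

*-nonNeg : ∀ {x y} → 0ℚ ℚ.≤ x → 0ℚ ℚ.≤ y → 0ℚ ℚ.≤ x ℚ.* y
*-nonNeg {x} {y} 0≤x 0≤y = ℚ.≤-trans (ℚ.≤-reflexive (sym (ℚ.*-zeroʳ x)))
  (ℚ.*-monoˡ-≤-nonNeg x {{ℚ.nonNegative 0≤x}} 0≤y)

*-positive : ∀ {x y} → 0ℚ ℚ.< x → 0ℚ ℚ.< y → 0ℚ ℚ.< x ℚ.* y
*-positive {x} {y} 0<x 0<y = subst (ℚ._< x ℚ.* y) (ℚ.*-zeroʳ x) (ℚ.*-monoʳ-<-pos x {{ℚ.positive 0<x}} 0<y)

*-cancelʳ-≤ : ∀ {x y} z → 0ℚ ℚ.< z → x ℚ.* z ℚ.≤ y ℚ.* z → x ℚ.≤ y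
*-cancelʳ-≤ z 0<z = ℚ.*-cancelʳ-≤-pos z {{ℚ.positive 0<z}}

*-cancelʳ-< : ∀ {x y} z → 0ℚ ℚ.< z → x ℚ.* z ℚ.< y ℚ.* z → x ℚ.< y
*-cancelʳ-< z 0<z = ℚ.*-cancelʳ-<-nonNeg z {{ℚ.nonNegative (ℚ.<⇒≤ 0<z)}}

positive⇒≢0 : ∀ {x} → 0ℚ ℚ.< x → x ≢ 0ℚ
positive⇒≢0 0<x x≡0 = ℚ.<⇒≢ 0<x (sym x≡0)

module _ (A : AbsoluteValue) where
  open AbsoluteValue A

  ≢0⇒∣∣-positive : ∀ {x} → x ≢ 0ℚ → 0ℚ ℚ.< ∣ x ∣
  ≢0⇒∣∣-positive {x} x≢0 with 0ℚ ℚ.<? ∣ x ∣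
  ... | yes 0<∣x∣ = 0<∣x∣
  ... | no  0≮∣x∣ = ⊥-elim (x≢0 (definite x (ℚ.≤-antisym (ℚ.≮⇒≥ 0≮∣x∣) (nonNeg x))))

  ∣∣-positive⇒≢0 : ∀ {x} → 0ℚ ℚ.< ∣ x ∣ → x ≢ 0ℚ
  ∣∣-positive⇒≢0 0<∣x∣ refl = ℚ.<⇒≢ 0<∣x∣ (sym ∣0∣)

÷-* : ∀ x {y} → y ≢ 0ℚ → (x ÷ y) ℚ.* y ≡ x
÷-* x {y} y≢0 with y ℚ.≟ 0ℚ
... | yes y≡0 = ⊥-elim (y≢0 y≡0)
... | no  n   = trans (ℚ.*-assoc x _ y) (trans (cong (x ℚ.*_) (ℚ.*-inverseˡ y {{ℚ.≢-nonZero n}})) (ℚ.*-identityʳ x))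

<-÷ : ∀ {x y z} → 0ℚ ℚ.< y → x ℚ.* y ℚ.< z → x ℚ.< z ÷ y
<-÷ {x} {y} {z} 0<y xy<z = *-cancelʳ-< y 0<y (subst (x ℚ.* y ℚ.<_) (sym (÷-* z (positive⇒≢0 0<y))) xy<z)

÷-positive : ∀ {x y} → 0ℚ ℚ.< x → 0ℚ ℚ.< y → 0ℚ ℚ.< x ÷ y
÷-positive {x} {y} 0<x 0<y = <-÷ 0<y (subst (ℚ._< x) (sym (ℚ.*-zeroˡ y)) 0<x)

∣∣-upper : ∀ {x b} → x ℚ.≤ b → ℚ.- x ℚ.≤ b → ℚ.∣ x ∣ ℚ.≤ b
∣∣-upper {x} {b} x≤b -x≤b with ℚ.∣p∣≡p∨∣p∣≡-p x
... | inj₁ e = subst (ℚ._≤ b) (sym e) x≤b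
... | inj₂ e = subst (ℚ._≤ b) (sym e) -x≤b

≤-∣∣ : ∀ x → x ℚ.≤ ℚ.∣ x ∣
≤-∣∣ x with ℚ.≤-total 0ℚ x
... | inj₁ 0≤x = ℚ.≤-reflexive (sym (ℚ.0≤p⇒∣p∣≡p 0≤x))
... | inj₂ x≤0 = ℚ.≤-trans x≤0 (ℚ.0≤∣p∣ x)

-- Ultrametric inequality and dyadic rationals

-- The order of a sum is at least the smaller of the two orders. The alternative form avoids
-- speaking of a maximum.
∣∣₂-ultrametric : ∀ x y → ∣ x ℚ.+ y ∣₂ ℚ.≤ ∣ x ∣₂ ⊎ ∣ x ℚ.+ y ∣₂ ℚ.≤ ∣ y ∣₂
∣∣₂-ultrametric x y = by-cases (x ℚ.≟ 0ℚ) (y ℚ.≟ 0ℚ) ((x ℚ.+ y) ℚ.≟ 0ℚ)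
  where
  bound : ∀ x y → x ≢ 0ℚ → y ≢ 0ℚ → x ℚ.+ y ≢ 0ℚ → v₂ x ℤ.≤ v₂ y → ∣ x ℚ.+ y ∣₂ ℚ.≤ ∣ x ∣₂
  bound x y x≢0 y≢0 s≢0 v≤v = subst₂ ℚ._≤_
    (sym (∣∣₂-hasOrder (x ℚ.+ y) s≢0 (proj₂ (proj₂ sum)))) (sym (∣∣₂-hasOrder x x≢0 (hasOrder-v₂ x x≢0)))
    (2^-antitone (proj₁ (proj₂ sum)))
    where sum = hasOrder-+ x y v≤v s≢0 (hasOrder-v₂ x x≢0) (hasOrder-v₂ y y≢0)
  by-cases : Dec (x ≡ 0ℚ) → Dec (y ≡ 0ℚ) → Dec (x ℚ.+ y ≡ 0ℚ) → ∣ x ℚ.+ y ∣₂ ℚ.≤ ∣ x ∣₂ ⊎ ∣ x ℚ.+ y ∣₂ ℚ.≤ ∣ y ∣₂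
  by-cases (yes refl) _ _ = inj₂ (ℚ.≤-reflexive (cong ∣_∣₂ (ℚ.+-identityˡ y)))
  by-cases (no _) (yes refl) _ = inj₁ (ℚ.≤-reflexive (cong ∣_∣₂ (ℚ.+-identityʳ x)))
  by-cases (no _) (no _) (yes s≡0) = inj₁ (subst (λ z → ∣ z ∣₂ ℚ.≤ ∣ x ∣₂) (sym s≡0) (∣∣₂-nonNeg x))
  by-cases (no x≢0) (no y≢0) (no s≢0) with ℤ.≤-total (v₂ x) (v₂ y)
  ... | inj₁ v≤v = inj₁ (bound x y x≢0 y≢0 s≢0 v≤v)
  ... | inj₂ v≤v = inj₂ (subst (λ z → ∣ z ∣₂ ℚ.≤ ∣ y ∣₂) (ℚ.+-comm y x)
    (bound y x y≢0 x≢0 (λ e → s≢0 (trans (ℚ.+-comm x y) e)) v≤v))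

∣∣₂-+-≤ : ∀ x y {b} → ∣ x ∣₂ ℚ.≤ b → ∣ y ∣₂ ℚ.≤ b → ∣ x ℚ.+ y ∣₂ ℚ.≤ b
∣∣₂-+-≤ x y x≤b y≤b with ∣∣₂-ultrametric x y
... | inj₁ h = ℚ.≤-trans h x≤b
... | inj₂ h = ℚ.≤-trans h y≤b

-- From x = (x + y) - y, the size of x is at most that of x + y or that of y, and the hypothesis
-- excludes the latter.
∣∣₂-dominant : ∀ x y → ∣ y ∣₂ ℚ.< ∣ x ∣₂ → ∣ x ℚ.+ y ∣₂ ≡ ∣ x ∣₂
∣∣₂-dominant x y y<x = ℚ.≤-antisym (∣∣₂-+-≤ x y ℚ.≤-refl (ℚ.<⇒≤ y<x)) lower
  where
  x≡ : (x ℚ.+ y) ℚ.+ (ℚ.- y) ≡ x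
  x≡ = solve 2 (λ x y → (x :+ y) :+ (:- y) := x) refl x y
  lower : ∣ x ∣₂ ℚ.≤ ∣ x ℚ.+ y ∣₂
  lower with ∣∣₂-ultrametric (x ℚ.+ y) (ℚ.- y)
  ... | inj₁ h = subst (λ z → ∣ z ∣₂ ℚ.≤ ∣ x ℚ.+ y ∣₂) x≡ h
  ... | inj₂ h = ⊥-elim (ℚ.<-irrefl refl (ℚ.<-≤-trans y<x (subst₂ (λ z w → ∣ z ∣₂ ℚ.≤ w) x≡ (∣∣₂-neg y) h)))

1-odd : Odd (+ 1)
1-odd 2∣1 with ∣1⇒≡1 2∣1
... | ()

∣2^∣₂ : ∀ k → ∣ 2^ k ∣₂ ≡ 2^ (ℤ.- k)
∣2^∣₂ k = ∣∣₂-hasOrder (2^ k) {k} (positive⇒≢0 (2^-positive k)) (hasOrder (+ 1) (+ 1) 1-odd 1-odd refl)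

∣∣₂-2^v₂ : ∀ {x} → x ≢ 0ℚ → ∣ x ∣₂ ≡ 2^ (ℤ.- v₂ x)
∣∣₂-2^v₂ {x} x≢0 = ∣∣₂-hasOrder x x≢0 (hasOrder-v₂ x x≢0)

odd⇒≢0 : ∀ {a} → Odd a → a ≢ + 0
odd⇒≢0 odd refl = odd (divides 0 refl)

fromℤ≢0 : ∀ {i} → i ≢ + 0 → fromℤ i ≢ 0ℚ
fromℤ≢0 {i} i≢0 e = i≢0 (fromℤ-injective {i} {+ 0} e)

fromℤ-odd-part : ∀ {i} → i ≢ + 0 → ∃₂ λ k a → a ≢ + 0 × fromℤ i ≡ 2^ (+ k) ℚ.* fromℤ a × ∣ fromℤ i ∣₂ ≡ 2^ (ℤ.- + k)
fromℤ-odd-part {i} i≢0 with odd-part i i≢0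
... | a , oa , e = v₂ℕ ℤ.∣ i ∣ , a , odd⇒≢0 oa , e ,
  ∣∣₂-hasOrder (fromℤ i) {+ v₂ℕ ℤ.∣ i ∣} (fromℤ≢0 i≢0) (hasOrder a (+ 1) oa 1-odd (trans (ℚ.*-identityʳ (fromℤ i)) e))

∣fromℤ∣₂≤1 : ∀ i → ∣ fromℤ i ∣₂ ℚ.≤ 1ℚ
∣fromℤ∣₂≤1 i with i ℤ.≟ + 0
... | yes refl = ℚ.<⇒≤ 0<1
... | no  i≢0 with fromℤ-odd-part i≢0
... | k , a , _ , _ , e = subst (ℚ._≤ 1ℚ) (sym e) (2^-antitone {+ 0} {+ k} (ℤ.+≤+ z≤n))

∣fromℕ∣ : ∀ n → ℚ.∣ fromℕ n ∣ ≡ fromℕ n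
∣fromℕ∣ n = ℚ.0≤p⇒∣p∣≡p (0≤fromℕ n)
  where
  0≤fromℕ : ∀ n → 0ℚ ℚ.≤ fromℕ n
  0≤fromℕ zero    = ℚ.≤-refl
  0≤fromℕ (suc n) = subst (0ℚ ℚ.≤_) (sym (fromℤ-+ (+ 1) (+ n))) (+-nonNeg (ℚ.<⇒≤ 0<1) (0≤fromℕ n))

fromℤ-neg : ∀ i → fromℤ (ℤ.- i) ≡ ℚ.- fromℤ i
fromℤ-neg i = begin
  fromℤ (ℤ.- i)                                     ≡⟨ solve 2 (λ x y → x := (x :+ y) :- y) refl (fromℤ (ℤ.- i)) (fromℤ i) ⟩
  (fromℤ (ℤ.- i) ℚ.+ fromℤ i) ℚ.- fromℤ i           ≡⟨ cong (ℚ._- fromℤ i) (fromℤ-+ (ℤ.- i) i) ⟨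
  fromℤ (ℤ.- i ℤ.+ i) ℚ.- fromℤ i                   ≡⟨ cong (λ z → fromℤ z ℚ.- fromℤ i) (ℤ.+-inverseˡ i) ⟩
  0ℚ ℚ.- fromℤ i                                    ≡⟨ ℚ.+-identityˡ _ ⟩
  ℚ.- fromℤ i                                       ∎
  where open ≡-Reasoning

1≤∣fromℤ∣ : ∀ {i} → i ≢ + 0 → 1ℚ ℚ.≤ ℚ.∣ fromℤ i ∣
1≤∣fromℤ∣ {+ zero}     i≢0 = ⊥-elim (i≢0 refl)
1≤∣fromℤ∣ {+ suc n}    i≢0 = subst (1ℚ ℚ.≤_) (sym (trans (∣fromℕ∣ (suc n)) (fromℤ-+ (+ 1) (+ n))))
  (≤-from-gap (fromℕ n) (subst (0ℚ ℚ.≤_) (∣fromℕ∣ n) (ℚ.0≤∣p∣ (fromℕ n))) refl)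
1≤∣fromℤ∣ { -[1+ n ]}  i≢0 = subst (1ℚ ℚ.≤_)
  (sym (trans (cong ℚ.∣_∣ (fromℤ-neg (+ suc n))) (ℚ.∣-p∣≡∣p∣ (fromℤ (+ suc n))))) (1≤∣fromℤ∣ {+ suc n} λ ())

∣2^∣ : ∀ k → ℚ.∣ 2^ k ∣ ≡ 2^ k
∣2^∣ k = ℚ.0≤p⇒∣p∣≡p (ℚ.<⇒≤ (2^-positive k))

-- x ∈ ℤ[1/2]
Dyadic : ℚ → Set
Dyadic x = ∃₂ λ k i → x ≡ 2^ k ℚ.* fromℤ i

dyadic-fromℤ : ∀ i → Dyadic (fromℤ i)
dyadic-fromℤ i = + 0 , i , sym (ℚ.*-identityˡ (fromℤ i))

dyadic-2^ : ∀ k → Dyadic (2^ k)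
dyadic-2^ k = k , + 1 , sym (ℚ.*-identityʳ (2^ k))

dyadic-* : ∀ {x y} → Dyadic x → Dyadic y → Dyadic (x ℚ.* y)
dyadic-* (k , i , refl) (l , j , refl) = k ℤ.+ l , i ℤ.* j ,
  trans (solve 4 (λ a b c d → (a :* b) :* (c :* d) := (a :* c) :* (b :* d)) refl (2^ k) (fromℤ i) (2^ l) (fromℤ j))
    (sym (cong₂ ℚ._*_ (2^-+ k l) (fromℤ-* i j)))

dyadic-+-≤ : ∀ {x y} k l → k ℤ.≤ l → ∀ i j → x ≡ 2^ k ℚ.* fromℤ i → y ≡ 2^ l ℚ.* fromℤ j → Dyadic (x ℚ.+ y)
dyadic-+-≤ k l k≤l i j refl refl with ≤⇒+ k≤l
... | n , refl = k , i ℤ.+ + (2 ℕ.^ n) ℤ.* j , (begin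
  2^ k ℚ.* fromℤ i ℚ.+ 2^ (k ℤ.+ + n) ℚ.* fromℤ j
    ≡⟨ cong (λ z → 2^ k ℚ.* fromℤ i ℚ.+ z ℚ.* fromℤ j) (2^-+ k (+ n)) ⟩
  2^ k ℚ.* fromℤ i ℚ.+ (2^ k ℚ.* 2^ (+ n)) ℚ.* fromℤ j
    ≡⟨ solve 4 (λ a b c d → a :* b :+ (a :* c) :* d := a :* (b :+ c :* d)) refl (2^ k) (fromℤ i) (2^ (+ n)) (fromℤ j) ⟩
  2^ k ℚ.* (fromℤ i ℚ.+ 2^ (+ n) ℚ.* fromℤ j)
    ≡⟨ cong (λ z → 2^ k ℚ.* (fromℤ i ℚ.+ z ℚ.* fromℤ j)) (fromℤ-2^ n) ⟨
  2^ k ℚ.* (fromℤ i ℚ.+ fromℤ (+ (2 ℕ.^ n)) ℚ.* fromℤ j)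
    ≡⟨ cong (λ z → 2^ k ℚ.* (fromℤ i ℚ.+ z)) (fromℤ-* (+ (2 ℕ.^ n)) j) ⟨
  2^ k ℚ.* (fromℤ i ℚ.+ fromℤ (+ (2 ℕ.^ n) ℤ.* j))
    ≡⟨ cong (2^ k ℚ.*_) (fromℤ-+ i (+ (2 ℕ.^ n) ℤ.* j)) ⟨
  2^ k ℚ.* fromℤ (i ℤ.+ + (2 ℕ.^ n) ℤ.* j) ∎)
  where open ≡-Reasoning

dyadic-+ : ∀ {x y} → Dyadic x → Dyadic y → Dyadic (x ℚ.+ y)
dyadic-+ {x} {y} (k , i , e) (l , j , e′) with ℤ.≤-total k l
... | inj₁ k≤l = dyadic-+-≤ k l k≤l i j e e′
... | inj₂ l≤k = subst Dyadic (ℚ.+-comm y x) (dyadic-+-≤ l k l≤k j i e′ e)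

dyadic-neg : ∀ {x} → Dyadic x → Dyadic (ℚ.- x)
dyadic-neg {x} d = subst Dyadic (solve 1 (λ x → con (ℚ.- 1ℚ) :* x := :- x) refl x) (dyadic-* (dyadic-fromℤ -[1+ 0 ]) d)

-- The product formula for ℤ[1/2]: only primes other than 2 and ∞ are missing, and there ∣x∣ ≤ 1.
dyadic-product : ∀ {x} → Dyadic x → x ≢ 0ℚ → 1ℚ ℚ.≤ ℚ.∣ x ∣ ℚ.* ∣ x ∣₂
dyadic-product (k , i , refl) x≢0 with i ℤ.≟ + 0
... | yes refl = ⊥-elim (x≢0 (ℚ.*-zeroʳ (2^ k)))
... | no  i≢0 with fromℤ-odd-part i≢0
... | l , a , a≢0 , e , e₂ = ℚ.≤-trans (1≤∣fromℤ∣ a≢0) (ℚ.≤-reflexive (sym (begin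
  ℚ.∣ 2^ k ℚ.* fromℤ i ∣ ℚ.* ∣ 2^ k ℚ.* fromℤ i ∣₂
    ≡⟨ cong₂ ℚ._*_ (ℚ.∣p*q∣≡∣p∣*∣q∣ (2^ k) (fromℤ i)) (∣∣₂-* (2^ k) (fromℤ i)) ⟩
  (ℚ.∣ 2^ k ∣ ℚ.* ℚ.∣ fromℤ i ∣) ℚ.* (∣ 2^ k ∣₂ ℚ.* ∣ fromℤ i ∣₂)
    ≡⟨ cong₂ (λ u v → (u ℚ.* ℚ.∣ fromℤ i ∣) ℚ.* (v ℚ.* ∣ fromℤ i ∣₂)) (∣2^∣ k) (∣2^∣₂ k) ⟩
  (2^ k ℚ.* ℚ.∣ fromℤ i ∣) ℚ.* (2^ (ℤ.- k) ℚ.* ∣ fromℤ i ∣₂)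
    ≡⟨ cong₂ (λ u v → (2^ k ℚ.* u) ℚ.* (2^ (ℤ.- k) ℚ.* v)) abs-i e₂ ⟩
  (2^ k ℚ.* (2^ (+ l) ℚ.* ℚ.∣ fromℤ a ∣)) ℚ.* (2^ (ℤ.- k) ℚ.* 2^ (ℤ.- + l))
    ≡⟨ solve 5 (λ s t u v w → (s :* (t :* u)) :* (v :* w) := (v :* s) :* ((w :* t) :* u)) refl
         (2^ k) (2^ (+ l)) ℚ.∣ fromℤ a ∣ (2^ (ℤ.- k)) (2^ (ℤ.- + l)) ⟩
  (2^ (ℤ.- k) ℚ.* 2^ k) ℚ.* ((2^ (ℤ.- + l) ℚ.* 2^ (+ l)) ℚ.* ℚ.∣ fromℤ a ∣)
    ≡⟨ cong₂ (λ u v → u ℚ.* (v ℚ.* ℚ.∣ fromℤ a ∣)) (2^-inverse k) (2^-inverse (+ l)) ⟩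
  1ℚ ℚ.* (1ℚ ℚ.* ℚ.∣ fromℤ a ∣)
    ≡⟨ trans (ℚ.*-identityˡ _) (ℚ.*-identityˡ _) ⟩
  ℚ.∣ fromℤ a ∣ ∎)))
  where
  open ≡-Reasoning
  abs-i : ℚ.∣ fromℤ i ∣ ≡ 2^ (+ l) ℚ.* ℚ.∣ fromℤ a ∣
  abs-i = trans (cong ℚ.∣_∣ e) (trans (ℚ.∣p*q∣≡∣p∣*∣q∣ (2^ (+ l)) (fromℤ a)) (cong (ℚ._* ℚ.∣ fromℤ a ∣) (∣2^∣ (+ l))))

-- Limit superior of sequences

Eventually : (ℕ → Set) → Set
Eventually P = ∃ λ N → ∀ n → N ℕ.≤ n → P n

eventually-map₂ : ∀ {P Q R : ℕ → Set} → (∀ n → P n → Q n → R n) → Eventually P → Eventually Q → Eventually R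
eventually-map₂ f (M , h) (N , k) = M ℕ.⊔ N , λ n le →
  f n (h n (ℕ.m⊔n≤o⇒m≤o M N le)) (k n (ℕ.m⊔n≤o⇒n≤o M N le))

-- lim sup s ≤ b
record Bound (s : ℕ → ℚ) (b : ℚ) : Set where
  constructor mkBound
  field bound : ∀ ε → 0ℚ ℚ.< ε → Eventually λ n → s n ℚ.≤ b ℚ.+ ε

open Bound

half-positive : ∀ {ε} → 0ℚ ℚ.< ε → 0ℚ ℚ.< ½ ℚ.* ε
half-positive = *-positive 0<½

half+half : ∀ ε → ½ ℚ.* ε ℚ.+ ½ ℚ.* ε ≡ ε
half+half ε = solve 1 (λ e → con ½ :* e :+ con ½ :* e := e) refl ε

bound-weaken : ∀ {s t b c} → (∀ n → t n ℚ.≤ s n) → b ℚ.≤ c → Bound s b → Bound t c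
bound-weaken t≤s b≤c B .bound ε 0<ε with bound B ε 0<ε
... | N , h = N , λ n le → ℚ.≤-trans (t≤s n) (ℚ.≤-trans (h n le) (ℚ.+-monoˡ-≤ ε b≤c))

eventually⇒bound : ∀ {s b} → Eventually (λ n → s n ℚ.≤ b) → Bound s b
eventually⇒bound (N , h) .bound ε 0<ε = N , λ n le → ℚ.≤-trans (h n le) (≤-from-gap ε (ℚ.<⇒≤ 0<ε) refl)

≤-from-all-ε : ∀ {x y} → (∀ ε → 0ℚ ℚ.< ε → x ℚ.≤ y ℚ.+ ε) → x ℚ.≤ y
≤-from-all-ε {x} {y} h = ℚ.≮⇒≥ λ y<x →
  let 0<d = gap-positive y<x
      le  = h (½ ℚ.* (x ℚ.- y)) (half-positive 0<d) in
  ℚ.<-irrefl refl (ℚ.≤-<-trans le (<-from-gap (½ ℚ.* (x ℚ.- y)) (half-positive 0<d)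
    (solve 2 (λ x y → (y :+ con ½ :* (x :- y)) :+ con ½ :* (x :- y) := x) refl x y)))

bound-lower : ∀ {s b c} → (∀ n → c ℚ.≤ s n) → Bound s b → c ℚ.≤ b
bound-lower c≤s B = ≤-from-all-ε λ ε 0<ε → let (N , h) = bound B ε 0<ε in ℚ.≤-trans (c≤s N) (h N ℕ.≤-refl)

bound-+ : ∀ {s t b c} → Bound s b → Bound t c → Bound (λ n → s n ℚ.+ t n) (b ℚ.+ c)
bound-+ {s} {t} {b} {c} B C .bound ε 0<ε = eventually-map₂
  (λ n h k → ℚ.≤-trans (ℚ.+-mono-≤ h k)
    (ℚ.≤-reflexive (solve 3 (λ b c e → (b :+ con ½ :* e) :+ (c :+ con ½ :* e) := (b :+ c) :+ e) refl b c ε)))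
  (bound B (½ ℚ.* ε) (half-positive 0<ε)) (bound C (½ ℚ.* ε) (half-positive 0<ε))

smaller : ∀ x y → 0ℚ ℚ.< x → 0ℚ ℚ.< y → ∃ λ δ → 0ℚ ℚ.< δ × δ ℚ.≤ x × δ ℚ.≤ y
smaller x y 0<x 0<y with ℚ.≤-total x y
... | inj₁ x≤y = x , 0<x , ℚ.≤-refl , x≤y
... | inj₂ y≤x = y , 0<y , y≤x , ℚ.≤-refl

bound-* : ∀ {s t b c} → (∀ n → 0ℚ ℚ.≤ s n) → (∀ n → 0ℚ ℚ.≤ t n) →
          Bound s b → Bound t c → Bound (λ n → s n ℚ.* t n) (b ℚ.* c)
bound-* {s} {t} {b} {c} 0≤s 0≤t B C .bound ε 0<ε = eventually-map₂ close (bound B δ 0<δ) (bound C δ 0<δ)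
  where
  0≤b : 0ℚ ℚ.≤ b
  0≤b = bound-lower 0≤s B
  0≤c : 0ℚ ℚ.≤ c
  0≤c = bound-lower 0≤t C
  0<b+c+1 : 0ℚ ℚ.< b ℚ.+ c ℚ.+ 1ℚ
  0<b+c+1 = ℚ.+-mono-≤-< (+-nonNeg 0≤b 0≤c) 0<1
  -- The error of the product is (b + c + δ) δ. With δ ≤ 1 and δ ≤ w it is at most (b + c + 1) w,
  -- and w is chosen so that this plus w equals ε.
  portion = split-positive 0<b+c+1 0<1 0<ε
  w = proj₁ portion
  small = smaller w 1ℚ (proj₁ (proj₂ portion)) 0<1
  δ = proj₁ small
  0<δ = proj₁ (proj₂ small)
  δ≤w = proj₁ (proj₂ (proj₂ small))
  δ≤1 = proj₂ (proj₂ (proj₂ small))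
  open ℚ.≤-Reasoning
  close : ∀ n → s n ℚ.≤ b ℚ.+ δ → t n ℚ.≤ c ℚ.+ δ → s n ℚ.* t n ℚ.≤ b ℚ.* c ℚ.+ ε
  close n h k = begin
    s n ℚ.* t n                                             ≤⟨ *-mono-≤ (0≤s n) (+-nonNeg 0≤c (ℚ.<⇒≤ 0<δ)) h k ⟩
    (b ℚ.+ δ) ℚ.* (c ℚ.+ δ)                                 ≡⟨ solve 3 (λ b c d → (b :+ d) :* (c :+ d) := b :* c :+ (b :+ c :+ d) :* d) refl b c δ ⟩
    b ℚ.* c ℚ.+ (b ℚ.+ c ℚ.+ δ) ℚ.* δ                       ≤⟨ ℚ.+-monoʳ-≤ (b ℚ.* c) (*-mono-≤ {b ℚ.+ c ℚ.+ δ} {b ℚ.+ c ℚ.+ 1ℚ} (+-nonNeg (+-nonNeg 0≤b 0≤c) (ℚ.<⇒≤ 0<δ))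
                                                                 (ℚ.<⇒≤ (proj₁ (proj₂ portion))) (ℚ.+-monoʳ-≤ (b ℚ.+ c) δ≤1) δ≤w) ⟩
    b ℚ.* c ℚ.+ (b ℚ.+ c ℚ.+ 1ℚ) ℚ.* w                      ≤⟨ ℚ.+-monoʳ-≤ (b ℚ.* c) (≤-from-gap (1ℚ ℚ.* w)
                                                                 (*-nonNeg (ℚ.<⇒≤ 0<1) (ℚ.<⇒≤ (proj₁ (proj₂ portion)))) (proj₂ (proj₂ portion))) ⟩
    b ℚ.* c ℚ.+ ε                                           ∎

bound-∣∣ : ∀ {s b} → Bound s b → Bound (λ n → ℚ.- s n) b → Bound (λ n → ℚ.∣ s n ∣) b
bound-∣∣ B C .bound ε 0<ε = eventually-map₂ (λ n → ∣∣-upper) (bound B ε 0<ε) (bound C ε 0<ε)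

-- Absolute values of points of a completion

-- ∥x∥ ≤ b
record AtMost {A : AbsoluteValue} (x : Completion A) (b : ℚ) : Set where
  constructor mkAtMost
  field abs-bound : Bound (λ n → AbsoluteValue.∣_∣ A (seq x n)) b

open AtMost

module _ {A : AbsoluteValue} where
  open AbsoluteValue A

  ∣-∣-swap : ∀ x y → ∣ x ℚ.- y ∣ ≡ ∣ y ℚ.- x ∣
  ∣-∣-swap x y = trans (cong ∣_∣ (solve 2 (λ x y → x :- y := :- (y :- x)) refl x y)) (neg (y ℚ.- x))

  ≈⇒atMost-0 : ∀ (x y : Completion A) → x ≈ y → Bound (λ n → ∣ seq x n ℚ.- seq y n ∣) 0ℚ
  ≈⇒atMost-0 x y x≈y .bound ε 0<ε with x≈y ε 0<ε
  ... | N , h = N , λ n le → ℚ.≤-trans (ℚ.<⇒≤ (h n le)) (ℚ.≤-reflexive (sym (ℚ.+-identityˡ ε)))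

  atMost-0⇒≈ : ∀ (x y : Completion A) → Bound (λ n → ∣ seq x n ℚ.- seq y n ∣) 0ℚ → x ≈ y
  atMost-0⇒≈ x y B ε 0<ε with bound B (½ ℚ.* ε) (half-positive 0<ε)
  ... | N , h = N , λ n le → ℚ.≤-<-trans (h n le) (<-from-gap (½ ℚ.* ε) (half-positive 0<ε)
    (trans (cong (ℚ._+ ½ ℚ.* ε) (ℚ.+-identityˡ (½ ℚ.* ε))) (half+half ε)))

  pointwise⇒≈ : ∀ (x y : Completion A) → (∀ n → seq x n ≡ seq y n) → x ≈ y
  pointwise⇒≈ x y e ε 0<ε = 0 , λ n _ → subst (ℚ._< ε)
    (sym (trans (cong (λ z → ∣ z ℚ.- seq y n ∣) (e n)) (trans (cong ∣_∣ (ℚ.+-inverseʳ (seq y n))) ∣0∣))) 0<ε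

  atMost-weaken : ∀ {x : Completion A} {b c} → b ℚ.≤ c → AtMost x b → AtMost x c
  atMost-weaken b≤c (mkAtMost B) = mkAtMost (bound-weaken (λ n → ℚ.≤-refl) b≤c B)

  atMost-+ : ∀ {x y : Completion A} {b c} → AtMost x b → AtMost y c → AtMost (x + y) (b ℚ.+ c)
  atMost-+ {x} {y} (mkAtMost B) (mkAtMost C) = mkAtMost (bound-weaken (λ n → triangle (seq x n) (seq y n)) ℚ.≤-refl (bound-+ B C))

  atMost-* : ∀ {x y : Completion A} {b c} → AtMost x b → AtMost y c → AtMost (x * y) (b ℚ.* c)
  atMost-* {x} {y} (mkAtMost B) (mkAtMost C) = mkAtMost (bound-weaken (λ n → ℚ.≤-reflexive (mult (seq x n) (seq y n))) ℚ.≤-refl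
    (bound-* (λ n → nonNeg (seq x n)) (λ n → nonNeg (seq y n)) B C))

  atMost-neg : ∀ {x : Completion A} {b} → AtMost x b → AtMost (- x) b
  atMost-neg {x} (mkAtMost B) = mkAtMost (bound-weaken (λ n → ℚ.≤-reflexive (neg (seq x n))) ℚ.≤-refl B)

  atMost-fromℚ : ∀ r → AtMost {A} (fromℚ r) ∣ r ∣
  atMost-fromℚ r = mkAtMost (eventually⇒bound (0 , λ n _ → ℚ.≤-refl))

  atMost-fromℚ⁻¹ : ∀ {r b} → AtMost {A} (fromℚ r) b → ∣ r ∣ ℚ.≤ b
  atMost-fromℚ⁻¹ (mkAtMost B) = bound-lower (λ n → ℚ.≤-refl) B

  atMost-≈ : ∀ {x y : Completion A} {b} → x ≈ y → AtMost x b → AtMost y b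
  atMost-≈ {x} {y} {b} x≈y (mkAtMost B) = mkAtMost (bound-weaken
    (λ n → ℚ.≤-trans (split-difference (seq y n) (seq x n)) (ℚ.+-monoʳ-≤ ∣ seq x n ∣ (ℚ.≤-reflexive (∣-∣-swap (seq y n) (seq x n)))))
    (ℚ.≤-reflexive (ℚ.+-identityʳ b)) (bound-+ B (≈⇒atMost-0 x y x≈y)))

  atMost-some : ∀ (x : Completion A) → ∃ λ b → 0ℚ ℚ.< b × AtMost x b
  atMost-some x = let (b , N , 0<b , h) = eventually-bounded {seq x} (cauchy x) in
    b , 0<b , mkAtMost (eventually⇒bound (N , h))

  ≈-sym : ∀ (x y : Completion A) → x ≈ y → y ≈ x
  ≈-sym x y x≈y ε 0<ε with x≈y ε 0<ε
  ... | N , h = N , λ n le → subst (ℚ._< ε) (∣-∣-swap (seq x n) (seq y n)) (h n le)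

  ≈-trans : ∀ (x y z : Completion A) → x ≈ y → y ≈ z → x ≈ z
  ≈-trans x y z x≈y y≈z = atMost-0⇒≈ x z (bound-weaken
    (λ n → ℚ.≤-trans (ℚ.≤-reflexive (cong ∣_∣ (solve 3 (λ x y z → x :- z := (x :- y) :+ (y :- z)) refl (seq x n) (seq y n) (seq z n))))
      (triangle (seq x n ℚ.- seq y n) (seq y n ℚ.- seq z n)))
    ℚ.≤-refl (bound-+ (≈⇒atMost-0 x y x≈y) (≈⇒atMost-0 y z y≈z)))

  +-cong : ∀ (x x′ y y′ : Completion A) → x ≈ x′ → y ≈ y′ → x + y ≈ x′ + y′
  +-cong x x′ y y′ x≈x′ y≈y′ = atMost-0⇒≈ (x + y) (x′ + y′) (bound-weaken
    (λ n → ℚ.≤-trans (ℚ.≤-reflexive (cong ∣_∣ (solve 4 (λ a b c d → (a :+ c) :- (b :+ d) := (a :- b) :+ (c :- d)) refl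
        (seq x n) (seq x′ n) (seq y n) (seq y′ n))))
      (triangle (seq x n ℚ.- seq x′ n) (seq y n ℚ.- seq y′ n)))
    ℚ.≤-refl (bound-+ (≈⇒atMost-0 x x′ x≈x′) (≈⇒atMost-0 y y′ y≈y′)))

  neg-cong : ∀ (x y : Completion A) → x ≈ y → - x ≈ - y
  neg-cong x y x≈y ε 0<ε with x≈y ε 0<ε
  ... | N , h = N , λ n le → subst (ℚ._< ε)
    (trans (sym (neg (seq x n ℚ.- seq y n))) (cong ∣_∣ (solve 2 (λ x y → :- (x :- y) := (:- x) :- (:- y)) refl (seq x n) (seq y n))))
    (h n le)

  -- The difference is x (y - y′) + y′ (x - x′), and in each term a bounded factor meets one whose
  -- limit superior is 0.
  *-cong : ∀ (x x′ y y′ : Completion A) → x ≈ x′ → y ≈ y′ → x * y ≈ x′ * y′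
  *-cong x x′ y y′ x≈x′ y≈y′ = atMost-0⇒≈ (x * y) (x′ * y′)
    (bound-weaken
      (λ n → ℚ.≤-reflexive (cong ∣_∣ (solve 4 (λ a b c d → a :* c :- b :* d := a :* (c :- d) :+ d :* (a :- b)) refl
        (seq x n) (seq x′ n) (seq y n) (seq y′ n))))
      (ℚ.≤-reflexive (trans (cong₂ ℚ._+_ (ℚ.*-zeroʳ b) (ℚ.*-zeroʳ c)) (ℚ.+-identityˡ 0ℚ)))
      (abs-bound (atMost-+ {x * (y - y′)} {y′ * (x - x′)}
        (atMost-* {x} {y - y′} (proj₂ (proj₂ bx)) (mkAtMost (≈⇒atMost-0 y y′ y≈y′)))
        (atMost-* {y′} {x - x′} (proj₂ (proj₂ by)) (mkAtMost (≈⇒atMost-0 x x′ x≈x′))))))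
    where
    bx = atMost-some x
    by = atMost-some y′
    b = proj₁ bx
    c = proj₁ by

  -- An upper bound for one factor becomes a lower bound for the other. Eventually ∣y∣ ≤ 2M and ∣xy
  -- - f∣ < ∣f∣/2, so ∣f∣/2 ≤ ∣x∣∣y∣ ≤ 2M∣x∣, whence the factor 4.
  cofactor-lower : ∀ (x y : Completion A) {f M} → x * y ≈ fromℚ f → f ≢ 0ℚ → 0ℚ ℚ.< M → AtMost y M →
                   Eventually λ n → ∣ f ∣ ℚ.≤ fromℕ 4 ℚ.* M ℚ.* ∣ seq x n ∣
  cofactor-lower x y {f} {M} xy≈f f≢0 0<M (mkAtMost B) = eventually-map₂ close (bound B M 0<M) (xy≈f (½ ℚ.* ∣ f ∣) (half-positive 0<∣f∣))
    where
    0<∣f∣ = ≢0⇒∣∣-positive A f≢0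
    close : ∀ n → ∣ seq y n ∣ ℚ.≤ M ℚ.+ M → ∣ seq x n ℚ.* seq y n ℚ.- f ∣ ℚ.< ½ ℚ.* ∣ f ∣ → ∣ f ∣ ℚ.≤ fromℕ 4 ℚ.* M ℚ.* ∣ seq x n ∣
    close n h k = ≤-from-gap (fromℕ 2 ℚ.* ((X ℚ.* (M ℚ.+ M) ℚ.- X ℚ.* Y) ℚ.+ ((X ℚ.* Y ℚ.+ D) ℚ.- F) ℚ.+ (½ ℚ.* F ℚ.- D)))
      (*-nonNeg (ℚ.<⇒≤ (ℚ.positive⁻¹ (fromℕ 2))) (+-nonNeg (+-nonNeg
        (gap-nonNeg (ℚ.*-monoˡ-≤-nonNeg X {{ℚ.nonNegative (nonNeg (seq x n))}} h))
        (gap-nonNeg f≤)) (gap-nonNeg (ℚ.<⇒≤ k))))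
      (solve 5 (λ F X M Y D → F :+ con (fromℕ 2) :* ((X :* (M :+ M) :- X :* Y) :+ ((X :* Y :+ D) :- F) :+ (con ½ :* F :- D))
        := con (fromℕ 4) :* M :* X) refl F X M Y D)
      where
      X = ∣ seq x n ∣
      Y = ∣ seq y n ∣
      F = ∣ f ∣
      D = ∣ seq x n ℚ.* seq y n ℚ.- f ∣
      f≤ : F ℚ.≤ X ℚ.* Y ℚ.+ D
      f≤ = ℚ.≤-trans (split-difference f (seq x n ℚ.* seq y n))
        (ℚ.≤-reflexive (cong₂ ℚ._+_ (mult (seq x n) (seq y n)) (∣-∣-swap f (seq x n ℚ.* seq y n))))

-- The ultrametric inequality keeps the bound b where the general rule for sums gives 2b.
atMost₂-+ : ∀ {x y : ℚ₂} {b} → AtMost x b → AtMost y b → AtMost (x + y) b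
atMost₂-+ {x} {y} (mkAtMost B) (mkAtMost C) = mkAtMost (mkBound λ ε 0<ε →
  eventually-map₂ (λ n → ∣∣₂-+-≤ (seq x n) (seq y n)) (bound B ε 0<ε) (bound C ε 0<ε))

-- Upper bounds from the order on ℝ

-- A negated inequality has to yield an index, so one term past the Cauchy modulus for ε/4 is tested
-- against b + ε/2. If it passes, all later terms stay below b + ε; if it fails, they all exceed b +
-- ε/4, which is the excluded inequality.
≮⇒bound : ∀ {x : ℝ} {b} → ¬ (fromℚ b < x) → Bound (seq x) b
≮⇒bound {x} {b} b≮x .bound ε 0<ε with cauchy x (½ ℚ.* (½ ℚ.* ε)) (half-positive (half-positive 0<ε))
... | N , h = go (seq x N ℚ.≤? b ℚ.+ ½ ℚ.* ε)
  where
  η = ½ ℚ.* (½ ℚ.* ε)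
  0<η = half-positive (half-positive 0<ε)
  go : Dec (seq x N ℚ.≤ b ℚ.+ ½ ℚ.* ε) → Eventually λ n → seq x n ℚ.≤ b ℚ.+ ε
  go (yes le) = N , λ n N≤n → ≤-from-gap
    ((b ℚ.+ ½ ℚ.* ε ℚ.- seq x N) ℚ.+ (η ℚ.- (seq x n ℚ.- seq x N)) ℚ.+ η)
    (+-nonNeg (+-nonNeg (gap-nonNeg le)
      (gap-nonNeg (ℚ.≤-trans (≤-∣∣ (seq x n ℚ.- seq x N)) (ℚ.<⇒≤ (h n N N≤n ℕ.≤-refl))))) (ℚ.<⇒≤ 0<η))
    (solve 4 (λ b e u v → u :+ ((b :+ con ½ :* e :- v) :+ (con ½ :* (con ½ :* e) :- (u :- v)) :+ con ½ :* (con ½ :* e)) := b :+ e) refl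
      b ε (seq x n) (seq x N))
  go (no ≰) = ⊥-elim (b≮x (η , 0<η , N , λ n N≤n → ≤-from-gap
    ((seq x N ℚ.- (b ℚ.+ ½ ℚ.* ε)) ℚ.+ (η ℚ.- (seq x N ℚ.- seq x n)))
    (+-nonNeg (gap-nonNeg (ℚ.<⇒≤ (ℚ.≰⇒> ≰)))
      (gap-nonNeg (ℚ.≤-trans (≤-∣∣ (seq x N ℚ.- seq x n)) (ℚ.<⇒≤ (h N n ℕ.≤-refl N≤n)))))
    (solve 4 (λ b e u v → (b :+ con ½ :* (con ½ :* e)) :+ ((v :- (b :+ con ½ :* e)) :+ (con ½ :* (con ½ :* e) :- (v :- u))) := u) refl
      b ε (seq x n) (seq x N))))

-- Translating by −s brings every x > s/2 closer to 0.
translate-bound : ∀ {x : ℝ} {s} → 0ℚ ℚ.< s → ¬ (∥ x - fromℚ s ∥ < ∥ x ∥) → Bound (seq x) (½ ℚ.* s)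
translate-bound {x} {s} 0<s h = ≮⇒bound {x} λ (ε , 0<ε , N , k) →
  -- `δ≤s` gives x - s ≤ x - δ. Since 2x - s ≥ 2ε, `δ≤ε` gives s - x ≤ x - δ.
  let (δ , 0<δ , δ≤s , δ≤ε) = smaller s (ε ℚ.+ ε) 0<s (+-positive 0<ε 0<ε) in
  h (δ , 0<δ , N , λ n le → ℚ.≤-trans
    (shift δ (seq x n)
      (∣∣-upper {seq x n ℚ.- s} {seq x n ℚ.- δ}
        (≤-from-gap (s ℚ.- δ) (gap-nonNeg δ≤s) (solve 3 (λ x s d → (x :- s) :+ (s :- d) := x :- d) refl (seq x n) s δ))
        (≤-from-gap ((seq x n ℚ.- (½ ℚ.* s ℚ.+ ε)) ℚ.+ (seq x n ℚ.- (½ ℚ.* s ℚ.+ ε)) ℚ.+ ((ε ℚ.+ ε) ℚ.- δ))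
          (+-nonNeg (+-nonNeg (gap-nonNeg (k n le)) (gap-nonNeg (k n le))) (gap-nonNeg δ≤ε))
          (solve 4 (λ x s e d → (:- (x :- s)) :+ ((x :- (con ½ :* s :+ e)) :+ (x :- (con ½ :* s :+ e)) :+ ((e :+ e) :- d)) := x :- d) refl
            (seq x n) s ε δ))))
    (≤-∣∣ (seq x n)))
  where
  shift : ∀ δ x {y} → y ℚ.≤ x ℚ.- δ → y ℚ.+ δ ℚ.≤ x
  shift δ x {y} le = ℚ.≤-trans (ℚ.+-monoˡ-≤ δ le) (ℚ.≤-reflexive (solve 2 (λ x d → (x :- d) :+ d := x) refl x δ))

-- The order sees only the underlying sequences, so points that differ in their Cauchy proofs can be
-- exchanged.
<-pointwise : ∀ {x x′ y y′ : ℝ} → (∀ n → seq x n ≡ seq x′ n) → (∀ n → seq y n ≡ seq y′ n) → x < y → x′ < y′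
<-pointwise e e′ (ε , 0<ε , N , h) = ε , 0<ε , N , λ n le → subst₂ (λ u v → u ℚ.+ ε ℚ.≤ v) (e n) (e′ n) (h n le)

-- Field arithmetic

module Field (K : QuadraticField κ ℓ) where
  open QuadraticField K using (commutativeRing; Carrier; ι; Rational; _⁻¹; ω) public
  open QuadraticField K using (ι-isRingHomomorphism; 1≉0; ⁻¹-inverse; spans) renaming
    (_≈_ to _≈ᴷ_; _+_ to _+ᴷ_; _*_ to _*ᴷ_; -_ to -ᴷ_; _-_ to _-ᴷ_; 0# to 0ᴷ; 1# to 1ᴷ;
     refl to ≈ᴷ-refl; sym to ≈ᴷ-sym; trans to ≈ᴷ-trans; reflexive to ≈ᴷ-reflexive;
     +-cong to +ᴷ-cong; *-cong to *ᴷ-cong; -‿cong to -ᴷ-cong; setoid to setoidᴷ) public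
  module ≈ᴷ-Reasoning = SetoidReasoning setoidᴷ
  open ≈ᴷ-Reasoning

  open IsRingHomomorphism ι-isRingHomomorphism public using () renaming
    (+-homo to ι-+; *-homo to ι-*; -‿homo to ι-neg; 0#-homo to ι-0; 1#-homo to ι-1)

  private
    coefficients : ACR._-Raw-AlmostCommutative⟶_ ℚ.+-*-rawRing (ACR.fromCommutativeRing commutativeRing)
    coefficients = record
      { ⟦_⟧ = ι ; +-homo = ι-+ ; *-homo = ι-* ; -‿homo = ι-neg ; 0-homo = ι-0 ; 1-homo = ι-1 }

    decide : ∀ p q → Maybe (ι p ≈ᴷ ι q)
    decide p q with p ℚ.≟ q
    ... | yes e = just (≈ᴷ-reflexive (cong ι e))
    ... | no  _ = nothing

  -- Equality in K is not assumed decidable. Taking coefficients from ℚ through `ι` lets the solver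
  -- compare constants.
  module KS = Algebra.Solver.Ring ℚ.+-*-rawRing (ACR.fromCommutativeRing commutativeRing) coefficients decide

  ι-cong : ∀ {r s} → r ≡ s → ι r ≈ᴷ ι s
  ι-cong e = ≈ᴷ-reflexive (cong ι e)

  ι-nonzero : ∀ {r} → r ≢ 0ℚ → ¬ ι r ≈ᴷ 0ᴷ
  ι-nonzero {r} r≢0 e = 1≉0 (begin
    1ᴷ                        ≈⟨ ι-1 ⟨
    ι 1ℚ                      ≈⟨ ι-cong (÷-* 1ℚ r≢0) ⟨
    ι ((1ℚ ÷ r) ℚ.* r)        ≈⟨ ι-* (1ℚ ÷ r) r ⟩
    ι (1ℚ ÷ r) *ᴷ ι r         ≈⟨ *ᴷ-cong ≈ᴷ-refl e ⟩
    ι (1ℚ ÷ r) *ᴷ 0ᴷ          ≈⟨ *ᴷ-cong ≈ᴷ-refl ι-0 ⟨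
    ι (1ℚ ÷ r) *ᴷ ι 0ℚ        ≈⟨ KS.solve 1 (λ x → x KS.:* KS.con 0ℚ KS.:= KS.con 0ℚ) ≈ᴷ-refl (ι (1ℚ ÷ r)) ⟩
    ι 0ℚ                      ≈⟨ ι-0 ⟩
    0ᴷ                        ∎)

  -- The solver knows 0 only as ι 0, so statements about vanishing are phrased with ι 0ℚ.
  *ᴷ-nonzero : ∀ {x y} → ¬ x ≈ᴷ ι 0ℚ → ¬ y ≈ᴷ ι 0ℚ → ¬ x *ᴷ y ≈ᴷ ι 0ℚ
  *ᴷ-nonzero {x} {y} x≉0 y≉0 e = y≉0 (begin
    y                         ≈⟨ KS.solve 1 (λ y → y KS.:= y KS.:* KS.con 1ℚ) ≈ᴷ-refl y ⟩
    y *ᴷ ι 1ℚ                 ≈⟨ *ᴷ-cong ≈ᴷ-refl (≈ᴷ-trans ι-1 (≈ᴷ-sym (⁻¹-inverse x λ z → x≉0 (≈ᴷ-trans z (≈ᴷ-sym ι-0))))) ⟩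
    y *ᴷ (x *ᴷ x ⁻¹)          ≈⟨ KS.solve 3 (λ x y z → y KS.:* (x KS.:* z) KS.:= (x KS.:* y) KS.:* z) ≈ᴷ-refl x y (x ⁻¹) ⟩
    (x *ᴷ y) *ᴷ x ⁻¹          ≈⟨ *ᴷ-cong e ≈ᴷ-refl ⟩
    ι 0ℚ *ᴷ x ⁻¹              ≈⟨ KS.solve 1 (λ x → KS.con 0ℚ KS.:* x KS.:= KS.con 0ℚ) ≈ᴷ-refl (x ⁻¹) ⟩
    ι 0ℚ                      ∎)

  *-inverse : ∀ {x} → ¬ Rational x → x *ᴷ x ⁻¹ ≈ᴷ ι 1ℚ
  *-inverse {x} irr = ≈ᴷ-trans (⁻¹-inverse x λ e → irr (0ℚ , ≈ᴷ-trans e (≈ᴷ-sym ι-0))) (≈ᴷ-sym ι-1)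

  -- The form in which irrationality is used: it makes linear forms in x with rational coefficients
  -- nonzero.
  rational-quotient : ∀ {x r s} → r ≢ 0ℚ → ι r *ᴷ x ≈ᴷ ι s → Rational x
  rational-quotient {x} {r} {s} r≢0 e = (1ℚ ÷ r) ℚ.* s , (begin
    x                               ≈⟨ KS.solve 1 (λ x → x KS.:= KS.con 1ℚ KS.:* x) ≈ᴷ-refl x ⟩
    ι 1ℚ *ᴷ x                       ≈⟨ *ᴷ-cong (≈ᴷ-trans (ι-cong (sym (÷-* 1ℚ r≢0))) (ι-* (1ℚ ÷ r) r)) ≈ᴷ-refl ⟩
    (ι (1ℚ ÷ r) *ᴷ ι r) *ᴷ x        ≈⟨ KS.solve 3 (λ a b c → (a KS.:* b) KS.:* c KS.:= a KS.:* (b KS.:* c)) ≈ᴷ-refl (ι (1ℚ ÷ r)) (ι r) x ⟩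
    ι (1ℚ ÷ r) *ᴷ (ι r *ᴷ x)        ≈⟨ *ᴷ-cong ≈ᴷ-refl e ⟩
    ι (1ℚ ÷ r) *ᴷ ι s               ≈⟨ ι-* (1ℚ ÷ r) s ⟨
    ι ((1ℚ ÷ r) ℚ.* s)              ∎)

  -- If y were a rational r, then (r + a) x = 1. Here r + a cannot vanish because 1 does not, so x
  -- would be rational.
  irrational-step : ∀ {x y a} → ¬ Rational x → y ≈ᴷ x ⁻¹ -ᴷ ι a → ¬ Rational y
  irrational-step {x} {y} {a} irr step (r , y≈r) = irr (rational-quotient {x} {r ℚ.+ a} {1ℚ} nonzero inverse)
    where
    inverse : ι (r ℚ.+ a) *ᴷ x ≈ᴷ ι 1ℚ
    inverse = begin
      ι (r ℚ.+ a) *ᴷ x                ≈⟨ *ᴷ-cong (ι-+ r a) ≈ᴷ-refl ⟩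
      (ι r +ᴷ ι a) *ᴷ x               ≈⟨ *ᴷ-cong (+ᴷ-cong (≈ᴷ-trans (≈ᴷ-sym y≈r) step) ≈ᴷ-refl) ≈ᴷ-refl ⟩
      ((x ⁻¹ -ᴷ ι a) +ᴷ ι a) *ᴷ x     ≈⟨ KS.solve 3 (λ u a x → ((u KS.:- a) KS.:+ a) KS.:* x KS.:= x KS.:* u) ≈ᴷ-refl (x ⁻¹) (ι a) x ⟩
      x *ᴷ x ⁻¹                       ≈⟨ *-inverse irr ⟩
      ι 1ℚ                            ∎
    nonzero : r ℚ.+ a ≢ 0ℚ
    nonzero e = ι-nonzero {1ℚ} (λ ()) (begin
      ι 1ℚ                            ≈⟨ inverse ⟨
      ι (r ℚ.+ a) *ᴷ x                ≈⟨ *ᴷ-cong (ι-cong e) ≈ᴷ-refl ⟩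
      ι 0ℚ *ᴷ x                       ≈⟨ KS.solve 1 (λ x → KS.con 0ℚ KS.:* x KS.:= KS.con 0ℚ) ≈ᴷ-refl x ⟩
      ι 0ℚ                            ≈⟨ ι-0 ⟩
      0ᴷ                              ∎)

  -- α₍ₙ₊₁₎ = β n for an irrational expansion with partial quotients a.
  record CompleteQuotients (β : ℕ → Carrier) (a : ℕ → ℚ) : Set ℓ where
    field
      irrational : ∀ n → ¬ Rational (β n)
      step       : ∀ n → β (suc n) ≈ᴷ β n ⁻¹ -ᴷ ι (a (suc n))

-- Absolute values of field elements

module Place (K : QuadraticField κ ℓ) {A : AbsoluteValue} (σ : QuadraticField.Carrier K → Completion A)
  (σ-isRingHomomorphism : IsRingHomomorphism (QuadraticField.rawRing K) (completionRing A) σ) where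

  open Field K
  open AbsoluteValue A using (∣_∣)
  open IsRingHomomorphism σ-isRingHomomorphism using () renaming
    (+-homo to σ-+; *-homo to σ-*; -‿homo to σ-neg; 0#-homo to σ-0; 1#-homo to σ-1; ⟦⟧-cong to σ-cong) public

  σ-ι-fromℕ : ∀ n → σ (ι (fromℕ n)) ≈ fromℚ (fromℕ n)
  σ-ι-fromℕ zero    = ≈-trans (σ (ι 0ℚ)) (σ 0ᴷ) (fromℚ 0ℚ) (σ-cong ι-0) σ-0
  σ-ι-fromℕ (suc n) = ≈-trans (σ (ι (fromℕ (suc n)))) (σ (ι 1ℚ) + σ (ι (fromℕ n))) (fromℚ (fromℕ (suc n)))
    (≈-trans (σ (ι (fromℕ (suc n)))) (σ (ι 1ℚ +ᴷ ι (fromℕ n))) (σ (ι 1ℚ) + σ (ι (fromℕ n)))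
      (σ-cong (≈ᴷ-trans (ι-cong (fromℤ-+ (+ 1) (+ n))) (ι-+ 1ℚ (fromℕ n)))) (σ-+ (ι 1ℚ) (ι (fromℕ n))))
    (≈-trans (σ (ι 1ℚ) + σ (ι (fromℕ n))) (fromℚ 1ℚ + fromℚ (fromℕ n)) (fromℚ (fromℕ (suc n)))
      (+-cong (σ (ι 1ℚ)) (fromℚ 1ℚ) (σ (ι (fromℕ n))) (fromℚ (fromℕ n))
        (≈-trans (σ (ι 1ℚ)) (σ 1ᴷ) (fromℚ 1ℚ) (σ-cong ι-1) σ-1) (σ-ι-fromℕ n))
      (pointwise⇒≈ {A} (fromℚ 1ℚ + fromℚ (fromℕ n)) (fromℚ (fromℕ (suc n))) λ _ → sym (fromℤ-+ (+ 1) (+ n))))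

  σ-ι-fromℤ : ∀ i → σ (ι (fromℤ i)) ≈ fromℚ (fromℤ i)
  σ-ι-fromℤ (+ n)    = σ-ι-fromℕ n
  σ-ι-fromℤ -[1+ n ] = ≈-trans (σ (ι (fromℤ -[1+ n ]))) (σ (-ᴷ ι m)) (fromℚ (fromℤ -[1+ n ]))
    (σ-cong (≈ᴷ-trans (ι-cong (fromℤ-neg (+ suc n))) (ι-neg m)))
    (≈-trans (σ (-ᴷ ι m)) (- σ (ι m)) (fromℚ (fromℤ -[1+ n ])) (σ-neg (ι m))
      (≈-trans (- σ (ι m)) (- fromℚ m) (fromℚ (fromℤ -[1+ n ])) (neg-cong (σ (ι m)) (fromℚ m) (σ-ι-fromℕ (suc n)))
        (pointwise⇒≈ {A} (- fromℚ m) (fromℚ (fromℤ -[1+ n ])) λ _ → sym (fromℤ-neg (+ suc n)))))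
    where m = fromℕ (suc n)

  -- Preservation of 1 and sums fixes the image of the integers. For r with numerator n and
  -- denominator d, the image of r times d is therefore n, and multiplication by the rational 1/d,
  -- exact on every term, recovers r.
  σ-ι : ∀ r → σ (ι r) ≈ fromℚ r
  σ-ι r = ≈-trans (σ (ι r)) (x * fromℚ i) (fromℚ r)
    (pointwise⇒≈ {A} (σ (ι r)) (x * fromℚ i) λ k → cancel (seq (σ (ι r)) k))
    (≈-trans (x * fromℚ i) (fromℚ n * fromℚ i) (fromℚ r)
      (*-cong x (fromℚ n) (fromℚ i) (fromℚ i) x≈n (pointwise⇒≈ {A} (fromℚ i) (fromℚ i) λ _ → refl))
      (pointwise⇒≈ {A} (fromℚ n * fromℚ i) (fromℚ r) λ _ → sym (trans (cancel r) (cong (ℚ._* i) (*-denominator r)))))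
    where
    d = fromℤ (↧ r)
    n = fromℤ (↥ r)
    i = 1ℚ ÷ d
    x = σ (ι r) * fromℚ d
    cancel : ∀ z → z ≡ (z ℚ.* d) ℚ.* i
    cancel z = trans (sym (ℚ.*-identityʳ z)) (trans (cong (z ℚ.*_) (trans (sym (÷-* 1ℚ (fromℤ≢0 {↧ r} λ ()))) (ℚ.*-comm i d)))
      (sym (ℚ.*-assoc z d i)))
    x≈n : x ≈ fromℚ n
    x≈n = ≈-trans x (σ (ι r) * σ (ι d)) (fromℚ n)
      (*-cong (σ (ι r)) (σ (ι r)) (fromℚ d) (σ (ι d)) (pointwise⇒≈ {A} (σ (ι r)) (σ (ι r)) λ _ → refl)
        (≈-sym (σ (ι d)) (fromℚ d) (σ-ι-fromℤ (↧ r))))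
      (≈-trans (σ (ι r) * σ (ι d)) (σ (ι n)) (fromℚ n)
        (≈-sym (σ (ι n)) (σ (ι r) * σ (ι d)) (≈-trans (σ (ι n)) (σ (ι r *ᴷ ι d)) (σ (ι r) * σ (ι d))
          (σ-cong (≈ᴷ-trans (ι-cong (sym (*-denominator r))) (ι-* r d))) (σ-* (ι r) (ι d))))
        (σ-ι-fromℤ (↥ r)))

  infix 4 ∥_∥≤_

  ∥_∥≤_ : Carrier → ℚ → Set
  ∥ x ∥≤ b = AtMost (σ x) b

  ∥∥-cong : ∀ {x y b} → x ≈ᴷ y → ∥ x ∥≤ b → ∥ y ∥≤ b
  ∥∥-cong x≈y = atMost-≈ (σ-cong x≈y)

  ∥∥-+ : ∀ {x y b b′} → ∥ x ∥≤ b → ∥ y ∥≤ b′ → ∥ x +ᴷ y ∥≤ b ℚ.+ b′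
  ∥∥-+ {x} {y} B C = atMost-≈ (≈-sym (σ (x +ᴷ y)) (σ x + σ y) (σ-+ x y)) (atMost-+ B C)

  ∥∥-* : ∀ {x y b b′} → ∥ x ∥≤ b → ∥ y ∥≤ b′ → ∥ x *ᴷ y ∥≤ b ℚ.* b′
  ∥∥-* {x} {y} B C = atMost-≈ (≈-sym (σ (x *ᴷ y)) (σ x * σ y) (σ-* x y)) (atMost-* B C)

  ∥∥-neg : ∀ {x b} → ∥ x ∥≤ b → ∥ -ᴷ x ∥≤ b
  ∥∥-neg {x} B = atMost-≈ (≈-sym (σ (-ᴷ x)) (- σ x) (σ-neg x)) (atMost-neg B)

  ∥ι∥ : ∀ r → ∥ ι r ∥≤ ∣ r ∣
  ∥ι∥ r = atMost-≈ (≈-sym (σ (ι r)) (fromℚ r) (σ-ι r)) (atMost-fromℚ r)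

  ∥ι∥⁻¹ : ∀ {r b} → ∥ ι r ∥≤ b → ∣ r ∣ ℚ.≤ b
  ∥ι∥⁻¹ {r} B = atMost-fromℚ⁻¹ (atMost-≈ (σ-ι r) B)

  σ-minus-ι : ∀ x r → σ (x -ᴷ ι r) ≈ σ x - fromℚ r
  σ-minus-ι x r = ≈-trans (σ (x -ᴷ ι r)) (σ x + σ (-ᴷ ι r)) (σ x - fromℚ r) (σ-+ x (-ᴷ ι r))
    (+-cong (σ x) (σ x) (σ (-ᴷ ι r)) (- fromℚ r) (pointwise⇒≈ {A} (σ x) (σ x) λ _ → refl)
      (≈-trans (σ (-ᴷ ι r)) (- σ (ι r)) (- fromℚ r) (σ-neg (ι r)) (neg-cong (σ (ι r)) (fromℚ r) (σ-ι r))))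

-- Recursions for the convergents

module _ (a : ℕ → ℚ) where

  -- p₋ n and q₋ n are p_{n−1} and q_{n−1}, with p₋ 0 = 1 and q₋ 0 = 0.
  p₋ q₋ : ℕ → ℚ
  p₋ n = Matrix₂.m₁₁ (convergentMatrix a n)
  q₋ n = Matrix₂.m₂₁ (convergentMatrix a n)

  p₋-suc : ∀ n → p₋ (suc n) ≡ p a n
  p₋-suc n = solve 2 (λ x y → x :* con 0ℚ :+ y :* con 1ℚ := y) refl (p₋ n) (p a n)

  q₋-suc : ∀ n → q₋ (suc n) ≡ q a n
  q₋-suc n = solve 2 (λ x y → x :* con 0ℚ :+ y :* con 1ℚ := y) refl (q₋ n) (q a n)

  p-suc : ∀ n → p a (suc n) ≡ p₋ n ℚ.+ p a n ℚ.* a (suc n)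
  p-suc n = cong (ℚ._+ p a n ℚ.* a (suc n)) (ℚ.*-identityʳ (p₋ n))

  q-suc : ∀ n → q a (suc n) ≡ q₋ n ℚ.+ q a n ℚ.* a (suc n)
  q-suc n = cong (ℚ._+ q a n ℚ.* a (suc n)) (ℚ.*-identityʳ (q₋ n))

  convergents-dyadic : (∀ n → Dyadic (a (suc n))) → ∀ n →
    (Dyadic (p₋ n) × Dyadic (q₋ n)) × (Dyadic (p a n) × Dyadic (q a n))
  convergents-dyadic da zero    = (dyadic-fromℤ (+ 1) , dyadic-fromℤ (+ 0)) , (dyadic-fromℤ (+ 0) , dyadic-fromℤ (+ 1))
  convergents-dyadic da (suc n) with convergents-dyadic da n
  ... | (dp₋ , dq₋) , (dp , dq) =
    (subst Dyadic (sym (p₋-suc n)) dp , subst Dyadic (sym (q₋-suc n)) dq) ,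
    (subst Dyadic (sym (p-suc n)) (dyadic-+ dp₋ (dyadic-* dp (da n))) ,
     subst Dyadic (sym (q-suc n)) (dyadic-+ dq₋ (dyadic-* dq (da n))))

  convergent : ℕ → ℚ
  convergent n = p′ a n ÷ q′ a n

  convergent-* : ∀ n → q a n ≢ 0ℚ → convergent n ℚ.* q a n ≡ p a n
  convergent-* n q≢0 = 2^-cancel (ℤ.- valuationSum a n) _ _
    (trans (solve 3 (λ u r q → u :* (r :* q) := r :* (u :* q)) refl (2^ (ℤ.- valuationSum a n)) (convergent n) (q a n))
      (÷-* (p′ a n) (*-nonzero (positive⇒≢0 (2^-positive (ℤ.- valuationSum a n))) q≢0)))

-- Continued fractions in K

module ContinuedFraction (K : QuadraticField κ ℓ) (β : ℕ → QuadraticField.Carrier K) (a : ℕ → ℚ)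
  (quotients : Field.CompleteQuotients K β a) where

  open Field K
  open CompleteQuotients quotients
  open ≈ᴷ-Reasoning

  complete-quotient : ∀ n → β n *ᴷ (ι (a (suc n)) +ᴷ β (suc n)) ≈ᴷ ι 1ℚ
  complete-quotient n = begin
    β n *ᴷ (ι (a (suc n)) +ᴷ β (suc n))                   ≈⟨ *ᴷ-cong ≈ᴷ-refl (+ᴷ-cong ≈ᴷ-refl (step n)) ⟩
    β n *ᴷ (ι (a (suc n)) +ᴷ (β n ⁻¹ -ᴷ ι (a (suc n))))   ≈⟨ KS.solve 3 (λ x a y → x KS.:* (a KS.:+ (y KS.:- a)) KS.:= x KS.:* y) ≈ᴷ-refl (β n) (ι (a (suc n))) (β n ⁻¹) ⟩
    β n *ᴷ β n ⁻¹                                         ≈⟨ *-inverse (irrational n) ⟩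
    ι 1ℚ                                                  ∎

  P : ℕ → Carrier
  P zero    = ι 1ℚ
  P (suc n) = P n *ᴷ β n

  w : ℕ → Carrier
  w n = ι (q a n) *ᴷ P n

  ι-q-suc : ∀ n → ι (q a (suc n)) ≈ᴷ ι (q₋ a n) +ᴷ ι (q a n) *ᴷ ι (a (suc n))
  ι-q-suc n = ≈ᴷ-trans (ι-cong (q-suc a n)) (≈ᴷ-trans (ι-+ (q₋ a n) (q a n ℚ.* a (suc n))) (+ᴷ-cong ≈ᴷ-refl (ι-* (q a n) (a (suc n)))))

  ι-p-suc : ∀ n → ι (p a (suc n)) ≈ᴷ ι (p₋ a n) +ᴷ ι (p a n) *ᴷ ι (a (suc n))
  ι-p-suc n = ≈ᴷ-trans (ι-cong (p-suc a n)) (≈ᴷ-trans (ι-+ (p₋ a n) (p a n ℚ.* a (suc n))) (+ᴷ-cong ≈ᴷ-refl (ι-* (p a n) (a (suc n)))))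

  -- After the recursion for q is inserted, the terms in qₙ combine to wₙ times βₙ (aₙ₊₁ + βₙ₊₁),
  -- which is wₙ. The sum thus does not depend on n.
  w-identity : ∀ n → w n +ᴷ ι (q₋ a n) *ᴷ P (suc n) ≈ᴷ ι 1ℚ
  w-identity zero    = KS.solve 1 (λ x → KS.con 1ℚ KS.:* KS.con 1ℚ KS.:+ KS.con 0ℚ KS.:* (KS.con 1ℚ KS.:* x) KS.:= KS.con 1ℚ) ≈ᴷ-refl (β 0)
  w-identity (suc n) = begin
    ι (q a (suc n)) *ᴷ (P n *ᴷ β n) +ᴷ ι (q₋ a (suc n)) *ᴷ ((P n *ᴷ β n) *ᴷ β (suc n))
      ≈⟨ +ᴷ-cong (*ᴷ-cong (ι-q-suc n) ≈ᴷ-refl) (*ᴷ-cong (ι-cong (q₋-suc a n)) ≈ᴷ-refl) ⟩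
    (ι (q₋ a n) +ᴷ ι (q a n) *ᴷ ι (a (suc n))) *ᴷ (P n *ᴷ β n) +ᴷ ι (q a n) *ᴷ ((P n *ᴷ β n) *ᴷ β (suc n))
      ≈⟨ KS.solve 6 (λ u v x P b c → (u KS.:+ v KS.:* x) KS.:* (P KS.:* b) KS.:+ v KS.:* ((P KS.:* b) KS.:* c)
           KS.:= (v KS.:* P) KS.:* (b KS.:* (x KS.:+ c)) KS.:+ u KS.:* (P KS.:* b)) ≈ᴷ-refl
           (ι (q₋ a n)) (ι (q a n)) (ι (a (suc n))) (P n) (β n) (β (suc n)) ⟩
    w n *ᴷ (β n *ᴷ (ι (a (suc n)) +ᴷ β (suc n))) +ᴷ ι (q₋ a n) *ᴷ P (suc n)
      ≈⟨ +ᴷ-cong (*ᴷ-cong ≈ᴷ-refl (complete-quotient n)) ≈ᴷ-refl ⟩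
    w n *ᴷ ι 1ℚ +ᴷ ι (q₋ a n) *ᴷ P (suc n)
      ≈⟨ +ᴷ-cong (KS.solve 1 (λ x → x KS.:* KS.con 1ℚ KS.:= x) ≈ᴷ-refl (w n)) ≈ᴷ-refl ⟩
    w n +ᴷ ι (q₋ a n) *ᴷ P (suc n)
      ≈⟨ w-identity n ⟩
    ι 1ℚ ∎

  -- Solved for w - 1 because the real estimate is an induction on the distance from 1.
  w-suc : ∀ n → w (suc n) -ᴷ ι 1ℚ ≈ᴷ -ᴷ (w n *ᴷ (β n *ᴷ β (suc n)))
  w-suc n = begin
    w (suc n) -ᴷ ι 1ℚ
      ≈⟨ KS.solve 3 (λ w x o → w KS.:- o KS.:= (w KS.:+ x) KS.:- o KS.:- x) ≈ᴷ-refl (w (suc n)) (ι (q₋ a (suc n)) *ᴷ P (suc (suc n))) (ι 1ℚ) ⟩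
    (w (suc n) +ᴷ ι (q₋ a (suc n)) *ᴷ P (suc (suc n))) -ᴷ ι 1ℚ -ᴷ ι (q₋ a (suc n)) *ᴷ P (suc (suc n))
      ≈⟨ +ᴷ-cong (+ᴷ-cong (w-identity (suc n)) ≈ᴷ-refl) (-ᴷ-cong (*ᴷ-cong (ι-cong (q₋-suc a n)) ≈ᴷ-refl)) ⟩
    ι 1ℚ -ᴷ ι 1ℚ -ᴷ ι (q a n) *ᴷ ((P n *ᴷ β n) *ᴷ β (suc n))
      ≈⟨ KS.solve 4 (λ q P b c → KS.con 1ℚ KS.:- KS.con 1ℚ KS.:- q KS.:* ((P KS.:* b) KS.:* c) KS.:= KS.:- ((q KS.:* P) KS.:* (b KS.:* c))) ≈ᴷ-refl
           (ι (q a n)) (P n) (β n) (β (suc n)) ⟩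
    -ᴷ (w n *ᴷ (β n *ᴷ β (suc n))) ∎

  Λ₋ Λ : ℕ → Carrier
  Λ₋ n = ι (q₋ a n) *ᴷ β 0 -ᴷ ι (p₋ a n)
  Λ  n = ι (q a n) *ᴷ β 0 -ᴷ ι (p a n)

  Λ₋-suc : ∀ n → Λ₋ (suc n) ≈ᴷ Λ n
  Λ₋-suc n = +ᴷ-cong (*ᴷ-cong (ι-cong (q₋-suc a n)) ≈ᴷ-refl) (-ᴷ-cong (ι-cong (p₋-suc a n)))

  -- Proved together with `Λ-suc`: the step to n + 1 uses this relation at n, and `Λ₋ (suc n)` is
  -- `Λ n`. The start is -1 and α.
  Λ-Λ₋ : ∀ n → Λ n ≈ᴷ -ᴷ (Λ₋ n *ᴷ β n)
  Λ-suc : ∀ n → Λ (suc n) ≈ᴷ -ᴷ (Λ n *ᴷ β (suc n))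

  Λ-Λ₋ zero    = KS.solve 1 (λ x → KS.con 1ℚ KS.:* x KS.:- KS.con 0ℚ KS.:= KS.:- ((KS.con 0ℚ KS.:* x KS.:- KS.con 1ℚ) KS.:* x)) ≈ᴷ-refl (β 0)
  Λ-Λ₋ (suc n) = ≈ᴷ-trans (Λ-suc n) (-ᴷ-cong (*ᴷ-cong (≈ᴷ-sym (Λ₋-suc n)) ≈ᴷ-refl))

  Λ-suc n = begin
    ι (q a (suc n)) *ᴷ β 0 -ᴷ ι (p a (suc n))
      ≈⟨ +ᴷ-cong (*ᴷ-cong (ι-q-suc n) ≈ᴷ-refl) (-ᴷ-cong (ι-p-suc n)) ⟩
    (ι (q₋ a n) +ᴷ ι (q a n) *ᴷ A) *ᴷ β 0 -ᴷ (ι (p₋ a n) +ᴷ ι (p a n) *ᴷ A)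
      -- Adding and subtracting Λₙ βₙ₊₁ creates the factor aₙ₊₁ + βₙ₊₁. Times βₙ it is 1, so the
      -- first two terms cancel.
      ≈⟨ KS.solve 7 (λ q₋ q p₋ p A x b → (q₋ KS.:+ q KS.:* A) KS.:* x KS.:- (p₋ KS.:+ p KS.:* A)
           KS.:= (q₋ KS.:* x KS.:- p₋) KS.:+ (q KS.:* x KS.:- p) KS.:* (A KS.:+ b) KS.:- (q KS.:* x KS.:- p) KS.:* b) ≈ᴷ-refl
           (ι (q₋ a n)) (ι (q a n)) (ι (p₋ a n)) (ι (p a n)) A (β 0) (β (suc n)) ⟩
    Λ₋ n +ᴷ Λ n *ᴷ (A +ᴷ β (suc n)) -ᴷ Λ n *ᴷ β (suc n)
      ≈⟨ +ᴷ-cong (+ᴷ-cong ≈ᴷ-refl (*ᴷ-cong (Λ-Λ₋ n) ≈ᴷ-refl)) ≈ᴷ-refl ⟩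
    Λ₋ n +ᴷ (-ᴷ (Λ₋ n *ᴷ β n)) *ᴷ (A +ᴷ β (suc n)) -ᴷ Λ n *ᴷ β (suc n)
      ≈⟨ KS.solve 4 (λ l b y z → l KS.:+ (KS.:- (l KS.:* b)) KS.:* y KS.:- z KS.:= l KS.:- l KS.:* (b KS.:* y) KS.:- z) ≈ᴷ-refl
           (Λ₋ n) (β n) (A +ᴷ β (suc n)) (Λ n *ᴷ β (suc n)) ⟩
    Λ₋ n -ᴷ Λ₋ n *ᴷ (β n *ᴷ (A +ᴷ β (suc n))) -ᴷ Λ n *ᴷ β (suc n)
      ≈⟨ +ᴷ-cong (+ᴷ-cong ≈ᴷ-refl (-ᴷ-cong (*ᴷ-cong ≈ᴷ-refl (complete-quotient n)))) ≈ᴷ-refl ⟩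
    Λ₋ n -ᴷ Λ₋ n *ᴷ ι 1ℚ -ᴷ Λ n *ᴷ β (suc n)
      ≈⟨ KS.solve 2 (λ l z → l KS.:- l KS.:* KS.con 1ℚ KS.:- z KS.:= KS.:- z) ≈ᴷ-refl (Λ₋ n) (Λ n *ᴷ β (suc n)) ⟩
    -ᴷ (Λ n *ᴷ β (suc n)) ∎
    where A = ι (a (suc n))

  -- The sign is (-1)ⁿ, but absolute values forget it, so its parity is not recorded.
  Λ≈±P : ∀ n → Λ n ≈ᴷ P (suc n) ⊎ Λ n ≈ᴷ -ᴷ P (suc n)
  Λ≈±P zero    = inj₁ (KS.solve 1 (λ x → KS.con 1ℚ KS.:* x KS.:- KS.con 0ℚ KS.:= KS.con 1ℚ KS.:* x) ≈ᴷ-refl (β 0))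
  Λ≈±P (suc n) with Λ≈±P n
  ... | inj₁ e = inj₂ (≈ᴷ-trans (Λ-suc n) (-ᴷ-cong (*ᴷ-cong e ≈ᴷ-refl)))
  ... | inj₂ e = inj₁ (≈ᴷ-trans (Λ-suc n) (≈ᴷ-trans (-ᴷ-cong (*ᴷ-cong e ≈ᴷ-refl))
    (KS.solve 2 (λ x y → KS.:- ((KS.:- x) KS.:* y) KS.:= x KS.:* y) ≈ᴷ-refl (P (suc n)) (β (suc n)))))

  Λ-nonzero : ∀ n → q a n ≢ 0ℚ → ¬ Λ n ≈ᴷ ι 0ℚ
  Λ-nonzero n q≢0 e = irrational 0 (rational-quotient q≢0 (begin
    ι (q a n) *ᴷ β 0                              ≈⟨ KS.solve 2 (λ x y → x KS.:= (x KS.:- y) KS.:+ y) ≈ᴷ-refl (ι (q a n) *ᴷ β 0) (ι (p a n)) ⟩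
    Λ n +ᴷ ι (p a n)                              ≈⟨ +ᴷ-cong e ≈ᴷ-refl ⟩
    ι 0ℚ +ᴷ ι (p a n)                             ≈⟨ KS.solve 1 (λ x → KS.con 0ℚ KS.:+ x KS.:= x) ≈ᴷ-refl (ι (p a n)) ⟩
    ι (p a n)                                     ∎))

  -- The approximation error is taken inside K, so that one element is measured at both places.
  Θ : ℕ → Carrier
  Θ n = β 0 -ᴷ ι (convergent a n)

  q*Θ : ∀ n → q a n ≢ 0ℚ → ι (q a n) *ᴷ Θ n ≈ᴷ Λ n
  q*Θ n q≢0 = begin
    ι (q a n) *ᴷ (β 0 -ᴷ ι (convergent a n))
      ≈⟨ KS.solve 3 (λ q x r → q KS.:* (x KS.:- r) KS.:= q KS.:* x KS.:- r KS.:* q) ≈ᴷ-refl (ι (q a n)) (β 0) (ι (convergent a n)) ⟩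
    ι (q a n) *ᴷ β 0 -ᴷ ι (convergent a n) *ᴷ ι (q a n)
      ≈⟨ +ᴷ-cong ≈ᴷ-refl (-ᴷ-cong (≈ᴷ-trans (≈ᴷ-sym (ι-* (convergent a n) (q a n))) (ι-cong (convergent-* a n q≢0)))) ⟩
    Λ n ∎

  Θ≈ : ∀ n → q a n ≢ 0ℚ → ι (1ℚ ÷ q a n) *ᴷ Λ n ≈ᴷ Θ n
  Θ≈ n q≢0 = begin
    ι i *ᴷ Λ n                          ≈⟨ *ᴷ-cong ≈ᴷ-refl (q*Θ n q≢0) ⟨
    ι i *ᴷ (ι (q a n) *ᴷ Θ n)           ≈⟨ KS.solve 3 (λ x y z → x KS.:* (y KS.:* z) KS.:= (x KS.:* y) KS.:* z) ≈ᴷ-refl (ι i) (ι (q a n)) (Θ n) ⟩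
    (ι i *ᴷ ι (q a n)) *ᴷ Θ n           ≈⟨ *ᴷ-cong (≈ᴷ-trans (≈ᴷ-sym (ι-* i (q a n))) (ι-cong (÷-* 1ℚ q≢0))) ≈ᴷ-refl ⟩
    ι 1ℚ *ᴷ Θ n                         ≈⟨ KS.solve 1 (λ x → KS.con 1ℚ KS.:* x KS.:= x) ≈ᴷ-refl (Θ n) ⟩
    Θ n                                 ∎
    where i = 1ℚ ÷ q a n

-- Quadratic equations over ℤ[1/2]

-- The product of the three denominators makes all three numbers integers; only membership in ℤ[1/2]
-- is kept.
clear-denominators : ∀ x y z → ∃ λ d → d ≢ 0ℚ × Dyadic (d ℚ.* x) × Dyadic (d ℚ.* y) × Dyadic (d ℚ.* z)
clear-denominators x y z = X ℚ.* (Y ℚ.* Z) ,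
  *-nonzero (fromℤ≢0 {↧ x} λ ()) (*-nonzero (fromℤ≢0 {↧ y} λ ()) (fromℤ≢0 {↧ z} λ ())) ,
  subst Dyadic (solve 4 (λ x X Y Z → (x :* X) :* (Y :* Z) := (X :* (Y :* Z)) :* x) refl x X Y Z)
    (dyadic-* (integral x) (dyadic-* (dyadic-fromℤ (↧ y)) (dyadic-fromℤ (↧ z)))) ,
  subst Dyadic (solve 4 (λ y X Y Z → (y :* Y) :* (X :* Z) := (X :* (Y :* Z)) :* y) refl y X Y Z)
    (dyadic-* (integral y) (dyadic-* (dyadic-fromℤ (↧ x)) (dyadic-fromℤ (↧ z)))) ,
  subst Dyadic (solve 4 (λ z X Y Z → (z :* Z) :* (X :* Y) := (X :* (Y :* Z)) :* z) refl z X Y Z)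
    (dyadic-* (integral z) (dyadic-* (dyadic-fromℤ (↧ x)) (dyadic-fromℤ (↧ y))))
  where
  X = fromℤ (↧ x)
  Y = fromℤ (↧ y)
  Z = fromℤ (↧ z)
  integral : ∀ r → Dyadic (r ℚ.* fromℤ (↧ r))
  integral r = subst Dyadic (sym (*-denominator r)) (dyadic-fromℤ (↥ r))

module Quadratic (K : QuadraticField κ ℓ) where
  open Field K
  open ≈ᴷ-Reasoning

  record QuadraticEquation (x : Carrier) : Set ℓ where
    field
      A B C : ℚ
      A≢0 : A ≢ 0ℚ
      A-dyadic : Dyadic A
      B-dyadic : Dyadic B
      C-dyadic : Dyadic C
      equation : ι A *ᴷ (x *ᴷ x) ≈ᴷ ι B *ᴷ x +ᴷ ι C

  ι-minus : ∀ r s → ι (r ℚ.- s) ≈ᴷ ι r -ᴷ ι s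
  ι-minus r s = ≈ᴷ-trans (ι-+ r (ℚ.- s)) (+ᴷ-cong ≈ᴷ-refl (ι-neg s))

  -- With x = r + sω and x² = t + uω, eliminating ω gives s x² = u x + (s t - u r), and s ≠ 0
  -- because x is irrational.
  quadraticEquation : ∀ {x} → ¬ Rational x → QuadraticEquation x
  quadraticEquation {x} irr with spans x | spans (x *ᴷ x)
  ... | r , s , x≈ | t , u , xx≈ = record
    { A = d ℚ.* s ; B = d ℚ.* u ; C = d ℚ.* v
    ; A≢0 = *-nonzero (proj₁ (proj₂ cleared)) s≢0
    ; A-dyadic = proj₁ (proj₂ (proj₂ cleared))
    ; B-dyadic = proj₁ (proj₂ (proj₂ (proj₂ cleared)))
    ; C-dyadic = proj₂ (proj₂ (proj₂ (proj₂ cleared)))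
    ; equation = begin
        ι (d ℚ.* s) *ᴷ (x *ᴷ x)
          ≈⟨ *ᴷ-cong (ι-* d s) xx≈ ⟩
        (ι d *ᴷ ι s) *ᴷ (ι t +ᴷ ι u *ᴷ ω)
          ≈⟨ KS.solve 6 (λ d r s t u o → (d KS.:* s) KS.:* (t KS.:+ u KS.:* o)
               KS.:= (d KS.:* u) KS.:* (r KS.:+ s KS.:* o) KS.:+ d KS.:* (s KS.:* t KS.:- u KS.:* r)) ≈ᴷ-refl (ι d) (ι r) (ι s) (ι t) (ι u) ω ⟩
        (ι d *ᴷ ι u) *ᴷ (ι r +ᴷ ι s *ᴷ ω) +ᴷ ι d *ᴷ (ι s *ᴷ ι t -ᴷ ι u *ᴷ ι r)
          ≈⟨ +ᴷ-cong (*ᴷ-cong (ι-* d u) x≈) (≈ᴷ-trans (ι-* d v) (*ᴷ-cong ≈ᴷ-refl (≈ᴷ-trans (ι-minus (s ℚ.* t) (u ℚ.* r))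
               (+ᴷ-cong (ι-* s t) (-ᴷ-cong (ι-* u r)))))) ⟨
        ι (d ℚ.* u) *ᴷ x +ᴷ ι (d ℚ.* v) ∎
    }
    where
    v = s ℚ.* t ℚ.- u ℚ.* r
    cleared = clear-denominators s u v
    d = proj₁ cleared
    s≢0 : s ≢ 0ℚ
    s≢0 refl = irr (r , ≈ᴷ-trans x≈ (KS.solve 2 (λ r o → r KS.:+ KS.con 0ℚ KS.:* o KS.:= r) ≈ᴷ-refl (ι r) ω))

  -- The form A (p − q x)(p − q x̄), where x̄ = B/A − x is the conjugate of x.
  module Norm {x : Carrier} (irr : ¬ Rational x) (E : QuadraticEquation x) (P Q : ℚ) where
    open QuadraticEquation E

    norm : ℚ
    norm = A ℚ.* (P ℚ.* P) ℚ.- B ℚ.* (P ℚ.* Q) ℚ.- C ℚ.* (Q ℚ.* Q)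

    norm-dyadic : Dyadic P → Dyadic Q → Dyadic norm
    norm-dyadic dP dQ = dyadic-+ (dyadic-+ (dyadic-* A-dyadic (dyadic-* dP dP))
      (dyadic-neg (dyadic-* B-dyadic (dyadic-* dP dQ)))) (dyadic-neg (dyadic-* C-dyadic (dyadic-* dQ dQ)))

    -- `conjugate` equals -A (P - Q x̄), written in terms of x alone, so no conjugate embedding is
    -- needed. The coefficient B - 2 A x is A (x̄ - x), which does not depend on P and Q; the
    -- remaining term is a multiple of the small `factor`.
    factor conjugate : Carrier
    factor    = ι Q *ᴷ x -ᴷ ι P
    conjugate = ι Q *ᴷ (ι B -ᴷ ι (fromℕ 2) *ᴷ (ι A *ᴷ x)) +ᴷ ι A *ᴷ factor

    norm≈ : ι norm ≈ᴷ factor *ᴷ conjugate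
    norm≈ = begin
      ι norm
        ≈⟨ ≈ᴷ-trans (ι-minus _ _) (+ᴷ-cong (≈ᴷ-trans (ι-minus _ _) (+ᴷ-cong (term A P P) (-ᴷ-cong (term B P Q)))) (-ᴷ-cong (term C Q Q))) ⟩
      ι A *ᴷ (ι P *ᴷ ι P) -ᴷ ι B *ᴷ (ι P *ᴷ ι Q) -ᴷ ι C *ᴷ (ι Q *ᴷ ι Q)
        ≈⟨ KS.solve 6 (λ A B C P Q x → A KS.:* (P KS.:* P) KS.:- B KS.:* (P KS.:* Q) KS.:- C KS.:* (Q KS.:* Q)
             KS.:= A KS.:* (P KS.:* P) KS.:- B KS.:* (P KS.:* Q) KS.:- ((B KS.:* x KS.:+ C) KS.:- B KS.:* x) KS.:* (Q KS.:* Q)) ≈ᴷ-refl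
             (ι A) (ι B) (ι C) (ι P) (ι Q) x ⟩
      ι A *ᴷ (ι P *ᴷ ι P) -ᴷ ι B *ᴷ (ι P *ᴷ ι Q) -ᴷ ((ι B *ᴷ x +ᴷ ι C) -ᴷ ι B *ᴷ x) *ᴷ (ι Q *ᴷ ι Q)
        ≈⟨ +ᴷ-cong ≈ᴷ-refl (-ᴷ-cong (*ᴷ-cong (+ᴷ-cong equation ≈ᴷ-refl) ≈ᴷ-refl)) ⟨
      ι A *ᴷ (ι P *ᴷ ι P) -ᴷ ι B *ᴷ (ι P *ᴷ ι Q) -ᴷ (ι A *ᴷ (x *ᴷ x) -ᴷ ι B *ᴷ x) *ᴷ (ι Q *ᴷ ι Q)
        ≈⟨ KS.solve 5 (λ A B P Q x → A KS.:* (P KS.:* P) KS.:- B KS.:* (P KS.:* Q) KS.:- (A KS.:* (x KS.:* x) KS.:- B KS.:* x) KS.:* (Q KS.:* Q)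
             KS.:= (Q KS.:* x KS.:- P) KS.:* (Q KS.:* (B KS.:- KS.con (fromℕ 2) KS.:* (A KS.:* x)) KS.:+ A KS.:* (Q KS.:* x KS.:- P))) ≈ᴷ-refl
             (ι A) (ι B) (ι P) (ι Q) x ⟩
      factor *ᴷ conjugate ∎
      where
      term : ∀ r s t → ι (r ℚ.* (s ℚ.* t)) ≈ᴷ ι r *ᴷ (ι s *ᴷ ι t)
      term r s t = ≈ᴷ-trans (ι-* r (s ℚ.* t)) (*ᴷ-cong ≈ᴷ-refl (ι-* s t))

    -- The terms collect to Q B - A P - Q A x, whose vanishing would make x rational.
    conjugate-nonzero : Q ≢ 0ℚ → ¬ conjugate ≈ᴷ ι 0ℚ
    conjugate-nonzero Q≢0 e = irr (rational-quotient {x} {Q ℚ.* A} {Q ℚ.* B ℚ.- A ℚ.* P} (*-nonzero Q≢0 A≢0) (begin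
      ι (Q ℚ.* A) *ᴷ x
        ≈⟨ *ᴷ-cong (ι-* Q A) ≈ᴷ-refl ⟩
      (ι Q *ᴷ ι A) *ᴷ x
        ≈⟨ KS.solve 5 (λ A B P Q x → (Q KS.:* A) KS.:* x KS.:= (Q KS.:* B KS.:- A KS.:* P)
             KS.:- (Q KS.:* (B KS.:- KS.con (fromℕ 2) KS.:* (A KS.:* x)) KS.:+ A KS.:* (Q KS.:* x KS.:- P))) ≈ᴷ-refl (ι A) (ι B) (ι P) (ι Q) x ⟩
      (ι Q *ᴷ ι B -ᴷ ι A *ᴷ ι P) -ᴷ conjugate
        ≈⟨ +ᴷ-cong ≈ᴷ-refl (-ᴷ-cong e) ⟩
      (ι Q *ᴷ ι B -ᴷ ι A *ᴷ ι P) -ᴷ ι 0ℚ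
        ≈⟨ KS.solve 1 (λ x → x KS.:- KS.con 0ℚ KS.:= x) ≈ᴷ-refl (ι Q *ᴷ ι B -ᴷ ι A *ᴷ ι P) ⟩
      ι Q *ᴷ ι B -ᴷ ι A *ᴷ ι P
        ≈⟨ ≈ᴷ-trans (ι-minus (Q ℚ.* B) (A ℚ.* P)) (+ᴷ-cong (ι-* Q B) (-ᴷ-cong (ι-* A P))) ⟨
      ι (Q ℚ.* B ℚ.- A ℚ.* P) ∎))

-- Remainders of the partial quotients

-- Bounds for ∣α₍ₙ₊₁₎∣ at the two places, in terms of τ(n).
r∞ r₂ : Fin 2 → ℚ
r∞ zero       = 1ℚ
r∞ (suc zero) = ½
r₂ zero       = ½
r₂ (suc zero) = 1ℚ

-- Consecutive indices have opposite parity, so one factor is ½ and the other 1. The bounds do not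
-- contract at every step, but at either place they do over any two consecutive ones.
r∞-consecutive : ∀ n → r∞ (τ n) ℚ.* r∞ (τ (suc n)) ≡ ½
r∞-consecutive zero          = refl
r∞-consecutive (suc zero)    = refl
r∞-consecutive (suc (suc n)) = r∞-consecutive n

r₂-consecutive : ∀ n → r₂ (τ n) ℚ.* r₂ (τ (suc n)) ≡ ½
r₂-consecutive zero          = refl
r₂-consecutive (suc zero)    = refl
r₂-consecutive (suc (suc n)) = r₂-consecutive n

r∞-stride : ∀ e → ½ ℚ.* fromℤ (stride e) ≡ r∞ e
r∞-stride zero       = refl
r∞-stride (suc zero) = refl

0<stride : ∀ e → 0ℚ ℚ.< fromℤ (stride e)
0<stride zero       = ℚ.positive⁻¹ (fromℤ (+ 2))
0<stride (suc zero) = 0<1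

½≤r₂ : ∀ e → ½ ℚ.≤ r₂ e
½≤r₂ zero       = ℚ.≤-refl
½≤r₂ (suc zero) = ≤-from-gap ½ (ℚ.<⇒≤ 0<½) refl

∣stride∣₂ : ∀ e → ∣ fromℤ (stride e) ∣₂ ≡ r₂ e
∣stride∣₂ zero       = refl
∣stride∣₂ (suc zero) = refl

-- Only the neighbours m + 1 and m - 1 are compared with m. That neither comes closer bounds x and
-- -x by half the stride.
minimizer-bound : ∀ (u : ℝ) s m r → 0ℚ ℚ.< fromℤ s →
  Minimizes (λ i → ∥ u - fromℚ (fromℤ (s ℤ.* i)) - fromℚ r ∥) m →
  AtMost (u - fromℚ (fromℤ (s ℤ.* m) ℚ.+ r)) (½ ℚ.* fromℤ s)
minimizer-bound u s m r 0<s minimal = mkAtMost (bound-∣∣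
  (translate-bound {x} 0<s λ lt → minimal (m ℤ.+ + 1)
    (<-pointwise {∥ x - fromℚ (fromℤ s) ∥} {f (m ℤ.+ + 1)} {∥ x ∥} {f m} next same lt))
  (translate-bound { - x} 0<s λ lt → minimal (m ℤ.+ -[1+ 0 ])
    (<-pointwise {∥ (- x) - fromℚ (fromℤ s) ∥} {f (m ℤ.+ -[1+ 0 ])} {∥ - x ∥} {f m} previous
      (λ n → trans (ℚ.∣-p∣≡∣p∣ (seq x n)) (same n)) lt)))
  where
  f : ℤ → ℝ
  f i = ∥ u - fromℚ (fromℤ (s ℤ.* i)) - fromℚ r ∥
  x : ℝ
  x = u - fromℚ (fromℤ (s ℤ.* m) ℚ.+ r)
  moved : ∀ j → fromℤ (s ℤ.* (m ℤ.+ j)) ≡ fromℤ (s ℤ.* m) ℚ.+ fromℤ s ℚ.* fromℤ j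
  moved j = trans (cong fromℤ (ℤ.*-distribˡ-+ s m j)) (trans (fromℤ-+ (s ℤ.* m) (s ℤ.* j)) (cong (fromℤ (s ℤ.* m) ℚ.+_) (fromℤ-* s j)))
  same : ∀ n → ℚ.∣ seq x n ∣ ≡ ℚ.∣ (seq u n ℚ.- fromℤ (s ℤ.* m)) ℚ.- r ∣
  same n = cong ℚ.∣_∣ (solve 3 (λ u y r → u :- (y :+ r) := (u :- y) :- r) refl (seq u n) (fromℤ (s ℤ.* m)) r)
  next : ∀ n → ℚ.∣ seq x n ℚ.- fromℤ s ∣ ≡ seq (f (m ℤ.+ + 1)) n
  next n = cong ℚ.∣_∣ (trans
    (solve 4 (λ u y r s → (u :- (y :+ r)) :- s := (u :- (y :+ s :* con 1ℚ)) :- r) refl (seq u n) (fromℤ (s ℤ.* m)) r (fromℤ s))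
    (cong (λ z → (seq u n ℚ.- z) ℚ.- r) (sym (moved (+ 1)))))
  previous : ∀ n → ℚ.∣ (ℚ.- seq x n) ℚ.- fromℤ s ∣ ≡ seq (f (m ℤ.+ -[1+ 0 ])) n
  previous n = trans (sym (ℚ.∣-p∣≡∣p∣ ((ℚ.- seq x n) ℚ.- fromℤ s))) (cong ℚ.∣_∣ (trans
    (solve 4 (λ u y r s → :- ((:- (u :- (y :+ r))) :- s) := (u :- (y :+ s :* con (ℚ.- 1ℚ))) :- r) refl
      (seq u n) (fromℤ (s ℤ.* m)) r (fromℤ s))
    (cong (λ z → (seq u n ℚ.- z) ℚ.- r) (sym (moved -[1+ 0 ])))))

unit-interval-bound : ∀ (x : ℝ) → fromℚ (ℚ.- 1ℚ) < x → x ≤ fromℚ 1ℚ → AtMost x 1ℚ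
unit-interval-bound x (ε , 0<ε , N , h) x≤1 = mkAtMost (bound-∣∣ (≮⇒bound {x} x≤1)
  (eventually⇒bound (N , λ n le → ≤-from-gap ((seq x n ℚ.- (ℚ.- 1ℚ ℚ.+ ε)) ℚ.+ ε)
    (+-nonNeg (gap-nonNeg (h n le)) (ℚ.<⇒≤ 0<ε))
    (solve 2 (λ x e → (:- x) :+ ((x :- (con (ℚ.- 1ℚ) :+ e)) :+ e) := con 1ℚ) refl (seq x n) ε))))

positiveValuation-bound : ∀ (x : ℚ₂) → PositiveValuation x → AtMost x ½
positiveValuation-bound x (inj₁ x≈0) = atMost-≈ (≈-sym x (fromℚ 0ℚ) x≈0) (atMost-weaken (ℚ.<⇒≤ 0<½) (atMost-fromℚ {dyadic} 0ℚ))
positiveValuation-bound x (inj₂ (k , (N , h) , 0<k)) = mkAtMost (eventually⇒bound (N , λ n le →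
  subst (ℚ._≤ ½) (sym (trans (∣∣₂-2^v₂ (proj₁ (h n le))) (cong (λ j → 2^ (ℤ.- j)) (proj₂ (h n le)))))
    (2^-antitone {+ 1} {k} (ℤ.i<j⇒suc[i]≤j 0<k))))

digitSum-dyadic : ∀ d N k → Dyadic (digitSum d N k)
digitSum-dyadic d N zero    = dyadic-fromℤ (+ 0)
digitSum-dyadic d N (suc k) = dyadic-+ (digitSum-dyadic d N k)
  (dyadic-* (dyadic-fromℤ (+ toℕ (d (ℤ.- + N ℤ.+ + k)))) (dyadic-2^ (ℤ.- + N ℤ.+ + k)))

-- The first `suc N` terms have exponents -N to 0. Every further term has exponent at least 1, hence
-- size at most ½, and sums do not enlarge this.
digitSum-tail : ∀ d N k → ∣ digitSum d N (k ℕ.+ suc N) ℚ.- digitSum d N (suc N) ∣₂ ℚ.≤ ½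
digitSum-tail d N zero    = subst (λ z → ∣ z ∣₂ ℚ.≤ ½) (sym (ℚ.+-inverseʳ (digitSum d N (suc N)))) (ℚ.<⇒≤ 0<½)
digitSum-tail d N (suc k) = subst (λ z → ∣ z ∣₂ ℚ.≤ ½)
  (solve 3 (λ x y z → (x :- y) :+ z := (x :+ z) :- y) refl (digitSum d N (k ℕ.+ suc N)) (digitSum d N (suc N)) term)
  (∣∣₂-+-≤ (digitSum d N (k ℕ.+ suc N) ℚ.- digitSum d N (suc N)) term (digitSum-tail d N k) small)
  where
  index = ℤ.- + N ℤ.+ + (k ℕ.+ suc N)
  digit = fromℤ (+ toℕ (d index))
  term = digit ℚ.* 2^ index
  index≡ : index ≡ + suc k
  index≡ = trans (cong (λ j → ℤ.- + N ℤ.+ + j) (trans (ℕ.+-suc k N) (ℕ.+-comm (suc k) N)))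
    (trans (cong (λ z → ℤ.- + N ℤ.+ z) (ℤ.pos-+ N (suc k)))
      (trans (sym (ℤ.+-assoc (ℤ.- + N) (+ N) (+ suc k))) (trans (cong (ℤ._+ + suc k) (ℤ.+-inverseˡ (+ N))) (ℤ.+-identityˡ (+ suc k)))))
  small : ∣ term ∣₂ ℚ.≤ ½
  small = begin
    ∣ digit ℚ.* 2^ index ∣₂               ≡⟨ ∣∣₂-* digit (2^ index) ⟩
    ∣ digit ∣₂ ℚ.* ∣ 2^ index ∣₂          ≡⟨ cong (∣ digit ∣₂ ℚ.*_) (trans (∣2^∣₂ index) (cong (λ j → 2^ (ℤ.- j)) index≡)) ⟩
    ∣ digit ∣₂ ℚ.* 2^ (ℤ.- + suc k)       ≤⟨ *-mono-≤ {v = ½} (∣∣₂-nonNeg digit) (ℚ.<⇒≤ 0<½) (∣fromℤ∣₂≤1 (+ toℕ (d index)))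
                                               (2^-antitone {+ 1} {+ suc k} (ℤ.+≤+ (s≤s z≤n))) ⟩
    1ℚ ℚ.* ½                              ≡⟨⟩
    ½                                     ∎
    where open ℚ.≤-Reasoning

-- A partial sum late enough to be within ½ of u, and long enough to extend the floor, mediates
-- between the two.
floor-bound : ∀ (u : ℚ₂) {r} → IsFloor₂ u r → AtMost (u - fromℚ r) ½
floor-bound u (e , refl) =
  let (M , h) = converges ½ 0<½
      (ε , 0<ε , L , k) = h (M ℕ.+ suc N) (ℕ.m≤m+n M (suc N)) in
  mkAtMost (eventually⇒bound (L , λ n le → subst (λ z → ∣ z ∣₂ ℚ.≤ ½)
    (solve 3 (λ x y z → (x :- y) :+ (y :- z) := x :- z) refl (seq u n) (digitSum digit N (M ℕ.+ suc N)) floor)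
    (∣∣₂-+-≤ (seq u n ℚ.- digitSum digit N (M ℕ.+ suc N)) (digitSum digit N (M ℕ.+ suc N) ℚ.- floor)
      (ℚ.≤-trans (ℚ.≤-reflexive (∣-∣-swap {dyadic} (seq u n) (digitSum digit N (M ℕ.+ suc N))))
        (ℚ.≤-trans (≤-from-gap ε (ℚ.<⇒≤ 0<ε) refl) (k n le)))
      (digitSum-tail digit N M))))
  where open DigitExpansion e

floor-dyadic : ∀ (u : ℚ₂) {r} → IsFloor₂ u r → Dyadic r
floor-dyadic u (e , refl) = digitSum-dyadic (DigitExpansion.digit e) (DigitExpansion.N e) (suc (DigitExpansion.N e))

-- The integer subtracted after the floor is a multiple of the stride. An even stride preserves the
-- bound ½, stride 1 only integrality.
floor-stride-bound : ∀ (u : ℚ₂) e m {r} → IsFloor₂ u r → AtMost (u - fromℚ (fromℤ (stride e ℤ.* m) ℚ.+ r)) (r₂ e)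
floor-stride-bound u e m {r} fl = atMost-≈
  (pointwise⇒≈ ((u - fromℚ r) + (- fromℚ z)) (u - fromℚ (z ℚ.+ r)) λ n →
    solve 3 (λ u z r → (u :- r) :+ (:- z) := u :- (z :+ r)) refl (seq u n) z r)
  (atMost₂-+ {u - fromℚ r} { - fromℚ z} (atMost-weaken (½≤r₂ e) (floor-bound u fl)) (atMost-neg {x = fromℚ z} (atMost-weaken small (atMost-fromℚ {dyadic} z))))
  where
  z = fromℤ (stride e ℤ.* m)
  small : ∣ z ∣₂ ℚ.≤ r₂ e
  small = begin
    ∣ z ∣₂                                      ≡⟨ cong ∣_∣₂ (fromℤ-* (stride e) m) ⟩
    ∣ fromℤ (stride e) ℚ.* fromℤ m ∣₂           ≡⟨ ∣∣₂-* (fromℤ (stride e)) (fromℤ m) ⟩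
    ∣ fromℤ (stride e) ∣₂ ℚ.* ∣ fromℤ m ∣₂      ≤⟨ ℚ.*-monoˡ-≤-nonNeg ∣ fromℤ (stride e) ∣₂ {{ℚ.nonNegative (∣∣₂-nonNeg (fromℤ (stride e)))}} (∣fromℤ∣₂≤1 m) ⟩
    ∣ fromℤ (stride e) ∣₂ ℚ.* 1ℚ                ≡⟨ trans (ℚ.*-identityʳ _) (∣stride∣₂ e) ⟩
    r₂ e                                        ∎
    where open ℚ.≤-Reasoning

-- Bounds for the continued fraction at a place

module Bounds (K : QuadraticField κ ℓ) (β : ℕ → QuadraticField.Carrier K) (a : ℕ → ℚ)
  (quotients : Field.CompleteQuotients K β a)
  {V : AbsoluteValue} (σ : QuadraticField.Carrier K → Completion V)
  (σ-isRingHomomorphism : IsRingHomomorphism (QuadraticField.rawRing K) (completionRing V) σ) where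

  open Field K
  open Field.CompleteQuotients quotients
  open AbsoluteValue V using (∣_∣)
  open ContinuedFraction K β a quotients public
  open Place K σ σ-isRingHomomorphism public
  open Quadratic K public

  ∥∥-Λ : ∀ n {b} → ∥ P (suc n) ∥≤ b → ∥ Λ n ∥≤ b
  ∥∥-Λ n B with Λ≈±P n
  ... | inj₁ e = ∥∥-cong (≈ᴷ-sym e) B
  ... | inj₂ e = ∥∥-cong (≈ᴷ-sym e) (∥∥-neg B)

  -- Since q Λ = ± w β, the bound for w enters here as a whole; bounding q and Λ separately would
  -- lose it.
  ∥∥-qΛ : ∀ n {b} → ∥ w n *ᴷ β n ∥≤ b → ∥ ι (q a n) *ᴷ Λ n ∥≤ b
  ∥∥-qΛ n B with Λ≈±P n
  ... | inj₁ e = ∥∥-cong (≈ᴷ-trans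
    (KS.solve 3 (λ q P b → (q KS.:* P) KS.:* b KS.:= q KS.:* (P KS.:* b)) ≈ᴷ-refl (ι (q a n)) (P n) (β n))
    (*ᴷ-cong ≈ᴷ-refl (≈ᴷ-sym e))) B
  ... | inj₂ e = ∥∥-cong (≈ᴷ-trans
    (KS.solve 3 (λ q P b → KS.:- ((q KS.:* P) KS.:* b) KS.:= q KS.:* (KS.:- (P KS.:* b))) ≈ᴷ-refl (ι (q a n)) (P n) (β n))
    (*ᴷ-cong ≈ᴷ-refl (≈ᴷ-sym e))) (∥∥-neg B)

  ∥∥-Θ : ∀ n {b} → q a n ≢ 0ℚ → ∥ Λ n ∥≤ b → ∥ Θ n ∥≤ ∣ 1ℚ ÷ q a n ∣ ℚ.* b
  ∥∥-Θ n q≢0 B = ∥∥-cong (Θ≈ n q≢0) (∥∥-* (∥ι∥ (1ℚ ÷ q a n)) B)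

  ∥∥-Λ-from-qΛ : ∀ n {b} → q a n ≢ 0ℚ → ∥ ι (q a n) *ᴷ Λ n ∥≤ b → ∥ Λ n ∥≤ ∣ 1ℚ ÷ q a n ∣ ℚ.* b
  ∥∥-Λ-from-qΛ n q≢0 B = ∥∥-cong cancel (∥∥-* (∥ι∥ (1ℚ ÷ q a n)) B)
    where
    open ≈ᴷ-Reasoning
    cancel : ι (1ℚ ÷ q a n) *ᴷ (ι (q a n) *ᴷ Λ n) ≈ᴷ Λ n
    cancel = begin
      ι (1ℚ ÷ q a n) *ᴷ (ι (q a n) *ᴷ Λ n)     ≈⟨ KS.solve 3 (λ x y z → x KS.:* (y KS.:* z) KS.:= y KS.:* (x KS.:* z)) ≈ᴷ-refl (ι (1ℚ ÷ q a n)) (ι (q a n)) (Λ n) ⟩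
      ι (q a n) *ᴷ (ι (1ℚ ÷ q a n) *ᴷ Λ n)     ≈⟨ *ᴷ-cong ≈ᴷ-refl (Θ≈ n q≢0) ⟩
      ι (q a n) *ᴷ Θ n                         ≈⟨ q*Θ n q≢0 ⟩
      Λ n                                      ∎

  module Liouville (E : QuadraticEquation (β 0)) where
    open QuadraticEquation E

    slope : Carrier
    slope = ι B -ᴷ ι (fromℕ 2) *ᴷ (ι A *ᴷ β 0)

    norm : ℕ → ℚ
    norm n = Norm.norm (irrational 0) E (p a n) (q a n)

    norm≢0 : ∀ n → q a n ≢ 0ℚ → norm n ≢ 0ℚ
    norm≢0 n q≢0 e = *ᴷ-nonzero (Λ-nonzero n q≢0) (Norm.conjugate-nonzero (irrational 0) E (p a n) (q a n) q≢0)
      (≈ᴷ-trans (≈ᴷ-sym (Norm.norm≈ (irrational 0) E (p a n) (q a n))) (ι-cong e))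

    norm-lower : ∀ n {M} → q a n ≢ 0ℚ → ∥ Λ n ∥≤ ∣ q a n ∣ → 0ℚ ℚ.< M → ∥ slope ∥≤ M → (x : Completion V) → x ≈ σ (Θ n) →
      Eventually λ k → ∣ norm n ∣ ℚ.≤ fromℕ 4 ℚ.* (∣ q a n ∣ ℚ.* ∣ q a n ∣ ℚ.* (M ℚ.+ ∣ A ∣)) ℚ.* ∣ seq x k ∣
    norm-lower n {M} q≢0 Λ≤q 0<M slope≤M x x≈Θ = cofactor-lower x (σ y) product (norm≢0 n q≢0)
      (*-positive (*-positive 0<q 0<q) (ℚ.+-mono-<-≤ 0<M (AbsoluteValue.nonNeg V A)))
      (atMost-weaken (ℚ.≤-reflexive (solve 3 (λ q M A → q :* (q :* M :+ A :* q) := q :* q :* (M :+ A)) refl u M v))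
        (∥∥-* (∥ι∥ (q a n)) (∥∥-+ (∥∥-* (∥ι∥ (q a n)) slope≤M) (∥∥-* (∥ι∥ A) Λ≤q))))
      where
      open ≈ᴷ-Reasoning
      u = ∣ q a n ∣
      v = ∣ A ∣
      0<q = ≢0⇒∣∣-positive V q≢0
      conjugate = Norm.conjugate (irrational 0) E (p a n) (q a n)
      y = ι (q a n) *ᴷ conjugate
      Θy≈ : Θ n *ᴷ y ≈ᴷ ι (norm n)
      Θy≈ = begin
        Θ n *ᴷ (ι (q a n) *ᴷ conjugate)     ≈⟨ KS.solve 3 (λ t q c → t KS.:* (q KS.:* c) KS.:= (q KS.:* t) KS.:* c) ≈ᴷ-refl (Θ n) (ι (q a n)) conjugate ⟩
        (ι (q a n) *ᴷ Θ n) *ᴷ conjugate     ≈⟨ *ᴷ-cong (q*Θ n q≢0) ≈ᴷ-refl ⟩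
        Λ n *ᴷ conjugate                    ≈⟨ Norm.norm≈ (irrational 0) E (p a n) (q a n) ⟨
        ι (norm n)                          ∎
      product : x * σ y ≈ fromℚ (norm n)
      product = ≈-trans (x * σ y) (σ (Θ n) * σ y) (fromℚ (norm n))
        (*-cong x (σ (Θ n)) (σ y) (σ y) x≈Θ (pointwise⇒≈ {V} (σ y) (σ y) λ _ → refl))
        (≈-trans (σ (Θ n) * σ y) (σ (Θ n *ᴷ y)) (fromℚ (norm n)) (≈-sym (σ (Θ n *ᴷ y)) (σ (Θ n) * σ y) (σ-* (Θ n) y))
          (≈-trans (σ (Θ n *ᴷ y)) (σ (ι (norm n))) (fromℚ (norm n)) (σ-cong Θy≈) (σ-ι (norm n))))

-- The real place

-- Bound for ∣α₍₁₎⋯α₍ₙ₎∣, one factor for each complete quotient.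
R∞ : ℕ → ℚ
R∞ zero    = 1ℚ
R∞ (suc n) = R∞ n ℚ.* r∞ (τ n)

0<r∞ : ∀ e → 0ℚ ℚ.< r∞ e
0<r∞ zero       = 0<1
0<r∞ (suc zero) = 0<½

0<R∞ : ∀ n → 0ℚ ℚ.< R∞ n
0<R∞ zero    = 0<1
0<R∞ (suc n) = *-positive (0<R∞ n) (0<r∞ (τ n))

R∞-consecutive : ∀ n → R∞ n ℚ.* R∞ (suc n) ≡ ½ ^ n
R∞-consecutive zero    = refl
R∞-consecutive (suc n) = trans
  (solve 3 (λ R x y → (R :* x) :* ((R :* x) :* y) := (x :* y) :* (R :* (R :* x))) refl (R∞ n) (r∞ (τ n)) (r∞ (τ (suc n))))
  (cong₂ ℚ._*_ (r∞-consecutive n) (R∞-consecutive n))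

module RealBounds (K : QuadraticField κ ℓ) (β : ℕ → QuadraticField.Carrier K) (a : ℕ → ℚ)
  (quotients : Field.CompleteQuotients K β a)
  (σ : QuadraticField.Carrier K → ℝ)
  (σ-isRingHomomorphism : IsRingHomomorphism (QuadraticField.rawRing K) ℝ-ring σ)
  (β-bound : ∀ n → AtMost (σ (β n)) (r∞ (τ n))) where

  open Field K
  open Bounds K β a quotients σ σ-isRingHomomorphism

  -- The two bounds feed each other: ∣wₙ∣ ≤ 1 + ∣wₙ - 1∣ and ∣wₙ₊₁ - 1∣ ≤ ½∣wₙ∣, so with h = 2⁻ⁿ the
  -- bound 1 - h becomes ½ (2 - h) = 1 - ½h.
  w-1-bound : ∀ n → ∥ w n -ᴷ ι 1ℚ ∥≤ 1ℚ ℚ.- ½ ^ n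
  w-bound : ∀ n → ∥ w n ∥≤ fromℕ 2 ℚ.- ½ ^ n

  w-bound n = ∥∥-cong (KS.solve 1 (λ w → (w KS.:- KS.con 1ℚ) KS.:+ KS.con 1ℚ KS.:= w) ≈ᴷ-refl (w n))
    (atMost-weaken (ℚ.≤-reflexive (solve 1 (λ h → (con 1ℚ :- h) :+ con 1ℚ := con (fromℕ 2) :- h) refl (½ ^ n)))
      (∥∥-+ (w-1-bound n) (∥ι∥ 1ℚ)))

  w-1-bound zero    = ∥∥-cong (KS.solve 0 (KS.con 0ℚ KS.:= (KS.con 1ℚ KS.:* KS.con 1ℚ) KS.:- KS.con 1ℚ) ≈ᴷ-refl) (∥ι∥ 0ℚ)
  w-1-bound (suc n) = ∥∥-cong (≈ᴷ-sym (w-suc n)) (∥∥-neg (atMost-weaken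
    (ℚ.≤-reflexive (trans (cong ((fromℕ 2 ℚ.- ½ ^ n) ℚ.*_) (r∞-consecutive n))
      (solve 1 (λ h → (con (fromℕ 2) :- h) :* con ½ := con 1ℚ :- con ½ :* h) refl (½ ^ n))))
    (∥∥-* (w-bound n) (∥∥-* (β-bound n) (β-bound (suc n))))))

  P-bound : ∀ n → ∥ P n ∥≤ R∞ n
  P-bound zero    = ∥ι∥ 1ℚ
  P-bound (suc n) = ∥∥-* (P-bound n) (β-bound n)

  -- Writing 1 = w - (w - 1) gives 2⁻ⁿ ≤ ∣qₙ∣ R∞ n, and 2⁻ⁿ is R∞ n times R∞ (n + 1). The resulting
  -- bound is exactly the one available for ∣qₙα - pₙ∣.
  q-lower : ∀ n → R∞ (suc n) ℚ.≤ ℚ.∣ q a n ∣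
  q-lower n = *-cancelʳ-≤ (R∞ n) (0<R∞ n) (≤-from-gap
    ((ℚ.∣ q a n ∣ ℚ.* R∞ n ℚ.+ (1ℚ ℚ.- ½ ^ n)) ℚ.- 1ℚ) (gap-nonNeg one≤)
    (trans (cong (ℚ._+ ((ℚ.∣ q a n ∣ ℚ.* R∞ n ℚ.+ (1ℚ ℚ.- ½ ^ n)) ℚ.- 1ℚ)) (trans (ℚ.*-comm (R∞ (suc n)) (R∞ n)) (R∞-consecutive n)))
      (solve 2 (λ h x → h :+ ((x :+ (con 1ℚ :- h)) :- con 1ℚ) := x) refl (½ ^ n) (ℚ.∣ q a n ∣ ℚ.* R∞ n))))
    where
    one≤ : 1ℚ ℚ.≤ ℚ.∣ q a n ∣ ℚ.* R∞ n ℚ.+ (1ℚ ℚ.- ½ ^ n)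
    one≤ = ∥ι∥⁻¹ {1ℚ} (∥∥-cong (KS.solve 1 (λ w → w KS.:+ (KS.:- (w KS.:- KS.con 1ℚ)) KS.:= KS.con 1ℚ) ≈ᴷ-refl (w n))
      (∥∥-+ (∥∥-* (∥ι∥ (q a n)) (P-bound n)) (∥∥-neg (w-1-bound n))))

  q≢0 : ∀ n → q a n ≢ 0ℚ
  q≢0 n = ∣∣-positive⇒≢0 archimedean (ℚ.<-≤-trans (0<R∞ (suc n)) (q-lower n))

  Λ≤q : ∀ n → ∥ Λ n ∥≤ ℚ.∣ q a n ∣
  Λ≤q n = atMost-weaken (q-lower n) (∥∥-Λ n (P-bound (suc n)))

  Θ-upper : ∀ n → ∥ Θ n ∥≤ ℚ.∣ 1ℚ ÷ q a n ∣ ℚ.* (ℚ.∣ 1ℚ ÷ q a n ∣ ℚ.* ((fromℕ 2 ℚ.- ½ ^ n) ℚ.* r∞ (τ n)))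
  Θ-upper n = ∥∥-Θ n (q≢0 n) (∥∥-Λ-from-qΛ n (q≢0 n) (∥∥-qΛ n (∥∥-* (w-bound n) (β-bound n))))

-- The 2-adic place

∣1÷∣₂ : ∀ {x} k → x ≢ 0ℚ → ∣ x ∣₂ ≡ 2^ (ℤ.- k) → ∣ 1ℚ ÷ x ∣₂ ≡ 2^ k
∣1÷∣₂ {x} k x≢0 e = 2^-cancel (ℤ.- k) _ _ (begin
  2^ (ℤ.- k) ℚ.* ∣ 1ℚ ÷ x ∣₂      ≡⟨ cong (ℚ._* ∣ 1ℚ ÷ x ∣₂) e ⟨
  ∣ x ∣₂ ℚ.* ∣ 1ℚ ÷ x ∣₂          ≡⟨ ∣∣₂-* x (1ℚ ÷ x) ⟨
  ∣ x ℚ.* (1ℚ ÷ x) ∣₂             ≡⟨ cong ∣_∣₂ (trans (ℚ.*-comm x (1ℚ ÷ x)) (÷-* 1ℚ x≢0)) ⟩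
  1ℚ                              ≡⟨ 2^-inverse k ⟨
  2^ (ℤ.- k) ℚ.* 2^ k             ∎)
  where open ≡-Reasoning

0<r₂ : ∀ e → 0ℚ ℚ.< r₂ e
0<r₂ e = ℚ.<-≤-trans 0<½ (½≤r₂ e)

r₂≤1 : ∀ e → r₂ e ℚ.≤ 1ℚ
r₂≤1 zero       = ≤-from-gap ½ (ℚ.<⇒≤ 0<½) refl
r₂≤1 (suc zero) = ℚ.≤-refl

module DyadicBounds (K : QuadraticField κ ℓ) (β : ℕ → QuadraticField.Carrier K) (a : ℕ → ℚ)
  (quotients : Field.CompleteQuotients K β a)
  (σ : QuadraticField.Carrier K → ℚ₂)
  (σ-isRingHomomorphism : IsRingHomomorphism (QuadraticField.rawRing K) ℚ₂-ring σ)
  (β-bound : ∀ n → AtMost (σ (β n)) (r₂ (τ n))) where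

  open Field K
  open Bounds K β a quotients σ σ-isRingHomomorphism

  ∥∥₂-+ : ∀ {x y b} → ∥ x ∥≤ b → ∥ y ∥≤ b → ∥ x +ᴷ y ∥≤ b
  ∥∥₂-+ {x} {y} B C = atMost-≈ (≈-sym (σ (x +ᴷ y)) (σ x + σ y) (σ-+ x y)) (atMost₂-+ {σ x} {σ y} B C)

  ββ-bound : ∀ n → ∥ β n *ᴷ β (suc n) ∥≤ ½
  ββ-bound n = atMost-weaken (ℚ.≤-reflexive (r₂-consecutive n)) (∥∥-* (β-bound n) (β-bound (suc n)))

  -- In 1 = βa + ββ′ the last term has size at most ½. Either r₂∣a∣ is at least ½ and bounds the
  -- whole sum, or the sum is at most ½, which is absurd.
  a-lower : ∀ n → 1ℚ ℚ.≤ r₂ (τ n) ℚ.* ∣ a (suc n) ∣₂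
  a-lower n with ℚ.≤-total ½ (r₂ (τ n) ℚ.* ∣ a (suc n) ∣₂)
  ... | inj₁ ½≤ = ∥ι∥⁻¹ {1ℚ} (∥∥-cong (complete-quotient n) (∥∥-cong
    (KS.solve 3 (λ b a c → b KS.:* a KS.:+ b KS.:* c KS.:= b KS.:* (a KS.:+ c)) ≈ᴷ-refl (β n) (ι (a (suc n))) (β (suc n)))
    (∥∥₂-+ (∥∥-* (β-bound n) (∥ι∥ (a (suc n)))) (atMost-weaken ½≤ (ββ-bound n)))))
  ... | inj₂ ≤½ = ⊥-elim (ℚ.<-irrefl refl (ℚ.<-≤-trans (<-from-gap {½} {1ℚ} ½ 0<½ refl) one≤½))
    where
    one≤½ : 1ℚ ℚ.≤ ½
    one≤½ = ∥ι∥⁻¹ {1ℚ} (∥∥-cong (complete-quotient n) (∥∥-cong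
      (KS.solve 3 (λ b a c → b KS.:* a KS.:+ b KS.:* c KS.:= b KS.:* (a KS.:+ c)) ≈ᴷ-refl (β n) (ι (a (suc n))) (β (suc n)))
      (∥∥₂-+ (atMost-weaken ≤½ (∥∥-* (β-bound n) (∥ι∥ (a (suc n))))) (ββ-bound n))))

  1≤∣a∣ : ∀ n → 1ℚ ℚ.≤ ∣ a (suc n) ∣₂
  1≤∣a∣ n = ℚ.≤-trans (a-lower n) (ℚ.≤-trans (ℚ.*-monoʳ-≤-nonNeg ∣ a (suc n) ∣₂ {{ℚ.nonNegative (∣∣₂-nonNeg (a (suc n)))}} (r₂≤1 (τ n)))
    (ℚ.≤-reflexive (ℚ.*-identityˡ _)))

  a≢0 : ∀ n → a (suc n) ≢ 0ℚ
  a≢0 n = ∣∣-positive⇒≢0 dyadic (ℚ.<-≤-trans 0<1 (1≤∣a∣ n))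

  ∣a∣ : ∀ n → ∣ a (suc n) ∣₂ ≡ 2^ (ℤ.- v₂ (a (suc n)))
  ∣a∣ n = ∣∣₂-2^v₂ (a≢0 n)

  -- From βa = 1 - ββ′ the product βa has size at most 1. Only the upper half of ∣β∣₂ = 1/∣a∣₂ is
  -- asserted.
  β-exact : ∀ n → ∥ β n ∥≤ 2^ (v₂ (a (suc n)))
  β-exact n = ∥∥-cong cancel (atMost-weaken
    (ℚ.≤-reflexive (trans (ℚ.*-identityʳ _) (∣1÷∣₂ (v₂ (a (suc n))) (a≢0 n) (∣a∣ n))))
    (∥∥-* (∥ι∥ (1ℚ ÷ a (suc n))) βa≤1))
    where
    open ≈ᴷ-Reasoning
    βa≤1 : ∥ β n *ᴷ ι (a (suc n)) ∥≤ 1ℚ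
    βa≤1 = ∥∥-cong (≈ᴷ-trans (+ᴷ-cong (≈ᴷ-sym (complete-quotient n)) ≈ᴷ-refl)
      (KS.solve 3 (λ b a c → b KS.:* (a KS.:+ c) KS.:+ (KS.:- (b KS.:* c)) KS.:= b KS.:* a) ≈ᴷ-refl (β n) (ι (a (suc n))) (β (suc n))))
      (∥∥₂-+ (∥ι∥ 1ℚ) (∥∥-neg (atMost-weaken (≤-from-gap ½ (ℚ.<⇒≤ 0<½) refl) (ββ-bound n))))
    cancel : ι (1ℚ ÷ a (suc n)) *ᴷ (β n *ᴷ ι (a (suc n))) ≈ᴷ β n
    cancel = begin
      ι (1ℚ ÷ a (suc n)) *ᴷ (β n *ᴷ ι (a (suc n)))      ≈⟨ KS.solve 3 (λ i b a → i KS.:* (b KS.:* a) KS.:= (i KS.:* a) KS.:* b) ≈ᴷ-refl (ι (1ℚ ÷ a (suc n))) (β n) (ι (a (suc n))) ⟩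
      (ι (1ℚ ÷ a (suc n)) *ᴷ ι (a (suc n))) *ᴷ β n      ≈⟨ *ᴷ-cong (≈ᴷ-trans (≈ᴷ-sym (ι-* (1ℚ ÷ a (suc n)) (a (suc n)))) (ι-cong (÷-* 1ℚ (a≢0 n)))) ≈ᴷ-refl ⟩
      ι 1ℚ *ᴷ β n                                       ≈⟨ KS.solve 1 (λ x → KS.con 1ℚ KS.:* x KS.:= x) ≈ᴷ-refl (β n) ⟩
      β n                                               ∎

  2^-valuationSum-suc : ∀ n → 2^ (ℤ.- valuationSum a (suc n)) ≡ 2^ (ℤ.- valuationSum a n) ℚ.* ∣ a (suc n) ∣₂
  2^-valuationSum-suc n = trans (cong 2^_ (ℤ.neg-distrib-+ (valuationSum a n) (v₂ (a (suc n)))))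
    (trans (2^-+ (ℤ.- valuationSum a n) (ℤ.- v₂ (a (suc n)))) (cong (2^ (ℤ.- valuationSum a n) ℚ.*_) (sym (∣a∣ n))))

  P-bound : ∀ n → ∥ P n ∥≤ 2^ (valuationSum a n)
  P-bound zero    = ∥ι∥ 1ℚ
  P-bound (suc n) = atMost-weaken (ℚ.≤-reflexive (sym (2^-+ (valuationSum a n) (v₂ (a (suc n)))))) (∥∥-* (P-bound n) (β-exact n))

  -- The second clause serves the first: with r₂∣aₙ₊₁∣₂ ≥ 1 it yields ∣qₙ₋₁∣₂ < ∣qₙaₙ₊₁∣₂, so the
  -- recursion has a dominant term. It reproduces itself because consecutive weights multiply to ½.
  ∣q∣-and-growth : ∀ n → ∣ q a n ∣₂ ≡ 2^ (ℤ.- valuationSum a n) × ∣ q₋ a n ∣₂ ℚ.* r₂ (τ n) ℚ.≤ ½ ℚ.* ∣ q a n ∣₂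
  ∣q∣-and-growth zero    = refl , ℚ.<⇒≤ 0<½
  ∣q∣-and-growth (suc n) with ∣q∣-and-growth n
  ... | ∣q∣ , growth = trans ∣q-suc∣ (trans (cong (ℚ._* A) ∣q∣) (sym (2^-valuationSum-suc n))) , growth′
    where
    Q = ∣ q a n ∣₂
    A = ∣ a (suc n) ∣₂
    ρ = r₂ (τ n)
    0<Q : 0ℚ ℚ.< Q
    0<Q = subst (0ℚ ℚ.<_) (sym ∣q∣) (2^-positive (ℤ.- valuationSum a n))
    dominated : ∣ q₋ a n ∣₂ ℚ.< ∣ q a n ℚ.* a (suc n) ∣₂
    dominated = *-cancelʳ-< ρ (0<r₂ (τ n)) (begin-strict
      ∣ q₋ a n ∣₂ ℚ.* ρ                       ≤⟨ growth ⟩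
      ½ ℚ.* Q                                 <⟨ <-from-gap (½ ℚ.* Q) (half-positive 0<Q) (half+half Q) ⟩
      Q                                       ≡⟨ ℚ.*-identityʳ Q ⟨
      Q ℚ.* 1ℚ                                ≤⟨ ℚ.*-monoˡ-≤-nonNeg Q {{ℚ.nonNegative (ℚ.<⇒≤ 0<Q)}} (a-lower n) ⟩
      Q ℚ.* (ρ ℚ.* A)                         ≡⟨ solve 3 (λ x y z → x :* (y :* z) := (x :* z) :* y) refl Q ρ A ⟩
      (Q ℚ.* A) ℚ.* ρ                         ≡⟨ cong (ℚ._* ρ) (∣∣₂-* (q a n) (a (suc n))) ⟨
      ∣ q a n ℚ.* a (suc n) ∣₂ ℚ.* ρ          ∎)
      where open ℚ.≤-Reasoning
    ∣q-suc∣ : ∣ q a (suc n) ∣₂ ≡ Q ℚ.* A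
    ∣q-suc∣ = trans (cong ∣_∣₂ (trans (q-suc a n) (ℚ.+-comm (q₋ a n) (q a n ℚ.* a (suc n)))))
      (trans (∣∣₂-dominant (q a n ℚ.* a (suc n)) (q₋ a n) dominated) (∣∣₂-* (q a n) (a (suc n))))
    growth′ : ∣ q₋ a (suc n) ∣₂ ℚ.* r₂ (τ (suc n)) ℚ.≤ ½ ℚ.* ∣ q a (suc n) ∣₂
    growth′ = begin
      ∣ q₋ a (suc n) ∣₂ ℚ.* ρ′                ≡⟨ cong (λ z → ∣ z ∣₂ ℚ.* ρ′) (q₋-suc a n) ⟩
      Q ℚ.* ρ′                                ≡⟨ ℚ.*-identityʳ _ ⟨
      Q ℚ.* ρ′ ℚ.* 1ℚ                         ≤⟨ ℚ.*-monoˡ-≤-nonNeg (Q ℚ.* ρ′) {{ℚ.nonNegative (*-nonNeg (ℚ.<⇒≤ 0<Q) (ℚ.<⇒≤ (0<r₂ (τ (suc n)))))}} (a-lower n) ⟩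
      Q ℚ.* ρ′ ℚ.* (ρ ℚ.* A)                  ≡⟨ solve 4 (λ x y z w → x :* y :* (z :* w) := (z :* y) :* (x :* w)) refl Q ρ′ ρ A ⟩
      (ρ ℚ.* ρ′) ℚ.* (Q ℚ.* A)                ≡⟨ cong₂ ℚ._*_ (r₂-consecutive n) (sym ∣q-suc∣) ⟩
      ½ ℚ.* ∣ q a (suc n) ∣₂                  ∎
      where
      open ℚ.≤-Reasoning
      ρ′ = r₂ (τ (suc n))

  ∣q∣ : ∀ n → ∣ q a n ∣₂ ≡ 2^ (ℤ.- valuationSum a n)
  ∣q∣ n = proj₁ (∣q∣-and-growth n)

  1≤∣q∣ : ∀ n → 1ℚ ℚ.≤ 2^ (ℤ.- valuationSum a n)
  1≤∣q∣ zero    = ℚ.≤-refl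
  1≤∣q∣ (suc n) = ℚ.≤-trans (*-mono-≤ (ℚ.<⇒≤ 0<1) (∣∣₂-nonNeg (a (suc n))) (1≤∣q∣ n) (1≤∣a∣ n)) (ℚ.≤-reflexive (sym (2^-valuationSum-suc n)))

  Λ-upper : ∀ n → ∥ Λ n ∥≤ 2^ (valuationSum a (suc n))
  Λ-upper n = ∥∥-Λ n (P-bound (suc n))

  Λ≤q : ∀ n → ∥ Λ n ∥≤ ∣ q a n ∣₂
  Λ≤q n = atMost-weaken (ℚ.≤-trans small (ℚ.≤-trans (1≤∣q∣ n) (ℚ.≤-reflexive (sym (∣q∣ n))))) (Λ-upper n)
    where
    s = valuationSum a (suc n)
    small : 2^ s ℚ.≤ 1ℚ
    small = ℚ.≤-trans (ℚ.≤-reflexive (sym (ℚ.*-identityˡ (2^ s)))) (ℚ.≤-trans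
      (ℚ.*-monoʳ-≤-nonNeg (2^ s) {{ℚ.nonNegative (ℚ.<⇒≤ (2^-positive s))}} (1≤∣q∣ (suc n))) (ℚ.≤-reflexive (2^-inverse s)))

  Θ-upper : ∀ n → q a n ≢ 0ℚ → ∥ Θ n ∥≤ 2^ (valuationSum a n) ℚ.* 2^ (valuationSum a (suc n))
  Θ-upper n q≢0 = atMost-weaken (ℚ.≤-reflexive (cong (ℚ._* 2^ (valuationSum a (suc n))) (∣1÷∣₂ (valuationSum a n) q≢0 (∣q∣ n))))
    (∥∥-Θ n q≢0 (Λ-upper n))

open QuadraticField using (Carrier; rawRing; Rational)
open Algorithm using (PropertyI; IsExpansion)

-- Products over the two places

-- The gap between u v and z is halved: one half absorbs the approximation, the other witnesses
-- strictness.
product-upper : ∀ {x : ℝ} {y : ℚ₂} {u v z} → AtMost x u → AtMost y v → u ℚ.* v ℚ.< z → ∥ x ∥ * ∥ y ∥ < fromℚ z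
product-upper {x} {y} {u} {v} {z} (mkAtMost B) (mkAtMost C) uv<z =
  let 0<δ = half-positive (gap-positive uv<z)
      (N , h) = Bound.bound (bound-* (λ n → ℚ.0≤∣p∣ (seq x n)) (λ n → ∣∣₂-nonNeg (seq y n)) B C) δ 0<δ in
  δ , 0<δ , N , λ n le → ℚ.≤-trans (ℚ.+-monoˡ-≤ δ (h n le))
    (ℚ.≤-reflexive (solve 2 (λ s z → (s :+ con ½ :* (z :- s)) :+ con ½ :* (z :- s) := z) refl (u ℚ.* v) z))
  where δ = ½ ℚ.* (z ℚ.- u ℚ.* v)

-- The number d occurs both as the value to be exceeded and as the margin of strictness, hence the 2
-- in the normalisation.
product-lower : ∀ {x : ℝ} {y : ℚ₂} {f f₂ k k₂ d} → 0ℚ ℚ.< k → 0ℚ ℚ.< k₂ → 0ℚ ℚ.≤ f₂ → 1ℚ ℚ.≤ f ℚ.* f₂ → 0ℚ ℚ.< d →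
  fromℕ 2 ℚ.* d ℚ.* (k ℚ.* k₂) ≡ 1ℚ →
  Eventually (λ n → f ℚ.≤ k ℚ.* ℚ.∣ seq x n ∣) → Eventually (λ n → f₂ ℚ.≤ k₂ ℚ.* ∣ seq y n ∣₂) →
  ∀ {z : ℝ} → (∀ n → seq z n ≡ d) → z < ∥ x ∥ * ∥ y ∥
product-lower {x} {y} {f} {f₂} {k} {k₂} {d} 0<k 0<k₂ 0≤f₂ 1≤ff₂ 0<d dkk₂≡1 X Y {z} z≡d = d , 0<d , eventually-map₂ close X Y
  where
  open ℚ.≤-Reasoning
  close : ∀ n → f ℚ.≤ k ℚ.* ℚ.∣ seq x n ∣ → f₂ ℚ.≤ k₂ ℚ.* ∣ seq y n ∣₂ → seq z n ℚ.+ d ℚ.≤ ℚ.∣ seq x n ∣ ℚ.* ∣ seq y n ∣₂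
  close n h h₂ = *-cancelʳ-≤ (k ℚ.* k₂) (*-positive 0<k 0<k₂) (begin
    (seq z n ℚ.+ d) ℚ.* (k ℚ.* k₂)                          ≡⟨ cong (λ e → (e ℚ.+ d) ℚ.* (k ℚ.* k₂)) (z≡d n) ⟩
    (d ℚ.+ d) ℚ.* (k ℚ.* k₂)                                ≡⟨ solve 2 (λ d k → (d :+ d) :* k := con (fromℕ 2) :* d :* k) refl d (k ℚ.* k₂) ⟩
    fromℕ 2 ℚ.* d ℚ.* (k ℚ.* k₂)                            ≡⟨ dkk₂≡1 ⟩
    1ℚ                                                      ≤⟨ 1≤ff₂ ⟩
    f ℚ.* f₂                                                ≤⟨ ℚ.*-monoʳ-≤-nonNeg f₂ {{ℚ.nonNegative 0≤f₂}} h ⟩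
    (k ℚ.* s) ℚ.* f₂                                        ≤⟨ ℚ.*-monoˡ-≤-nonNeg (k ℚ.* s) {{ℚ.nonNegative (*-nonNeg (ℚ.<⇒≤ 0<k) (ℚ.0≤∣p∣ (seq x n)))}} h₂ ⟩
    (k ℚ.* s) ℚ.* (k₂ ℚ.* s₂)                               ≡⟨ solve 4 (λ k x l y → (k :* x) :* (l :* y) := (x :* y) :* (k :* l)) refl k s k₂ s₂ ⟩
    (s ℚ.* s₂) ℚ.* (k ℚ.* k₂)                               ∎)
    where
    s = ℚ.∣ seq x n ∣
    s₂ = ∣ seq y n ∣₂

-- The origin of 1 + τ(n) in the theorem: it is the reciprocal of the real bound for α₍ₙ₊₁₎.
r∞-τ : ∀ e → r∞ e ℚ.* (1ℚ ℚ.+ fromℕ (toℕ e)) ≡ 1ℚ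
r∞-τ zero       = refl
r∞-τ (suc zero) = refl

-- Both estimates for a given expansion

module Expansion (K : QuadraticField κ ℓ)
  (σ∞ : Carrier K → ℝ) (hom∞ : IsRingHomomorphism (rawRing K) ℝ-ring σ∞)
  (σ₂ : Carrier K → ℚ₂) (hom₂ : IsRingHomomorphism (rawRing K) ℚ₂-ring σ₂)
  (α : Carrier K) (irr : ¬ Rational K α) (propertyI : PropertyI K σ∞ σ₂ α)
  (αs : ℕ → Carrier K) (a : ℕ → ℚ) (E : IsExpansion K σ∞ σ₂ α αs a) where

  open Field K hiding (Carrier; Rational)
  open IsExpansion E

  β : ℕ → Carrier K
  β n = αs (suc n)

  step-β : ∀ n → β (suc n) ≈ᴷ β n ⁻¹ -ᴷ ι (a (suc n))
  step-β n = step (suc n) (s≤s z≤n)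

  irrational : ∀ n → ¬ Rational K (β n)
  irrational zero (r , e) = irr (r , ≈ᴷ-trans (≈ᴷ-sym initial) e)
  irrational (suc n) = irrational-step (irrational n) (step-β n)

  quotients : CompleteQuotients β a
  quotients = record { irrational = irrational ; step = step-β }

  module B∞ = Bounds K β a quotients σ∞ hom∞
  module B₂ = Bounds K β a quotients σ₂ hom₂

  -- Property I supplies the case n = 0: since τ(0) = 0, the required bounds are 1 at the real place
  -- and ½ at the 2-adic one. Later cases come from the choice of the partial quotient.
  β-bound∞ : ∀ n → B∞.∥ β n ∥≤ r∞ (τ n)
  β-bound∞ zero = B∞.∥∥-cong (≈ᴷ-sym initial) (unit-interval-bound (σ∞ α) (proj₁ propertyI) (proj₁ (proj₂ propertyI)))
  β-bound∞ (suc n) = let (r , m , _ , (minimal , _) , a≡) = quotient (suc n) (s≤s z≤n) ; e = τ (suc n) in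
    B∞.∥∥-cong (≈ᴷ-sym (step-β n)) (atMost-≈
      (≈-sym (σ∞ (β n ⁻¹ -ᴷ ι (a (suc n)))) (σ∞ (β n ⁻¹) - fromℚ (a (suc n))) (B∞.σ-minus-ι (β n ⁻¹) (a (suc n))))
      (subst₂ (λ z → AtMost (σ∞ (β n ⁻¹) - fromℚ z)) (sym a≡) (r∞-stride e)
        (minimizer-bound (σ∞ (β n ⁻¹)) (stride e) m r (0<stride e) minimal)))

  β-bound₂ : ∀ n → B₂.∥ β n ∥≤ r₂ (τ n)
  β-bound₂ zero = B₂.∥∥-cong (≈ᴷ-sym initial) (positiveValuation-bound (σ₂ α) (proj₂ (proj₂ propertyI)))
  β-bound₂ (suc n) = let (r , m , isFloor , _ , a≡) = quotient (suc n) (s≤s z≤n) ; e = τ (suc n) in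
    B₂.∥∥-cong (≈ᴷ-sym (step-β n)) (atMost-≈
      (≈-sym (σ₂ (β n ⁻¹ -ᴷ ι (a (suc n)))) (σ₂ (β n ⁻¹) - fromℚ (a (suc n))) (B₂.σ-minus-ι (β n ⁻¹) (a (suc n))))
      (subst (λ z → AtMost (σ₂ (β n ⁻¹) - fromℚ z) (r₂ e)) (sym a≡) (floor-stride-bound (σ₂ (β n ⁻¹)) e m isFloor)))

  a-dyadic : ∀ n → Dyadic (a (suc n))
  a-dyadic n = let (r , m , isFloor , _ , a≡) = quotient (suc n) (s≤s z≤n) in
    subst Dyadic (sym a≡) (dyadic-+ (dyadic-fromℤ (stride (τ (suc n)) ℤ.* m)) (floor-dyadic (σ₂ (β n ⁻¹)) isFloor))

  module C∞ = RealBounds K β a quotients σ∞ hom∞ β-bound∞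
  module C₂ = DyadicBounds K β a quotients σ₂ hom₂ β-bound₂

  x∞ : ℕ → ℝ
  x∞ n = σ∞ α - fromℚ (convergent a n)

  x₂ : ℕ → ℚ₂
  x₂ n = σ₂ α - fromℚ (convergent a n)

  Θ≈-α : ∀ n → B∞.Θ n ≈ᴷ α -ᴷ ι (convergent a n)
  Θ≈-α n = +ᴷ-cong initial ≈ᴷ-refl

  Θ≈x∞ : ∀ n → σ∞ (B∞.Θ n) ≈ x∞ n
  Θ≈x∞ n = ≈-trans (σ∞ (B∞.Θ n)) (σ∞ (α -ᴷ ι (convergent a n))) (x∞ n) (B∞.σ-cong (Θ≈-α n)) (B∞.σ-minus-ι α (convergent a n))

  Θ≈x₂ : ∀ n → σ₂ (B∞.Θ n) ≈ x₂ n
  Θ≈x₂ n = ≈-trans (σ₂ (B∞.Θ n)) (σ₂ (α -ᴷ ι (convergent a n))) (x₂ n) (B₂.σ-cong (Θ≈-α n)) (B₂.σ-minus-ι α (convergent a n))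

  H : ℕ → ℚ
  H n = ℚ.∣ q′ a n ∣ ^ 2

  -- The power of 2 that turns q into q′ is ∣q∣₂, so ∣q′∣ = ∣q∣∣q∣₂. This is how estimates at two
  -- places combine into one in q′².
  H≡ : ∀ n → H n ≡ (ℚ.∣ q a n ∣ ℚ.* ∣ q a n ∣₂) ℚ.* (ℚ.∣ q a n ∣ ℚ.* ∣ q a n ∣₂)
  H≡ n = trans (cong (ℚ.∣ q′ a n ∣ ℚ.*_) (ℚ.*-identityʳ ℚ.∣ q′ a n ∣)) (cong₂ ℚ._*_ ∣q′∣ ∣q′∣)
    where
    t = 2^ (ℤ.- valuationSum a n)
    ∣q′∣ : ℚ.∣ q′ a n ∣ ≡ ℚ.∣ q a n ∣ ℚ.* ∣ q a n ∣₂
    ∣q′∣ = trans (ℚ.∣p*q∣≡∣p∣*∣q∣ t (q a n)) (trans (ℚ.*-comm ℚ.∣ t ∣ ℚ.∣ q a n ∣)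
      (cong (ℚ.∣ q a n ∣ ℚ.*_) (trans (∣2^∣ (ℤ.- valuationSum a n)) (sym (C₂.∣q∣ n)))))

  0<∣q∣∞ : ∀ n → 0ℚ ℚ.< ℚ.∣ q a n ∣
  0<∣q∣∞ n = ≢0⇒∣∣-positive archimedean (C∞.q≢0 n)

  0<∣q∣₂ : ∀ n → 0ℚ ℚ.< ∣ q a n ∣₂
  0<∣q∣₂ n = ≢0⇒∣∣-positive dyadic (C∞.q≢0 n)

  0<H : ∀ n → 0ℚ ℚ.< H n
  0<H n = subst (0ℚ ℚ.<_) (sym (H≡ n)) (*-positive 0<qq 0<qq)
    where 0<qq = *-positive (0<∣q∣∞ n) (0<∣q∣₂ n)

  upper : ∀ n → ∥ x∞ n ∥ * ∥ x₂ n ∥ < fromℚ (2ℚ ÷ ((1ℚ ℚ.+ fromℕ (toℕ (τ n))) ℚ.* ∣ a (suc n) ∣₂ ℚ.* H n))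
  upper n = product-upper {x∞ n} {x₂ n} (atMost-≈ (Θ≈x∞ n) (C∞.Θ-upper n)) (atMost-≈ (Θ≈x₂ n) (C₂.Θ-upper n (C∞.q≢0 n)))
    (<-÷ (*-positive (*-positive 0<T (ℚ.<-≤-trans 0<1 (C₂.1≤∣a∣ n))) (0<H n))
      (subst (ℚ._< 2ℚ) (sym simplified) (<-from-gap (½ ^ n) (^-positive ½ 0<½ n)
        (solve 1 (λ h → (con (fromℕ 2) :- h) :+ h := con (fromℕ 2)) refl (½ ^ n)))))
    where
    open ≡-Reasoning
    i = ℚ.∣ 1ℚ ÷ q a n ∣
    T = 1ℚ ℚ.+ fromℕ (toℕ (τ n))
    ρ = r∞ (τ n)
    s = 2^ (valuationSum a n)
    t = 2^ (valuationSum a (suc n))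
    A = ∣ a (suc n) ∣₂
    Q = ℚ.∣ q a n ∣
    Q₂ = ∣ q a n ∣₂
    g = fromℕ 2 ℚ.- ½ ^ n
    0<T : 0ℚ ℚ.< T
    0<T = go (τ n)
      where
      go : ∀ e → 0ℚ ℚ.< 1ℚ ℚ.+ fromℕ (toℕ e)
      go zero       = 0<1
      go (suc zero) = ℚ.positive⁻¹ (fromℕ 2)
    iQ : i ℚ.* Q ≡ 1ℚ
    iQ = trans (sym (ℚ.∣p*q∣≡∣p∣*∣q∣ (1ℚ ÷ q a n) (q a n))) (cong ℚ.∣_∣ (÷-* 1ℚ (C∞.q≢0 n)))
    Q₂s : Q₂ ℚ.* s ≡ 1ℚ
    Q₂s = trans (cong (ℚ._* s) (C₂.∣q∣ n)) (2^-inverse (valuationSum a n))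
    Q₂At : (Q₂ ℚ.* A) ℚ.* t ≡ 1ℚ
    Q₂At = trans (cong (ℚ._* t) (trans (cong (ℚ._* A) (C₂.∣q∣ n)) (sym (C₂.2^-valuationSum-suc n)))) (2^-inverse (valuationSum a (suc n)))
    simplified : (i ℚ.* (i ℚ.* (g ℚ.* ρ))) ℚ.* (s ℚ.* t) ℚ.* (T ℚ.* A ℚ.* H n) ≡ g
    simplified = begin
      (i ℚ.* (i ℚ.* (g ℚ.* ρ))) ℚ.* (s ℚ.* t) ℚ.* (T ℚ.* A ℚ.* H n)
        ≡⟨ cong (λ z → (i ℚ.* (i ℚ.* (g ℚ.* ρ))) ℚ.* (s ℚ.* t) ℚ.* (T ℚ.* A ℚ.* z)) (H≡ n) ⟩
      (i ℚ.* (i ℚ.* (g ℚ.* ρ))) ℚ.* (s ℚ.* t) ℚ.* (T ℚ.* A ℚ.* ((Q ℚ.* Q₂) ℚ.* (Q ℚ.* Q₂)))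
        -- Every factor meets its inverse: 1/q and q twice, `ρ` and 1 + τ(n), `s` and ∣qₙ∣₂, `t` and
        -- ∣qₙ∣₂∣aₙ₊₁∣₂.
        ≡⟨ solve 9 (λ i g ρ s t T A Q Q₂ → (i :* (i :* (g :* ρ))) :* (s :* t) :* (T :* A :* ((Q :* Q₂) :* (Q :* Q₂)))
             := g :* ((i :* Q) :* (i :* Q) :* ((ρ :* T) :* ((Q₂ :* s) :* ((Q₂ :* A) :* t))))) refl i g ρ s t T A Q Q₂ ⟩
      g ℚ.* ((i ℚ.* Q) ℚ.* (i ℚ.* Q) ℚ.* ((ρ ℚ.* T) ℚ.* ((Q₂ ℚ.* s) ℚ.* ((Q₂ ℚ.* A) ℚ.* t))))
        ≡⟨ cong₂ (λ u v → g ℚ.* (u ℚ.* u ℚ.* v)) iQ (cong₂ ℚ._*_ (r∞-τ (τ n)) (cong₂ ℚ._*_ Q₂s Q₂At)) ⟩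
      g ℚ.* 1ℚ
        ≡⟨ ℚ.*-identityʳ g ⟩
      g ∎

  equation : B∞.QuadraticEquation (β 0)
  equation = B∞.quadraticEquation (irrational 0)

  open B∞.QuadraticEquation equation using (A)

  slope : Carrier K
  slope = B∞.Liouville.slope equation

  slope∞ : ∃ λ b → 0ℚ ℚ.< b × B∞.∥ slope ∥≤ b
  slope∞ = atMost-some (σ∞ slope)

  slope₂ : ∃ λ b → 0ℚ ℚ.< b × B₂.∥ slope ∥≤ b
  slope₂ = atMost-some (σ₂ slope)

  M∞ M₂ : ℚ
  M∞ = proj₁ slope∞ ℚ.+ ℚ.∣ A ∣
  M₂ = proj₁ slope₂ ℚ.+ ∣ A ∣₂

  0<M : 0ℚ ℚ.< fromℕ 32 ℚ.* (M∞ ℚ.* M₂)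
  0<M = *-positive (ℚ.positive⁻¹ (fromℕ 32)) (*-positive
    (ℚ.+-mono-<-≤ (proj₁ (proj₂ slope∞)) (ℚ.0≤∣p∣ A)) (ℚ.+-mono-<-≤ (proj₁ (proj₂ slope₂)) (∣∣₂-nonNeg A)))

  -- 32 = 4 · 4 · 2: a 4 from the cofactor estimate at each place and a 2 for the strict inequality.
  -- `M∞` and `M₂` come from a fixed equation for α, so n does not enter.
  C : ℚ
  C = 1ℚ ÷ (fromℕ 32 ℚ.* (M∞ ℚ.* M₂))

  0<C : 0ℚ ℚ.< C
  0<C = ÷-positive 0<1 0<M

  lower : ∀ n → fromℚ C * fromℚ (1ℚ ÷ H n) < ∥ x∞ n ∥ * ∥ x₂ n ∥
  lower n = product-lower {x∞ n} {x₂ n}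
    (*-positive (ℚ.positive⁻¹ (fromℕ 4)) (*-positive (*-positive (0<∣q∣∞ n) (0<∣q∣∞ n)) (ℚ.+-mono-<-≤ (proj₁ (proj₂ slope∞)) (ℚ.0≤∣p∣ A))))
    (*-positive (ℚ.positive⁻¹ (fromℕ 4)) (*-positive (*-positive (0<∣q∣₂ n) (0<∣q∣₂ n)) (ℚ.+-mono-<-≤ (proj₁ (proj₂ slope₂)) (∣∣₂-nonNeg A))))
    (∣∣₂-nonNeg norm)
    -- The norm form is the same rational number at both places, which is what allows the product
    -- formula to be applied.
    (dyadic-product (B∞.Norm.norm-dyadic (irrational 0) equation (p a n) (q a n) (proj₁ dpq) (proj₂ dpq)) (B∞.Liouville.norm≢0 equation n (C∞.q≢0 n)))
    (*-positive 0<C (÷-positive 0<1 (0<H n)))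
    simplified
    (B∞.Liouville.norm-lower equation n (C∞.q≢0 n) (C∞.Λ≤q n) (proj₁ (proj₂ slope∞)) (proj₂ (proj₂ slope∞)) (x∞ n) (≈-sym (σ∞ (B∞.Θ n)) (x∞ n) (Θ≈x∞ n)))
    (B₂.Liouville.norm-lower equation n (C∞.q≢0 n) (C₂.Λ≤q n) (proj₁ (proj₂ slope₂)) (proj₂ (proj₂ slope₂)) (x₂ n) (≈-sym (σ₂ (B∞.Θ n)) (x₂ n) (Θ≈x₂ n)))
    {fromℚ C * fromℚ (1ℚ ÷ H n)} (λ _ → refl)
    where
    open ≡-Reasoning
    norm = B∞.Liouville.norm equation n
    dpq = proj₂ (convergents-dyadic a a-dyadic n)
    Q = ℚ.∣ q a n ∣
    Q₂ = ∣ q a n ∣₂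
    G = 1ℚ ÷ H n
    simplified : fromℕ 2 ℚ.* (C ℚ.* G) ℚ.* ((fromℕ 4 ℚ.* (Q ℚ.* Q ℚ.* M∞)) ℚ.* (fromℕ 4 ℚ.* (Q₂ ℚ.* Q₂ ℚ.* M₂))) ≡ 1ℚ
    simplified = begin
      fromℕ 2 ℚ.* (C ℚ.* G) ℚ.* ((fromℕ 4 ℚ.* (Q ℚ.* Q ℚ.* M∞)) ℚ.* (fromℕ 4 ℚ.* (Q₂ ℚ.* Q₂ ℚ.* M₂)))
        ≡⟨ solve 6 (λ C G Q Q₂ M N → con (fromℕ 2) :* (C :* G) :* ((con (fromℕ 4) :* (Q :* Q :* M)) :* (con (fromℕ 4) :* (Q₂ :* Q₂ :* N)))
             := (C :* (con (fromℕ 32) :* (M :* N))) :* (G :* ((Q :* Q₂) :* (Q :* Q₂)))) refl C G Q Q₂ M∞ M₂ ⟩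
      (C ℚ.* (fromℕ 32 ℚ.* (M∞ ℚ.* M₂))) ℚ.* (G ℚ.* ((Q ℚ.* Q₂) ℚ.* (Q ℚ.* Q₂)))
        ≡⟨ cong₂ ℚ._*_ (÷-* 1ℚ (positive⇒≢0 0<M)) (trans (cong (G ℚ.*_) (sym (H≡ n))) (÷-* 1ℚ (positive⇒≢0 (0<H n)))) ⟩
      1ℚ ∎

theorem3p21 : {c ℓ : Level} (K : QuadraticField c ℓ)
    (σ∞ : Carrier K → ℝ) → IsRingMonomorphism (rawRing K) ℝ-ring σ∞ →
    (σ₂ : Carrier K → ℚ₂) → IsRingMonomorphism (rawRing K) ℚ₂-ring σ₂ →
    (α : Carrier K) → ¬ Rational K α → PropertyI K σ∞ σ₂ α →
    (αs : ℕ → Carrier K) (a : ℕ → ℚ) → IsExpansion K σ∞ σ₂ α αs a →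
    ∃ λ (C : ℝ) → fromℚ 0ℚ < C × (∀ n → 1 ℕ.≤ n →
    C * fromℚ (1ℚ ÷ ℚ.∣ q′ a n ∣ ^ 2)
    < ∥ σ∞ α - fromℚ (p′ a n ÷ q′ a n) ∥ * ∥ σ₂ α - fromℚ (p′ a n ÷ q′ a n) ∥
    × ∥ σ∞ α - fromℚ (p′ a n ÷ q′ a n) ∥ * ∥ σ₂ α - fromℚ (p′ a n ÷ q′ a n) ∥
    < fromℚ (2ℚ ÷ ((1ℚ ℚ.+ fromℕ (toℕ (τ n))) ℚ.* ∣ a (suc n) ∣₂ ℚ.* ℚ.∣ q′ a n ∣ ^ 2)))
theorem3p21 K σ∞ mono∞ σ₂ mono₂ α irr propertyI αs a expansion =
  fromℚ C , (C , 0<C , 0 , λ _ _ → ℚ.≤-reflexive (ℚ.+-identityˡ C)) , λ n _ → lower n , upper n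
  where
  open Expansion K σ∞ (IsRingMonomorphism.isRingHomomorphism mono∞) σ₂ (IsRingMonomorphism.isRingHomomorphism mono₂)
    α irr propertyI αs a expansion
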